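{- Let $\mathbb{K}$ be a field. If $\Omega$ is a nondegenerate extended diassociative semigroup (EDS), there exists a unique coproduct $\Delta$ on the dendriform algebra $\mathbb{K}\Omega\otimes\mathbb{K}\mathcal{T}_\Omega^+$ making it a dendriform bialgebra, such that $\Delta(\alpha\otimes Y)=0$ for all $\alpha\in\Omega$, where $Y$ is the tree with exactly one internal vertex. Moreover, this dendriform bialgebra is graded by the number of internal vertices.
   Context: Extended diassociative semigroups. A diassociative semigroup is a set $\Omega$ with maps $\leftarrow,\rightarrow:\Omega\times\Omega\to\Omega$ such that for all $\alpha,\beta,\gamma\in\Omega$: $(\alpha\leftarrow\beta)\leftarrow\gamma=\alpha\leftarrow(\beta\leftarrow\gamma)=\alpha\leftarrow(\beta\rightarrow\gamma)$; $(\alpha\rightarrow\beta)\leftarrow\gamma=\alpha\rightarrow(\beta\leftarrow\gamma)$; $(\alpha\rightarrow\beta)\rightarrow\gamma=(\alpha\leftarrow\beta)\rightarrow\gamma=\alpha\rightarrow(\beta\rightarrow\gamma)$. An extended diassociative semigroup (EDS) is $(\Omega,\leftarrow,\rightarrow,\triangleleft,\triangleright)$ such that $(\Omega,\leftarrow,\rightarrow)$ is a diassociative semigroup and for all $\alpha,\beta,\gamma\in\Omega$: $\alpha\triangleright(\beta\leftarrow\gamma)=\alpha\triangleright\beta$; $(\alpha\rightarrow\beta)\triangleleft\gamma=\beta\triangleleft\gamma$; $(\alpha\triangleleft\beta)\leftarrow((\alpha\leftarrow\beta)\triangleleft\gamma)=\alpha\triangleleft(\beta\leftarrow\gamma)$;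 $(\alpha\triangleleft\beta)\triangleleft((\alpha\leftarrow\beta)\triangleleft\gamma)=\beta\triangleleft\gamma$; $(\alpha\triangleleft\beta)\rightarrow((\alpha\leftarrow\beta)\triangleleft\gamma)=\alpha\triangleleft(\beta\rightarrow\gamma)$; $(\alpha\triangleleft\beta)\triangleright((\alpha\leftarrow\beta)\triangleleft\gamma)=\beta\triangleright\gamma$; $(\alpha\triangleright(\beta\rightarrow\gamma))\leftarrow(\beta\triangleright\gamma)=(\alpha\leftarrow\beta)\triangleright\gamma$; $(\alpha\triangleright(\beta\rightarrow\gamma))\triangleleft(\beta\triangleright\gamma)=\alpha\triangleleft\beta$; $(\alpha\triangleright(\beta\rightarrow\gamma))\rightarrow(\beta\triangleright\gamma)=(\alpha\rightarrow\beta)\triangleright\gamma$; $(\alpha\triangleright(\beta\rightarrow\gamma))\triangleright(\beta\triangleright\gamma)=\alpha\triangleright\beta$. It is nondegenerate if the maps $(\alpha,\beta)\mapsto(\alpha\leftarrow\beta,\alpha\triangleleft\beta)$ and $(\alpha,\beta)\mapsto(\alpha\rightarrow\beta,\alpha\triangleright\beta)$ from $\Omega^2$ to $\Omega^2$ are bijective. Typed trees. A plane binary tree is a rooted plane tree in which each internal vertex has a left and a right child; $|$ is the trivial tree. An $\Omega$-typed tree carries a map from its internal edges (edges between internal vertices) to $\Omega$. $\mathcal{T}_\Omega$ is the set of such trees, $\mathcal{T}^+_\Omega=\mathcal{T}_\Omega\setminus\{|\}$, $\mathbb{K}\mathcal{T}^+_\Omega$ the vector space with this basis. $T_1\bigvee_{\alpha,\beta}T_2$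 is the tree with left subtree $T_1$ and right subtree $T_2$ grafted on a common root, the edge to the root of $T_1$ having type $\alpha$ and the edge to the root of $T_2$ type $\beta$; $\alpha=\emptyset$ (an extra symbol) exactly when $T_1=|$, $\beta=\emptyset$ exactly when $T_2=|$. It is extended bilinearly. Products on $\mathbb{K}\mathcal{T}_\Omega^+$: for $T\in\mathcal{T}_\Omega^+$, $(T_1\bigvee_{\alpha,\emptyset}|)\prec_\gamma T=T_1\bigvee_{\alpha,\gamma}T$; $(T_1\bigvee_{\alpha,\beta}T_2)\prec_\gamma T=T_1\bigvee_{\alpha,\beta\leftarrow\gamma}(T_2\prec_{\beta\triangleleft\gamma}T)+T_1\bigvee_{\alpha,\beta\rightarrow\gamma}(T_2\succ_{\beta\triangleright\gamma}T)$ if $T_2\ne|$; $T\succ_\alpha(|\bigvee_{\emptyset,\gamma}T_2)=T\bigvee_{\alpha,\gamma}T_2$; $T\succ_\alpha(T_1\bigvee_{\beta,\gamma}T_2)=(T\succ_{\alpha\triangleright\beta}T_1)\bigvee_{\alpha\rightarrow\beta,\gamma}T_2+(T\prec_{\alpha\triangleleft\beta}T_1)\bigvee_{\alpha\leftarrow\beta,\gamma}T_2$ if $T_1\neq|$. The space $\mathbb{K}\Omega\otimes\mathbb{K}\mathcal{T}_\Omega^+$ is a dendriform algebra with $(\alpha\otimes x)\prec(\beta\otimes y)=(\alpha\leftarrow\beta)\otimes(x\prec_{\alpha\triangleleft\beta}y)$ and $(\alpha\otimes x)\succ(\beta\otimes y)=(\alpha\rightarrow\beta)\otimes(x\succ_{\alpha\triangleright\beta}y)$.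 Dendriform algebra: bilinear $\prec,\succ$ with $(x\prec y)\prec z=x\prec(y\prec z+y\succ z)$, $(x\succ y)\prec z=x\succ(y\prec z)$, $(x\prec y+x\succ y)\succ z=x\succ(y\succ z)$. A dendriform bialgebra is $(B,\prec,\succ,\Delta)$ with $(B,\prec,\succ)$ a dendriform algebra, $(B,\Delta)$ a coassociative (not necessarily counital) coalgebra such that, with $\Delta(x)=x'\otimes x''$ (Sweedler) and $\cdot=\prec+\succ$, for all $x,y\in B$: $\Delta(x\prec y)=x\otimes y+x'\prec y\otimes x''+x'\otimes x''\cdot y+x\prec y'\otimes y''+x'\prec y'\otimes x''\cdot y''$ and $\Delta(x\succ y)=y\otimes x+x'\succ y\otimes x''+y'\otimes x\cdot y''+x\succ y'\otimes y''+x'\succ y'\otimes x''\cdot y''$. -}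

module Defs where

open import Level using (Level; _⊔_; suc)
open import Algebra.Apartness.Bundles using (HeytingField; HeytingCommutativeRing)
open import Algebra.Bundles using (CommutativeMonoid; CommutativeRing)
open import Algebra.Module.Bundles using (Module)
open import Algebra.Module.Morphism.Structures using (module ModuleMorphisms)
open import Algebra.Module.Structures using (IsModule)
open import Algebra.Module.Structures.Biased using (IsModuleFromLeft)
import Algebra.Definitions.RawMonoid as RawMonoidSum
import Algebra.Properties.AbelianGroup as AbelianGroupProperties
import Algebra.Properties.CommutativeSemigroup as CommutativeSemigroupProperties
open import Data.Empty using (⊥)
open import Data.Fin.Base using (toℕ)
open import Data.Nat.Base as ℕ using (ℕ)
open import Data.Product.Base using (Σ-syntax; ∃; _×_; _,_)
open import Data.Vec.Functional using (Vector)
open import Function.Definitions using (Bijective)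
open import Relation.Binary.Core using (Rel)
open import Relation.Binary.PropositionalEquality.Core using (_≡_; refl)
import Relation.Binary.Reasoning.Setoid as SetoidReasoning
open import Relation.Unary using (Pred)

private
  variable
    x r m ℓm n ℓn p ℓp q ℓq s ℓs : Level

------------------------------------------------------------------------
-- Extended diassociative semigroups

record IsDiassociativeSemigroup {w} {Ω : Set w}
         (_⟵_ _⟶_ : Ω → Ω → Ω) : Set w where
  field
    ⟵-assoc    : ∀ α β γ → (α ⟵ β) ⟵ γ ≡ α ⟵ (β ⟵ γ)
    ⟵-absorbs  : ∀ α β γ → α ⟵ (β ⟵ γ) ≡ α ⟵ (β ⟶ γ)
    inner-assoc : ∀ α β γ → (α ⟶ β) ⟵ γ ≡ α ⟶ (β ⟵ γ)
    ⟶-absorbs  : ∀ α β γ → (α ⟶ β) ⟶ γ ≡ (α ⟵ β) ⟶ γ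
    ⟶-assoc    : ∀ α β γ → (α ⟵ β) ⟶ γ ≡ α ⟶ (β ⟶ γ)

record IsEDS {w} {Ω : Set w}
         (_⟵_ _⟶_ _◃_ _▹_ : Ω → Ω → Ω) : Set w where
  field
    isDiassociativeSemigroup : IsDiassociativeSemigroup _⟵_ _⟶_
    ▹-⟵  : ∀ α β γ → α ▹ (β ⟵ γ) ≡ α ▹ β
    ⟶-◃  : ∀ α β γ → (α ⟶ β) ◃ γ ≡ β ◃ γ
    ◃-⟵-◃ : ∀ α β γ → (α ◃ β) ⟵ ((α ⟵ β) ◃ γ) ≡ α ◃ (β ⟵ γ)
    ◃-◃-◃ : ∀ α β γ → (α ◃ β) ◃ ((α ⟵ β) ◃ γ) ≡ β ◃ γ
    ◃-⟶-◃ : ∀ α β γ → (α ◃ β) ⟶ ((α ⟵ β) ◃ γ) ≡ α ◃ (β ⟶ γ)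
    ◃-▹-◃ : ∀ α β γ → (α ◃ β) ▹ ((α ⟵ β) ◃ γ) ≡ β ▹ γ
    ▹-⟵-▹ : ∀ α β γ → (α ▹ (β ⟶ γ)) ⟵ (β ▹ γ) ≡ (α ⟵ β) ▹ γ
    ▹-◃-▹ : ∀ α β γ → (α ▹ (β ⟶ γ)) ◃ (β ▹ γ) ≡ α ◃ β
    ▹-⟶-▹ : ∀ α β γ → (α ▹ (β ⟶ γ)) ⟶ (β ▹ γ) ≡ (α ⟶ β) ▹ γ
    ▹-▹-▹ : ∀ α β γ → (α ▹ (β ⟶ γ)) ▹ (β ▹ γ) ≡ α ▹ β

record EDS (w : Level) : Set (suc w) where
  infixl 7 _⟵_ _⟶_ _◃_ _▹_
  field
    Carrier : Set w
    _⟵_ _⟶_ _◃_ _▹_ : Carrier → Carrier → Carrier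
    isEDS   : IsEDS _⟵_ _⟶_ _◃_ _▹_

record Nondegenerate {w} (Ω : EDS w) : Set w where
  open EDS Ω
  field
    left-bijective  : Bijective {A = Carrier × Carrier} {B = Carrier × Carrier}
                        _≡_ _≡_ λ (α , β) → α ⟵ β , α ◃ β
    right-bijective : Bijective {A = Carrier × Carrier} {B = Carrier × Carrier}
                        _≡_ _≡_ λ (α , β) → α ⟶ β , α ▹ β

------------------------------------------------------------------------
-- Modules over a commutative ring: linear maps, modules given by
-- generators and relations, free modules, tensor products

module LinearAlgebra {c ℓ} (R : CommutativeRing c ℓ) where

  private
    module R = CommutativeRing R

  open Module using () renaming (Carrierᴹ to ∣_∣) public

  record LinearMap (M : Module R m ℓm) (N : Module R n ℓn)
         : Set (c ⊔ m ⊔ ℓm ⊔ n ⊔ ℓn) where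
    private
      module M = Module M
      module N = Module N
    infixl 20 _$_
    field
      _$_ : ∣ M ∣ → ∣ N ∣
      isModuleHomomorphism :
        ModuleMorphisms.IsModuleHomomorphism M.rawModule N.rawModule _$_
    open ModuleMorphisms.IsModuleHomomorphism isModuleHomomorphism public

  open LinearMap using (_$_) public

  module _ {M : Module R m ℓm} {N : Module R n ℓn} where
    private
      module M = Module M
      module N = Module N
    open SetoidReasoning N.≈ᴹ-setoid

    linearMap : (f : ∣ M ∣ → ∣ N ∣) →
                (∀ {u v} → u M.≈ᴹ v → f u N.≈ᴹ f v) →
                (∀ u v → f (u M.+ᴹ v) N.≈ᴹ f u N.+ᴹ f v) →
                (∀ a u → f (a M.*ₗ u) N.≈ᴹ a N.*ₗ f u) →
                LinearMap M N
    linearMap f f-cong f-+ f-* = record { _$_ = f ; isModuleHomomorphism = isHom }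
      where
      f-0 : f M.0ᴹ N.≈ᴹ N.0ᴹ
      f-0 = begin
        f M.0ᴹ               ≈⟨ f-cong (M.*ₗ-zeroˡ M.0ᴹ) ⟨
        f (R.0# M.*ₗ M.0ᴹ)   ≈⟨ f-* R.0# M.0ᴹ ⟩
        R.0# N.*ₗ f M.0ᴹ     ≈⟨ N.*ₗ-zeroˡ _ ⟩
        N.0ᴹ                 ∎

      f-neg : ∀ u → f (M.-ᴹ u) N.≈ᴹ N.-ᴹ f u
      f-neg u = AbelianGroupProperties.inverseˡ-unique N.+ᴹ-abelianGroup _ _ (begin
        f (M.-ᴹ u) N.+ᴹ f u  ≈⟨ f-+ (M.-ᴹ u) u ⟨
        f (M.-ᴹ u M.+ᴹ u)    ≈⟨ f-cong (M.-ᴹ‿inverseˡ u) ⟩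
        f M.0ᴹ               ≈⟨ f-0 ⟩
        N.0ᴹ                 ∎)

      abstract
        isHom : ModuleMorphisms.IsModuleHomomorphism M.rawModule N.rawModule f
        isHom = record
          { isBimoduleHomomorphism = record
            { +ᴹ-isGroupHomomorphism = record
              { isMonoidHomomorphism = record
                { isMagmaHomomorphism = record
                  { isRelHomomorphism = record { cong = f-cong }
                  ; homo = f-+
                  }
                ; ε-homo = f-0
                }
              ; ⁻¹-homo = f-neg
              }
            ; *ₗ-homo = f-*
            ; *ᵣ-homo = λ a u → begin
                f (u M.*ᵣ a)  ≈⟨ f-cong (M.*ₗ-*ᵣ-coincident a u) ⟨
                f (a M.*ₗ u)  ≈⟨ f-* a u ⟩
                a N.*ₗ f u    ≈⟨ N.*ₗ-*ᵣ-coincident a (f u) ⟩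
                f u N.*ᵣ a    ∎
            }
          }

  infix 4 _≋_
  _≋_ : {M : Module R m ℓm} {N : Module R n ℓn} → Rel (LinearMap M N) (m ⊔ ℓn)
  _≋_ {N = N} f g = ∀ u → f $ u ≈ᴹ g $ u
    where open Module N

  idₗ : (M : Module R m ℓm) → LinearMap M M
  idₗ M = linearMap (λ u → u) (λ u≈v → u≈v) (λ _ _ → ≈ᴹ-refl) (λ _ _ → ≈ᴹ-refl)
    where open Module M

  infixr 9 _∘ₗ_
  _∘ₗ_ : {M : Module R m ℓm} {N : Module R n ℓn} {P : Module R p ℓp} →
         LinearMap N P → LinearMap M N → LinearMap M P
  _∘ₗ_ {P = P} g f = linearMap (λ u → g $ (f $ u))
    (λ u≈v → g.⟦⟧-cong (f.⟦⟧-cong u≈v))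
    (λ u v → ≈ᴹ-trans (g.⟦⟧-cong (f.+ᴹ-homo u v)) (g.+ᴹ-homo _ _))
    (λ a u → ≈ᴹ-trans (g.⟦⟧-cong (f.*ₗ-homo a u)) (g.*ₗ-homo _ _))
    where
    open Module P
    module f = LinearMap f
    module g = LinearMap g

  -- The module of linear maps.  A bilinear map M × N → P is an element of
  -- LinearMap M (N ⊸ P).
  infixr 5 _⊸_
  _⊸_ : Module R m ℓm → Module R n ℓn → Module R (c ⊔ m ⊔ ℓm ⊔ n ⊔ ℓn) (m ⊔ ℓn)
  M ⊸ N = record
    { Carrierᴹ = LinearMap M N
    ; _≈ᴹ_     = _≋_
    ; _+ᴹ_     = add
    ; _*ₗ_     = scale
    ; _*ᵣ_     = λ f a → scale a f
    ; 0ᴹ       = zero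
    ; -ᴹ_      = neg
    ; isModule = isMod
    }
    where
    module N = Module N
    open SetoidReasoning N.≈ᴹ-setoid

    add : LinearMap M N → LinearMap M N → LinearMap M N
    add f g = linearMap (λ u → f $ u N.+ᴹ g $ u)
      (λ u≈v → N.+ᴹ-cong (f.⟦⟧-cong u≈v) (g.⟦⟧-cong u≈v))
      (λ u v → N.≈ᴹ-trans (N.+ᴹ-cong (f.+ᴹ-homo u v) (g.+ᴹ-homo u v))
                          (interchange _ _ _ _))
      (λ a u → N.≈ᴹ-trans (N.+ᴹ-cong (f.*ₗ-homo a u) (g.*ₗ-homo a u))
                          (N.≈ᴹ-sym (N.*ₗ-distribˡ _ _ _)))
      where
      module f = LinearMap f
      module g = LinearMap g
      open CommutativeSemigroupProperties
        (CommutativeMonoid.commutativeSemigroup N.+ᴹ-commutativeMonoid)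
        using (interchange)

    scale : R.Carrier → LinearMap M N → LinearMap M N
    scale a f = linearMap (λ u → a N.*ₗ f $ u)
      (λ u≈v → N.*ₗ-congˡ (f.⟦⟧-cong u≈v))
      (λ u v → N.≈ᴹ-trans (N.*ₗ-congˡ (f.+ᴹ-homo u v)) (N.*ₗ-distribˡ _ _ _))
      (λ b u → begin
        a N.*ₗ f $ (Module._*ₗ_ M b u)  ≈⟨ N.*ₗ-congˡ (f.*ₗ-homo b u) ⟩
        a N.*ₗ b N.*ₗ f $ u             ≈⟨ N.*ₗ-assoc _ _ _ ⟨
        (a R.* b) N.*ₗ f $ u            ≈⟨ N.*ₗ-congʳ (R.*-comm a b) ⟩
        (b R.* a) N.*ₗ f $ u            ≈⟨ N.*ₗ-assoc _ _ _ ⟩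
        b N.*ₗ a N.*ₗ f $ u             ∎)
      where module f = LinearMap f

    zero : LinearMap M N
    zero = linearMap (λ _ → N.0ᴹ) (λ _ → N.≈ᴹ-refl)
      (λ _ _ → N.≈ᴹ-sym (N.+ᴹ-identityˡ _)) (λ _ _ → N.≈ᴹ-sym (N.*ₗ-zeroʳ _))

    neg : LinearMap M N → LinearMap M N
    neg f = linearMap (λ u → N.-ᴹ f $ u)
      (λ u≈v → N.-ᴹ‿cong (f.⟦⟧-cong u≈v))
      (λ u v → N.≈ᴹ-trans (N.-ᴹ‿cong (f.+ᴹ-homo u v))
                          (N.≈ᴹ-sym (AG.⁻¹-∙-comm _ _)))
      (λ a u → N.≈ᴹ-sym (AG.inverseˡ-unique _ _ (begin
        a N.*ₗ (N.-ᴹ f $ u) N.+ᴹ f $ (Module._*ₗ_ M a u)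
          ≈⟨ N.+ᴹ-congˡ (f.*ₗ-homo a u) ⟩
        a N.*ₗ (N.-ᴹ f $ u) N.+ᴹ a N.*ₗ f $ u
          ≈⟨ N.*ₗ-distribˡ _ _ _ ⟨
        a N.*ₗ (N.-ᴹ f $ u N.+ᴹ f $ u)
          ≈⟨ N.*ₗ-congˡ (N.-ᴹ‿inverseˡ _) ⟩
        a N.*ₗ N.0ᴹ
          ≈⟨ N.*ₗ-zeroʳ a ⟩
        N.0ᴹ ∎)))
      where
      module f = LinearMap f
      module AG = AbelianGroupProperties N.+ᴹ-abelianGroup

    abstract
      isMod : IsModule R _≋_ add zero neg scale (λ f a → scale a f)
      isMod = IsModuleFromLeft.isModule record
        { isLeftModule = record
          { isLeftSemimodule = record
            { +ᴹ-isCommutativeMonoid = record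
              { isMonoid = record
                { isSemigroup = record
                  { isMagma = record
                    { isEquivalence = record
                      { refl  = λ _ → N.≈ᴹ-refl
                      ; sym   = λ f≈g u → N.≈ᴹ-sym (f≈g u)
                      ; trans = λ f≈g g≈h u → N.≈ᴹ-trans (f≈g u) (g≈h u)
                      }
                    ; ∙-cong = λ f≈f′ g≈g′ u → N.+ᴹ-cong (f≈f′ u) (g≈g′ u)
                    }
                  ; assoc = λ f g h u → N.+ᴹ-assoc _ _ _
                  }
                ; identity = (λ f u → N.+ᴹ-identityˡ _) , (λ f u → N.+ᴹ-identityʳ _)
                }
              ; comm = λ f g u → N.+ᴹ-comm _ _
              }
            ; isPreleftSemimodule = record
              { *ₗ-cong      = λ a≈b f≈g u → N.*ₗ-cong a≈b (f≈g u)
              ; *ₗ-zeroˡ     = λ f u → N.*ₗ-zeroˡ _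
              ; *ₗ-distribʳ  = λ f a b u → N.*ₗ-distribʳ _ _ _
              ; *ₗ-identityˡ = λ f u → N.*ₗ-identityˡ _
              ; *ₗ-assoc     = λ a b f u → N.*ₗ-assoc _ _ _
              ; *ₗ-zeroʳ     = λ a u → N.*ₗ-zeroʳ _
              ; *ₗ-distribˡ  = λ a f g u → N.*ₗ-distribˡ _ _ _
              }
            }
          ; -ᴹ‿cong    = λ f≈g u → N.-ᴹ‿cong (f≈g u)
          ; -ᴹ‿inverse = (λ f u → N.-ᴹ‿inverseˡ _) , (λ f u → N.-ᴹ‿inverseʳ _)
          }
        }

  flipₗ : {M : Module R m ℓm} {N : Module R n ℓn} {P : Module R p ℓp} →
          LinearMap M (N ⊸ P) → LinearMap N (M ⊸ P)
  flipₗ β = linearMap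
    (λ v → linearMap (λ u → β $ u $ v)
      (λ u≈u′ → β.⟦⟧-cong u≈u′ v) (λ u u′ → β.+ᴹ-homo u u′ v) (λ a u → β.*ₗ-homo a u v))
    (λ v≈v′ u → LinearMap.⟦⟧-cong (β $ u) v≈v′)
    (λ v v′ u → LinearMap.+ᴹ-homo (β $ u) v v′)
    (λ a v u → LinearMap.*ₗ-homo (β $ u) a v)
    where module β = LinearMap β

  composeₗ : {M : Module R m ℓm} {N : Module R n ℓn} {P : Module R p ℓp} →
             LinearMap (N ⊸ P) ((M ⊸ N) ⊸ (M ⊸ P))
  composeₗ {P = P} = linearMap
    (λ g → linearMap (g ∘ₗ_)
      (λ f≈f′ u → LinearMap.⟦⟧-cong g (f≈f′ u))
      (λ f f′ u → LinearMap.+ᴹ-homo g (f $ u) (f′ $ u))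
      (λ a f u → LinearMap.*ₗ-homo g a (f $ u)))
    (λ g≈g′ f u → g≈g′ (f $ u))
    (λ _ _ _ _ → Module.≈ᴹ-refl P)
    (λ _ _ _ _ → Module.≈ᴹ-refl P)

  -- (u , v) ↦ β (f u) (g v)
  precompose₂ : {M : Module R m ℓm} {N : Module R n ℓn} {P : Module R p ℓp}
                {Q : Module R q ℓq} {S : Module R s ℓs} →
                LinearMap P (Q ⊸ S) → LinearMap M P → LinearMap N Q →
                LinearMap M (N ⊸ S)
  precompose₂ β f g = flipₗ (flipₗ (β ∘ₗ f) ∘ₗ g)

  infixl 6 _⊕_
  infixr 7 _⊙_
  data Term (X : Set x) : Set (c ⊔ x) where
    gen : X → Term X
    𝟘   : Term X
    _⊕_ : Term X → Term X → Term X
    _⊙_ : R.Carrier → Term X → Term X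

  -- The least R-module congruence on formal linear combinations containing _∼_.
  data Generated {X : Set x} (_∼_ : Rel (Term X) r) : Rel (Term X) (c ⊔ ℓ ⊔ x ⊔ r) where
    relation   : ∀ {t u} → t ∼ u → Generated _∼_ t u
    ≈-refl     : ∀ {t} → Generated _∼_ t t
    ≈-sym      : ∀ {t u} → Generated _∼_ t u → Generated _∼_ u t
    ≈-trans    : ∀ {t u v} → Generated _∼_ t u → Generated _∼_ u v → Generated _∼_ t v
    ⊕-cong     : ∀ {t t′ u u′} → Generated _∼_ t t′ → Generated _∼_ u u′ →
                 Generated _∼_ (t ⊕ u) (t′ ⊕ u′)
    ⊕-assoc    : ∀ t u v → Generated _∼_ ((t ⊕ u) ⊕ v) (t ⊕ (u ⊕ v))
    ⊕-comm     : ∀ t u → Generated _∼_ (t ⊕ u) (u ⊕ t)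
    ⊕-identity : ∀ t → Generated _∼_ (𝟘 ⊕ t) t
    ⊙-cong     : ∀ {a b t u} → a R.≈ b → Generated _∼_ t u →
                 Generated _∼_ (a ⊙ t) (b ⊙ u)
    ⊙-assoc    : ∀ a b t → Generated _∼_ ((a R.* b) ⊙ t) (a ⊙ b ⊙ t)
    ⊙-identity : ∀ t → Generated _∼_ (R.1# ⊙ t) t
    ⊙-zero     : ∀ t → Generated _∼_ (R.0# ⊙ t) 𝟘
    ⊙-distribˡ : ∀ a t u → Generated _∼_ (a ⊙ (t ⊕ u)) (a ⊙ t ⊕ a ⊙ u)
    ⊙-distribʳ : ∀ t a b → Generated _∼_ ((a R.+ b) ⊙ t) (a ⊙ t ⊕ b ⊙ t)

  Presented : {X : Set x} → Rel (Term X) r → Module R (c ⊔ x) (c ⊔ ℓ ⊔ x ⊔ r)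
  Presented {X = X} _∼_ = record
    { Carrierᴹ = Term X
    ; _≈ᴹ_     = Generated _∼_
    ; _+ᴹ_     = _⊕_
    ; _*ₗ_     = _⊙_
    ; _*ᵣ_     = λ t a → a ⊙ t
    ; 0ᴹ       = 𝟘
    ; -ᴹ_      = λ t → (R.- R.1#) ⊙ t
    ; isModule = isMod
    }
    where
    inverseˡ : ∀ t → Generated _∼_ ((R.- R.1#) ⊙ t ⊕ t) 𝟘
    inverseˡ t =
      ≈-trans (⊕-cong ≈-refl (≈-sym (⊙-identity t)))
      (≈-trans (≈-sym (⊙-distribʳ t (R.- R.1#) R.1#))
      (≈-trans (⊙-cong (R.-‿inverseˡ R.1#) ≈-refl) (⊙-zero t)))

    abstract
      isMod : IsModule R (Generated _∼_) _⊕_ 𝟘 ((R.- R.1#) ⊙_) _⊙_ (λ t a → a ⊙ t)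
      isMod = IsModuleFromLeft.isModule record
        { isLeftModule = record
          { isLeftSemimodule = record
            { +ᴹ-isCommutativeMonoid = record
              { isMonoid = record
                { isSemigroup = record
                  { isMagma = record
                    { isEquivalence = record
                      { refl = ≈-refl ; sym = ≈-sym ; trans = ≈-trans }
                    ; ∙-cong = ⊕-cong
                    }
                  ; assoc = ⊕-assoc
                  }
                ; identity = ⊕-identity
                           , λ t → ≈-trans (⊕-comm t 𝟘) (⊕-identity t)
                }
              ; comm = ⊕-comm
              }
            ; isPreleftSemimodule = record
              { *ₗ-cong      = ⊙-cong
              ; *ₗ-zeroˡ     = ⊙-zero
              ; *ₗ-distribʳ  = ⊙-distribʳ
              ; *ₗ-identityˡ = ⊙-identity
              ; *ₗ-assoc     = ⊙-assoc
              ; *ₗ-zeroʳ     = λ a →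
                  ≈-trans (⊙-cong R.refl (≈-sym (⊙-zero 𝟘)))
                  (≈-trans (≈-sym (⊙-assoc a R.0# 𝟘))
                  (≈-trans (⊙-cong (R.zeroʳ a) ≈-refl) (⊙-zero 𝟘)))
              ; *ₗ-distribˡ  = ⊙-distribˡ
              }
            }
          ; -ᴹ‿cong    = ⊙-cong R.refl
          ; -ᴹ‿inverse = inverseˡ , λ t → ≈-trans (⊕-comm _ _) (inverseˡ t)
          }
        }

  module _ {X : Set x} (P : Module R p ℓp) where
    open Module P

    extend : (X → ∣ P ∣) → Term X → ∣ P ∣
    extend f (gen y) = f y
    extend f 𝟘       = 0ᴹ
    extend f (t ⊕ u) = extend f t +ᴹ extend f u
    extend f (a ⊙ t) = a *ₗ extend f t

    module _ (_∼_ : Rel (Term X) r) (f : X → ∣ P ∣)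
             (respects : ∀ {t u} → t ∼ u → extend f t ≈ᴹ extend f u) where

      extend-cong : ∀ {t u} → Generated _∼_ t u → extend f t ≈ᴹ extend f u
      extend-cong (relation t∼u)     = respects t∼u
      extend-cong ≈-refl             = ≈ᴹ-refl
      extend-cong (≈-sym e)          = ≈ᴹ-sym (extend-cong e)
      extend-cong (≈-trans e e′)     = ≈ᴹ-trans (extend-cong e) (extend-cong e′)
      extend-cong (⊕-cong e e′)      = +ᴹ-cong (extend-cong e) (extend-cong e′)
      extend-cong (⊕-assoc t u v)    = +ᴹ-assoc _ _ _
      extend-cong (⊕-comm t u)       = +ᴹ-comm _ _
      extend-cong (⊕-identity t)     = +ᴹ-identityˡ _
      extend-cong (⊙-cong a≈b e)     = *ₗ-cong a≈b (extend-cong e)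
      extend-cong (⊙-assoc a b t)    = *ₗ-assoc _ _ _
      extend-cong (⊙-identity t)     = *ₗ-identityˡ _
      extend-cong (⊙-zero t)         = *ₗ-zeroˡ _
      extend-cong (⊙-distribˡ a t u) = *ₗ-distribˡ _ _ _
      extend-cong (⊙-distribʳ t a b) = *ₗ-distribʳ _ _ _

      lift : LinearMap (Presented _∼_) P
      lift = linearMap (extend f) extend-cong (λ _ _ → ≈ᴹ-refl) (λ _ _ → ≈ᴹ-refl)

  module _ {X : Set x} {_∼_ : Rel (Term X) r} {P : Module R p ℓp} where
    private
      module P = Module P

    lift-unique : (f g : LinearMap (Presented _∼_) P) →
                  (∀ y → f $ gen y P.≈ᴹ g $ gen y) → f ≋ g
    lift-unique f g f≈g = go
      where
      module f = LinearMap f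
      module g = LinearMap g
      go : f ≋ g
      go (gen y) = f≈g y
      go 𝟘       = P.≈ᴹ-trans f.0ᴹ-homo (P.≈ᴹ-sym g.0ᴹ-homo)
      go (t ⊕ u) = P.≈ᴹ-trans (f.+ᴹ-homo t u)
        (P.≈ᴹ-trans (P.+ᴹ-cong (go t) (go u)) (P.≈ᴹ-sym (g.+ᴹ-homo t u)))
      go (a ⊙ t) = P.≈ᴹ-trans (f.*ₗ-homo a t)
        (P.≈ᴹ-trans (P.*ₗ-congˡ (go t)) (P.≈ᴹ-sym (g.*ₗ-homo a t)))

  Free : Set x → Module R (c ⊔ x) (c ⊔ ℓ ⊔ x)
  Free X = Presented {X = X} (λ _ _ → ⊥)

  freeLift : {X : Set x} {P : Module R p ℓp} → (X → ∣ P ∣) → LinearMap (Free X) P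
  freeLift {P = P} f = lift P _ f (λ ())

  data TensorRelation (M : Module R m ℓm) (N : Module R n ℓn) :
         Rel (Term (∣ M ∣ × ∣ N ∣)) (c ⊔ m ⊔ ℓm ⊔ n ⊔ ℓn) where
    cong : ∀ {u u′ v v′} → Module._≈ᴹ_ M u u′ → Module._≈ᴹ_ N v v′ →
           TensorRelation M N (gen (u , v)) (gen (u′ , v′))
    +ˡ   : ∀ u u′ v → TensorRelation M N
             (gen (Module._+ᴹ_ M u u′ , v)) (gen (u , v) ⊕ gen (u′ , v))
    +ʳ   : ∀ u v v′ → TensorRelation M N
             (gen (u , Module._+ᴹ_ N v v′)) (gen (u , v) ⊕ gen (u , v′))
    *ˡ   : ∀ a u v → TensorRelation M N
             (gen (Module._*ₗ_ M a u , v)) (a ⊙ gen (u , v))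
    *ʳ   : ∀ a u v → TensorRelation M N
             (gen (u , Module._*ₗ_ N a v)) (a ⊙ gen (u , v))

  infixr 8 _⊗ᴹ_ _⊗_
  _⊗ᴹ_ : Module R m ℓm → Module R n ℓn →
         Module R (c ⊔ m ⊔ n) (c ⊔ ℓ ⊔ m ⊔ ℓm ⊔ n ⊔ ℓn)
  M ⊗ᴹ N = Presented (TensorRelation M N)

  _⊗_ : {A : Set m} {B : Set n} → A → B → Term (A × B)
  u ⊗ v = gen (u , v)

  module _ {M : Module R m ℓm} {N : Module R n ℓn} where

    tensor : LinearMap M (N ⊸ M ⊗ᴹ N)
    tensor = linearMap
      (λ u → linearMap (u ⊗_)
        (λ v≈v′ → relation (cong (Module.≈ᴹ-refl M) v≈v′))
        (λ v v′ → relation (+ʳ u v v′))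
        (λ a v → relation (*ʳ a u v)))
      (λ u≈u′ v → relation (cong u≈u′ (Module.≈ᴹ-refl N)))
      (λ u u′ v → relation (+ˡ u u′ v))
      (λ a u v → relation (*ˡ a u v))

    uncurryₗ : {P : Module R p ℓp} → LinearMap M (N ⊸ P) → LinearMap (M ⊗ᴹ N) P
    uncurryₗ {P = P} β = lift P _ (λ (u , v) → β $ u $ v) λ where
        (cong {u} u≈u′ v≈v′) →
          ≈ᴹ-trans (LinearMap.⟦⟧-cong (β $ u) v≈v′) (β.⟦⟧-cong u≈u′ _)
        (+ˡ u u′ v) → β.+ᴹ-homo u u′ v
        (+ʳ u v v′) → LinearMap.+ᴹ-homo (β $ u) v v′
        (*ˡ a u v)  → β.*ₗ-homo a u v
        (*ʳ a u v)  → LinearMap.*ₗ-homo (β $ u) a v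
      where
      open Module P
      module β = LinearMap β

  -- (f ⊗₁ g) (u ⊗ v) = f u ⊗ g v
  infixr 8 _⊗₁_
  _⊗₁_ : {M : Module R m ℓm} {N : Module R n ℓn} {P : Module R p ℓp} {Q : Module R q ℓq} →
         LinearMap M P → LinearMap N Q → LinearMap (M ⊗ᴹ N) (P ⊗ᴹ Q)
  _⊗₁_ {M = M} {N = N} {P = P} {Q = Q} f g =
    uncurryₗ {M = M} {N = N} {P = P ⊗ᴹ Q}
      (precompose₂ {M = M} {N = N} {P = P} {Q = Q} {S = P ⊗ᴹ Q} tensor f g)

  ⊗₁-bilinear : {M : Module R m ℓm} {N : Module R n ℓn}
                {P : Module R p ℓp} {Q : Module R q ℓq} →
                LinearMap (M ⊸ P) ((N ⊸ Q) ⊸ (M ⊗ᴹ N ⊸ P ⊗ᴹ Q))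
  ⊗₁-bilinear {M = M} {N = N} {P = P} {Q = Q} = linearMap
    (λ f → linearMap (f ⊗₁_)
      (λ {g} {g′} g≈g′ → lift-unique (f ⊗₁ g) (f ⊗₁ g′) λ (u , v) →
        relation (cong P.≈ᴹ-refl (g≈g′ v)))
      (λ g g′ → lift-unique (f ⊗₁ (g H₂.+ᴹ g′)) (f ⊗₁ g T.+ᴹ f ⊗₁ g′) λ (u , v) →
        relation (+ʳ (f $ u) (g $ v) (g′ $ v)))
      (λ a g → lift-unique (f ⊗₁ (a H₂.*ₗ g)) (a T.*ₗ f ⊗₁ g) λ (u , v) →
        relation (*ʳ a (f $ u) (g $ v))))
    (λ {f} {f′} f≈f′ g → lift-unique (f ⊗₁ g) (f′ ⊗₁ g) λ (u , v) →
      relation (cong (f≈f′ u) Q.≈ᴹ-refl))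
    (λ f f′ g → lift-unique ((f H₁.+ᴹ f′) ⊗₁ g) (f ⊗₁ g T.+ᴹ f′ ⊗₁ g) λ (u , v) →
      relation (+ˡ (f $ u) (f′ $ u) (g $ v)))
    (λ a f g → lift-unique ((a H₁.*ₗ f) ⊗₁ g) (a T.*ₗ f ⊗₁ g) λ (u , v) →
      relation (*ˡ a (f $ u) (g $ v)))
    where
    module P = Module P
    module Q = Module Q
    module H₁ = Module (M ⊸ P)
    module H₂ = Module (N ⊸ Q)
    module T = Module (M ⊗ᴹ N ⊸ P ⊗ᴹ Q)

  -- (β ⊗₂ γ) (u ⊗ u′) (v ⊗ v′) = β u v ⊗ γ u′ v′
  infixr 8 _⊗₂_
  _⊗₂_ : ∀ {m₁ ℓm₁ n₁ ℓn₁ p₁ ℓp₁ m₂ ℓm₂ n₂ ℓn₂ p₂ ℓp₂}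
         {M₁ : Module R m₁ ℓm₁} {N₁ : Module R n₁ ℓn₁} {P₁ : Module R p₁ ℓp₁}
         {M₂ : Module R m₂ ℓm₂} {N₂ : Module R n₂ ℓn₂} {P₂ : Module R p₂ ℓp₂} →
         LinearMap M₁ (N₁ ⊸ P₁) → LinearMap M₂ (N₂ ⊸ P₂) →
         LinearMap (M₁ ⊗ᴹ M₂) (N₁ ⊗ᴹ N₂ ⊸ P₁ ⊗ᴹ P₂)
  _⊗₂_ {M₁ = M₁} {N₁ = N₁} {P₁ = P₁} {M₂ = M₂} {N₂ = N₂} {P₂ = P₂} β γ =
    uncurryₗ {M = M₁} {N = M₂} {P = N₁ ⊗ᴹ N₂ ⊸ P₁ ⊗ᴹ P₂}
      (precompose₂ {M = M₁} {N = M₂} {P = N₁ ⊸ P₁} {Q = N₂ ⊸ P₂}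
         {S = N₁ ⊗ᴹ N₂ ⊸ P₁ ⊗ᴹ P₂}
         (⊗₁-bilinear {M = N₁} {N = N₂} {P = P₁} {Q = P₂}) β γ)

  -- (u ⊗ v) ⊗ w ↦ u ⊗ (v ⊗ w)
  associator : {M : Module R m ℓm} {N : Module R n ℓn} {P : Module R p ℓp} →
               LinearMap ((M ⊗ᴹ N) ⊗ᴹ P) (M ⊗ᴹ N ⊗ᴹ P)
  associator {M = M} {N = N} {P = P} =
    uncurryₗ {M = M ⊗ᴹ N} {N = P} {P = M ⊗ᴹ N ⊗ᴹ P}
      (uncurryₗ {M = M} {N = N} {P = P ⊸ M ⊗ᴹ N ⊗ᴹ P}
        (precompose₂ {M = M} {N = N} {P = N ⊗ᴹ P ⊸ M ⊗ᴹ N ⊗ᴹ P} {Q = P ⊸ N ⊗ᴹ P}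
          {S = P ⊸ M ⊗ᴹ N ⊗ᴹ P} composeₗ tensor tensor))

  module _ (M : Module R m ℓm) where
    open Module M

    record IsSubmodule (S : Pred ∣ M ∣ s) : Set (c ⊔ m ⊔ ℓm ⊔ s) where
      field
        resp : ∀ {u v} → u ≈ᴹ v → S u → S v
        has0 : S 0ᴹ
        has+ : ∀ {u v} → S u → S v → S (u +ᴹ v)
        has* : ∀ a {u} → S u → S (a *ₗ u)

    data Span (S : Pred ∣ M ∣ s) : Pred ∣ M ∣ (c ⊔ m ⊔ ℓm ⊔ s) where
      incl  : ∀ {u} → S u → Span S u
      span≈ : ∀ {u v} → u ≈ᴹ v → Span S u → Span S v
      span0 : Span S 0ᴹ
      span+ : ∀ {u v} → Span S u → Span S v → Span S (u +ᴹ v)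
      span* : ∀ a {u} → Span S u → Span S (a *ₗ u)

    -- M is the (internal) direct sum of its submodules G 0, G 1, G 2, …
    record IsGrading (G : ℕ → Pred ∣ M ∣ s) : Set (c ⊔ m ⊔ ℓm ⊔ s) where
      open RawMonoidSum +ᴹ-rawMonoid using (sum)
      field
        isSubmodule : ∀ d → IsSubmodule (G d)
        spanning    : ∀ u → Σ[ k ∈ ℕ ] Σ[ v ∈ Vector ∣ M ∣ k ]
                        (∀ i → G (toℕ i) (v i)) × u ≈ᴹ sum v
        independent : ∀ k (v : Vector ∣ M ∣ k) → (∀ i → G (toℕ i) (v i)) →
                        sum v ≈ᴹ 0ᴹ → ∀ i → v i ≈ᴹ 0ᴹ

  -- The degree d part of M ⊗ N is the sum of the G i ⊗ H j with i + j = d.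
  tensorGrade : (M : Module R m ℓm) (N : Module R n ℓn) →
                (ℕ → Pred ∣ M ∣ p) → (ℕ → Pred ∣ N ∣ q) →
                ℕ → Pred ∣ M ⊗ᴹ N ∣ (c ⊔ ℓ ⊔ m ⊔ ℓm ⊔ n ⊔ ℓn ⊔ p ⊔ q)
  tensorGrade M N G H d = Span (M ⊗ᴹ N) λ t →
    Σ[ i ∈ ℕ ] Σ[ j ∈ ℕ ] Σ[ u ∈ ∣ M ∣ ] Σ[ v ∈ ∣ N ∣ ]
      i ℕ.+ j ≡ d × G i u × H j v × t ≡ u ⊗ v

------------------------------------------------------------------------
-- Dendriform algebras and bialgebras

module Dendriform {c ℓ} (R : CommutativeRing c ℓ) where

  open LinearAlgebra R

  module _ (A : Module R m ℓm) (≺ₗ ≻ₗ : LinearMap A (A ⊸ A)) where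
    open Module A

    infixl 7 _≺_ _≻_
    _≺_ _≻_ : ∣ A ∣ → ∣ A ∣ → ∣ A ∣
    u ≺ v = ≺ₗ $ u $ v
    u ≻ v = ≻ₗ $ u $ v

    ·ₗ : LinearMap A (A ⊸ A)
    ·ₗ = Module._+ᴹ_ (A ⊸ A ⊸ A) ≺ₗ ≻ₗ

    record IsDendriformAlgebra : Set (c ⊔ m ⊔ ℓm) where
      field
        ≺-≺ : ∀ u v w → (u ≺ v) ≺ w ≈ᴹ u ≺ (v ≺ w +ᴹ v ≻ w)
        ≻-≺ : ∀ u v w → (u ≻ v) ≺ w ≈ᴹ u ≻ (v ≺ w)
        ≻-≻ : ∀ u v w → (u ≺ v +ᴹ u ≻ v) ≻ w ≈ᴹ u ≻ (v ≻ w)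

    module _ (Δ : LinearMap A (A ⊗ᴹ A)) where

      Coassociative : Set (c ⊔ ℓ ⊔ m ⊔ ℓm)
      Coassociative = associator ∘ₗ (Δ ⊗₁ idₗ A) ∘ₗ Δ ≋ (idₗ A ⊗₁ Δ) ∘ₗ Δ

      -- In Sweedler notation Δ u = u′ ⊗ u″, the last four summands of Δ-≺ are
      -- u′ ≺ v ⊗ u″,  u′ ⊗ u″ · v,  u ≺ v′ ⊗ v″  and  u′ ≺ v′ ⊗ u″ · v″, and
      -- those of Δ-≻ are
      -- u′ ≻ v ⊗ u″,  v′ ⊗ u · v″,  u ≻ v′ ⊗ v″  and  u′ ≻ v′ ⊗ u″ · v″.
      record IsDendriformBialgebra : Set (c ⊔ ℓ ⊔ m ⊔ ℓm) where
        open Module (A ⊗ᴹ A) using () renaming (_≈ᴹ_ to _≈_; _+ᴹ_ to _+_)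
        field
          isDendriformAlgebra : IsDendriformAlgebra
          coassociative       : Coassociative
          Δ-≺ : ∀ u v → Δ $ (u ≺ v) ≈
                  u ⊗ v
                  + (flipₗ ≺ₗ $ v ⊗₁ idₗ A) $ (Δ $ u)
                  + (idₗ A ⊗₁ flipₗ ·ₗ $ v) $ (Δ $ u)
                  + (≺ₗ $ u ⊗₁ idₗ A) $ (Δ $ v)
                  + (≺ₗ ⊗₂ ·ₗ) $ (Δ $ u) $ (Δ $ v)
          Δ-≻ : ∀ u v → Δ $ (u ≻ v) ≈
                  v ⊗ u
                  + (flipₗ ≻ₗ $ v ⊗₁ idₗ A) $ (Δ $ u)
                  + (idₗ A ⊗₁ ·ₗ $ u) $ (Δ $ v)
                  + (≻ₗ $ u ⊗₁ idₗ A) $ (Δ $ v)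
                  + (≻ₗ ⊗₂ ·ₗ) $ (Δ $ u) $ (Δ $ v)

      record IsGradedBialgebra (G : ℕ → Pred ∣ A ∣ s) : Set (c ⊔ ℓ ⊔ m ⊔ ℓm ⊔ s) where
        field
          isGrading : IsGrading A G
          ≺-graded  : ∀ {i j u v} → G i u → G j v → G (i ℕ.+ j) (u ≺ v)
          ≻-graded  : ∀ {i j u v} → G i u → G j v → G (i ℕ.+ j) (u ≻ v)
          Δ-graded  : ∀ {d u} → G d u → tensorGrade A A G G d (Δ $ u)

------------------------------------------------------------------------
-- Typed trees

-- A branch is what hangs below a vertex on one side: the trivial tree,
-- whose edge carries no type (the symbol ∅), or a nontrivial tree together
-- with the type of the internal edge leading to it.  Thus T₁ ⋁_{α,β} T₂ is
-- (α ↘ T₁) ⋁ (β ↘ T₂), with (α ↘ T₁) replaced by ∅ when T₁ is trivial, and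
-- likewise on the right.
infix  6 _⋁_
infixr 7 _↘_

mutual
  data Tree⁺ {w} (Ω : Set w) : Set w where
    _⋁_ : Branch Ω → Branch Ω → Tree⁺ Ω

  data Branch {w} (Ω : Set w) : Set w where
    ∅   : Branch Ω
    _↘_ : Ω → Tree⁺ Ω → Branch Ω

Y : ∀ {w} {Ω : Set w} → Tree⁺ Ω
Y = ∅ ⋁ ∅

mutual
  vertices : ∀ {w} {Ω : Set w} → Tree⁺ Ω → ℕ
  vertices (l ⋁ r) = 1 ℕ.+ branchVertices l ℕ.+ branchVertices r

  branchVertices : ∀ {w} {Ω : Set w} → Branch Ω → ℕ
  branchVertices ∅       = 0
  branchVertices (α ↘ T) = vertices T

-- The library's notion of field is the Heyting field, in which invertibility
-- is governed by an apartness relation; with excluded middle every field is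
-- one, taking x # y to mean ¬ (x ≈ y).
module TypedTrees {c ℓ₁ ℓ₂ w} (K : HeytingField c ℓ₁ ℓ₂) (Ω : EDS w) where

  𝕂 : CommutativeRing c ℓ₁
  𝕂 = HeytingCommutativeRing.commutativeRing (HeytingField.heytingCommutativeRing K)

  open LinearAlgebra 𝕂 public
  open Dendriform 𝕂 public
  open EDS Ω

  𝕂Ω : Module 𝕂 (c ⊔ w) (c ⊔ ℓ₁ ⊔ w)
  𝕂Ω = Free Carrier

  𝕂𝒯⁺ : Module 𝕂 (c ⊔ w) (c ⊔ ℓ₁ ⊔ w)
  𝕂𝒯⁺ = Free (Tree⁺ Carrier)

  -- T ↦ l ⋁_α T  and  T ↦ T ⋁_α r, extended linearly
  graftʳ : Branch Carrier → Carrier → LinearMap 𝕂𝒯⁺ 𝕂𝒯⁺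
  graftʳ l α = freeLift (λ T → gen (l ⋁ α ↘ T))

  graftˡ : Carrier → Branch Carrier → LinearMap 𝕂𝒯⁺ 𝕂𝒯⁺
  graftˡ α r = freeLift (λ T → gen (α ↘ T ⋁ r))

  mutual
    _≺ᵗ[_]_ : Tree⁺ Carrier → Carrier → Tree⁺ Carrier → ∣ 𝕂𝒯⁺ ∣
    (l ⋁ ∅)      ≺ᵗ[ γ ] T = gen (l ⋁ γ ↘ T)
    (l ⋁ β ↘ T₂) ≺ᵗ[ γ ] T = graftʳ l (β ⟵ γ) $ (T₂ ≺ᵗ[ β ◃ γ ] T)
                            ⊕ graftʳ l (β ⟶ γ) $ (T₂ ≻ᵗ[ β ▹ γ ] T)

    _≻ᵗ[_]_ : Tree⁺ Carrier → Carrier → Tree⁺ Carrier → ∣ 𝕂𝒯⁺ ∣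
    T ≻ᵗ[ α ] (∅ ⋁ r)      = gen (α ↘ T ⋁ r)
    T ≻ᵗ[ α ] (β ↘ T₁ ⋁ r) = graftˡ (α ⟶ β) r $ (T ≻ᵗ[ α ▹ β ] T₁)
                            ⊕ graftˡ (α ⟵ β) r $ (T ≺ᵗ[ α ◃ β ] T₁)

  ≺[_] ≻[_] : Carrier → LinearMap 𝕂𝒯⁺ (𝕂𝒯⁺ ⊸ 𝕂𝒯⁺)
  ≺[ γ ] = freeLift {P = 𝕂𝒯⁺ ⊸ 𝕂𝒯⁺} λ S → freeLift {P = 𝕂𝒯⁺} λ T → S ≺ᵗ[ γ ] T
  ≻[ γ ] = freeLift {P = 𝕂𝒯⁺ ⊸ 𝕂𝒯⁺} λ S → freeLift {P = 𝕂𝒯⁺} λ T → S ≻ᵗ[ γ ] T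

  B : Module 𝕂 (c ⊔ w) (c ⊔ ℓ₁ ⊔ w)
  B = 𝕂Ω ⊗ᴹ 𝕂𝒯⁺

  -- (α ⊗ x) , (β ⊗ y) ↦ op α β ⊗ prod α β x y  for α, β ∈ Ω
  semidirect : (Carrier → Carrier → Carrier) →
               (Carrier → Carrier → LinearMap 𝕂𝒯⁺ (𝕂𝒯⁺ ⊸ 𝕂𝒯⁺)) →
               LinearMap B (B ⊸ B)
  semidirect op prod =
    uncurryₗ {M = 𝕂Ω} {N = 𝕂𝒯⁺} {P = B ⊸ B} (freeLift {P = 𝕂𝒯⁺ ⊸ B ⊸ B} λ α →
      flipₗ {M = B} {N = 𝕂𝒯⁺} {P = B}
        (uncurryₗ {M = 𝕂Ω} {N = 𝕂𝒯⁺} {P = 𝕂𝒯⁺ ⊸ B} (freeLift {P = 𝕂𝒯⁺ ⊸ 𝕂𝒯⁺ ⊸ B} λ β →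
          flipₗ {M = 𝕂𝒯⁺} {N = 𝕂𝒯⁺} {P = B} (α-β α β))))
    where
    -- x , y ↦ op α β ⊗ prod α β x y
    α-β : Carrier → Carrier → LinearMap 𝕂𝒯⁺ (𝕂𝒯⁺ ⊸ B)
    α-β α β = (composeₗ {M = 𝕂𝒯⁺} {N = 𝕂𝒯⁺} {P = B} $ (tensor $ gen (op α β))) ∘ₗ prod α β

  ≺ᴮ ≻ᴮ : LinearMap B (B ⊸ B)
  ≺ᴮ = semidirect _⟵_ (λ α β → ≺[ α ◃ β ])
  ≻ᴮ = semidirect _⟶_ (λ α β → ≻[ α ▹ β ])

  ≺ᴮ-tensors : ∀ α β x y →
    ≺ᴮ $ (gen α ⊗ x) $ (gen β ⊗ y) ≡ gen (α ⟵ β) ⊗ (≺[ α ◃ β ] $ x $ y)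
  ≺ᴮ-tensors α β x y = refl

  ≻ᴮ-tensors : ∀ α β x y →
    ≻ᴮ $ (gen α ⊗ x) $ (gen β ⊗ y) ≡ gen (α ⟶ β) ⊗ (≻[ α ▹ β ] $ x $ y)
  ≻ᴮ-tensors α β x y = refl

  IsCoproduct : LinearMap B (B ⊗ᴹ B) → Set (c ⊔ ℓ₁ ⊔ w)
  IsCoproduct Δ = IsDendriformBialgebra B ≺ᴮ ≻ᴮ Δ
                × (∀ α → Δ $ (gen α ⊗ gen Y) ≈ᴹ 0ᴹ)
    where open Module (B ⊗ᴹ B)

  Homogeneous : ℕ → Pred ∣ B ∣ (c ⊔ ℓ₁ ⊔ w)
  Homogeneous d = Span B λ u →
    Σ[ α ∈ Carrier ] Σ[ T ∈ Tree⁺ Carrier ] vertices T ≡ d × u ≡ gen α ⊗ gen T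

{-# OPTIONS --safe #-}

-- Every basis element α ⊗ T of B is, in a unique way, of the form
-- (x ≻ (ω ⊗ Y)) ≺ y with x, y basis elements or the unit: this gives the
-- element ((α₁ ⟶ ω) ⟵ α₂) ⊗ (T₁ ⋁ T₂) with edge types α₁ ▹ ω and
-- (α₁ ⟶ ω) ◃ α₂, and nondegeneracy recovers α₁, ω, α₂ from it.  So B is the
-- free dendriform algebra on the ω ⊗ Y, i.e. the algebra of plane binary trees
-- with vertices decorated by Ω, which gives uniqueness of Δ.
--
-- On decorated trees, put Δ̄ t = t ⊗ 1 + 1 ⊗ t + Δ t.  The compatibility of Δ
-- with ≺ and ≻ amounts to the recursion
--   Δ̄ (l ∨_ω r) = 1 ⊗ (l ∨_ω r) + Σ (l′ ∨_ω r′) ⊗ (l″ · r″),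
-- which defines Δ.  With
--   (l ∨_ω r) ≺ y = l ∨_ω (r · y)  and  x ≻ (l ∨_ω r) = (x · l) ∨_ω r,
-- multiplicativity and coassociativity of Δ̄ are then direct inductions.

module Submission where

open import Defs
open import Level using (Level; _⊔_)
open import Algebra.Apartness.Bundles using (HeytingField)
open import Algebra.Bundles using (CommutativeMonoid; CommutativeRing)
open import Algebra.Module.Bundles using (Module)
import Algebra.Definitions.RawMonoid as RawMonoidSum
import Algebra.Properties.CommutativeSemigroup as CommutativeSemigroupProperties
open import Data.Fin.Base as Fin using (Fin; toℕ)
open import Data.Fin.Properties using (toℕ-injective; suc-injective)
open import Data.Maybe.Base using (Maybe; just; nothing)
open import Data.Nat.Base as ℕ using (ℕ; zero; suc; _≤_; _<_; s≤s)
open import Data.Nat.Properties as ℕ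
  using (+-assoc; +-suc; +-commutativeSemigroup; m⊔n≤o⇒m≤o; m⊔n≤o⇒n≤o)
open import Data.Product using (_×_; _,_; map₁; map₂; proj₁; proj₂; ∃; ∃!; Σ-syntax)
open import Data.Unit.Polymorphic.Base using (⊤; tt)
open import Data.Vec.Functional using (Vector)
open import Function.Base using (_∘_)
open import Relation.Binary.PropositionalEquality.Core as ≡ using (_≡_; _≢_; refl)
import Relation.Binary.Reasoning.Setoid as SetoidReasoning
open import Relation.Nullary.Decidable.Core using (yes; no)
open import Relation.Nullary.Negation.Core using (contradiction)
open import Relation.Unary using (Pred)

-- Two obstacles shape the constructions. With a unit, the half-products make sense only as x ≺ 1 =
-- x and 1 ≻ x = x; the expression 1 ≺ 1 has no value, yet the recursion for Δ̄ meets the unit at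
-- every leaf. Hence `Maybe` marks the unit, each half-product has one argument that cannot be the
-- unit, and Δ̄ is split according to whether its left factor is the unit, so that u′ ≺ v′ is always
-- defined. Returning from Δ̄ to Δ also requires the terms with right factor 1, which the recursion
-- does not display; a counit argument shows that they add up to x ⊗ 1. Moreover, the dendriform
-- axioms of B are part of the claim, so its products cannot be handled as dendriform from the
-- start. They are first identified, on basis elements, with the products of decorated trees, and
-- the EDS axioms enter there. All identities are proved for decorated trees as equations between
-- formal sums and then carried over. Spanning suffices for identities and uniqueness; defining Δ
-- and separating degrees use the inverse of the encoding.

private
  variable
    a ℓa p ℓp q ℓq s x y z w : Level

-- Formal linear combinations as a commutative monad

module FreeMonad {c ℓ} (R : CommutativeRing c ℓ) where

  open LinearAlgebra R

  module _ {X : Set x} (P : Module R p ℓp) where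
    open Module P

    extend-congˡ : (f : X → ∣ P ∣) → ∀ {t u} → Module._≈ᴹ_ (Free X) t u →
                   extend P f t ≈ᴹ extend P f u
    extend-congˡ f = extend-cong P _ f (λ ())

    extend-congʳ : {f g : X → ∣ P ∣} → (∀ x → f x ≈ᴹ g x) →
                   ∀ t → extend P f t ≈ᴹ extend P g t
    extend-congʳ e (gen x) = e x
    extend-congʳ e 𝟘       = ≈ᴹ-refl
    extend-congʳ e (t ⊕ u) = +ᴹ-cong (extend-congʳ e t) (extend-congʳ e u)
    extend-congʳ e (a ⊙ t) = *ₗ-congˡ (extend-congʳ e t)

    -- With `extend-0` and `extend-*` this makes `extend` linear in the function as well as in the
    -- term, which is what lets two nested sums change places.
    extend-+ : (f g : X → ∣ P ∣) →
               ∀ t → extend P (λ x → f x +ᴹ g x) t ≈ᴹ extend P f t +ᴹ extend P g t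
    extend-+ f g (gen x) = ≈ᴹ-refl
    extend-+ f g 𝟘       = ≈ᴹ-sym (+ᴹ-identityˡ 0ᴹ)
    extend-+ f g (t ⊕ u) = ≈ᴹ-trans (+ᴹ-cong (extend-+ f g t) (extend-+ f g u))
                                    (interchange _ _ _ _)
      where
      open CommutativeSemigroupProperties
        (CommutativeMonoid.commutativeSemigroup +ᴹ-commutativeMonoid)
        using (interchange)
    extend-+ f g (a ⊙ t) = ≈ᴹ-trans (*ₗ-congˡ (extend-+ f g t)) (*ₗ-distribˡ a _ _)

    extend-0 : ∀ t → extend P (λ (_ : X) → 0ᴹ) t ≈ᴹ 0ᴹ
    extend-0 (gen x) = ≈ᴹ-refl
    extend-0 𝟘       = ≈ᴹ-refl
    extend-0 (t ⊕ u) = ≈ᴹ-trans (+ᴹ-cong (extend-0 t) (extend-0 u)) (+ᴹ-identityˡ 0ᴹ)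
    extend-0 (a ⊙ t) = ≈ᴹ-trans (*ₗ-congˡ (extend-0 t)) (*ₗ-zeroʳ a)

    extend-* : ∀ a (f : X → ∣ P ∣) t → extend P (λ x → a *ₗ f x) t ≈ᴹ a *ₗ extend P f t
    extend-* a f (gen x) = ≈ᴹ-refl
    extend-* a f 𝟘       = ≈ᴹ-sym (*ₗ-zeroʳ a)
    extend-* a f (t ⊕ u) = ≈ᴹ-trans (+ᴹ-cong (extend-* a f t) (extend-* a f u))
                                    (≈ᴹ-sym (*ₗ-distribˡ a _ _))
    extend-* a f (b ⊙ t) = ≈ᴹ-trans (*ₗ-congˡ (extend-* a f t))
      (≈ᴹ-trans (≈ᴹ-sym (*ₗ-assoc b a _))
        (≈ᴹ-trans (*ₗ-congʳ (CommutativeRing.*-comm R b a)) (*ₗ-assoc a b _)))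

  map-extend : {X : Set x} {P : Module R p ℓp} {Q : Module R q ℓq} (F : LinearMap P Q)
               (f : X → ∣ P ∣) → ∀ t →
               Module._≈ᴹ_ Q (F $ extend P f t) (extend Q (λ x → F $ f x) t)
  map-extend {P = P} {Q = Q} F f = go
    where
    open Module Q
    module F = LinearMap F
    go : ∀ t → F $ extend P f t ≈ᴹ extend Q (λ x → F $ f x) t
    go (gen x) = ≈ᴹ-refl
    go 𝟘       = F.0ᴹ-homo
    go (t ⊕ u) = ≈ᴹ-trans (F.+ᴹ-homo _ _) (+ᴹ-cong (go t) (go u))
    go (a ⊙ t) = ≈ᴹ-trans (F.*ₗ-homo _ _) (*ₗ-congˡ (go t))

  infix 4 _≈_
  _≈_ : {X : Set x} → Term X → Term X → Set _
  _≈_ {X = X} = Module._≈ᴹ_ (Free X)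

  -- Sweedler sums are written in the free module monad: Σ f x′ x″ is
  -- Δ x >>= λ (x′ , x″) → f x′ x″.
  infixl 1 _>>=_
  _>>=_ : {X : Set x} {Y : Set y} → Term X → (X → Term Y) → Term Y
  _>>=_ {Y = Y} t f = extend (Free Y) f t

  module _ {X : Set x} {Y : Set y} where

    infixl 4 _<$>_
    _<$>_ : (X → Y) → Term X → Term Y
    f <$> t = t >>= λ x → gen (f x)

    bind-cong : {f g : X → Term Y} {t u : Term X} →
                t ≈ u → (∀ x → f x ≈ g x) → (t >>= f) ≈ (u >>= g)
    bind-cong {f = f} {u = u} t≈u f≈g =
      ≈-trans (extend-congˡ (Free Y) f t≈u) (extend-congʳ (Free Y) f≈g u)

    bind-congˡ : (f : X → Term Y) {t u : Term X} → t ≈ u → (t >>= f) ≈ (u >>= f)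
    bind-congˡ f t≈u = extend-congˡ (Free Y) f t≈u

    bind-congʳ : {f g : X → Term Y} (t : Term X) → (∀ x → f x ≈ g x) → (t >>= f) ≈ (t >>= g)
    bind-congʳ t f≈g = extend-congʳ (Free Y) f≈g t

    bind-+ : (f g : X → Term Y) → ∀ t → (t >>= λ x → f x ⊕ g x) ≈ (t >>= f) ⊕ (t >>= g)
    bind-+ = extend-+ (Free Y)

    bind-0 : (t : Term X) → (t >>= λ _ → 𝟘 {X = Y}) ≈ 𝟘
    bind-0 = extend-0 (Free Y)

    -- A propositional equality: both sides unfold along the constructors of `t` to the same
    -- expression, and no module law is involved.
    extend-bind : (P : Module R p ℓp) (f : X → Term Y) (g : Y → ∣ P ∣) →
                  ∀ t → extend P g (t >>= f) ≡ extend P (λ x → extend P g (f x)) t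
    extend-bind P f g (gen x) = refl
    extend-bind P f g 𝟘       = refl
    extend-bind P f g (t ⊕ u) = ≡.cong₂ (Module._+ᴹ_ P) (extend-bind P f g t) (extend-bind P f g u)
    extend-bind P f g (a ⊙ t) = ≡.cong (Module._*ₗ_ P a) (extend-bind P f g t)

  module _ {X : Set x} {Y : Set y} {Z : Set z} where

    bind-bind : (f : X → Term Y) (g : Y → Term Z) (t : Term X) →
                (t >>= f >>= g) ≈ (t >>= λ x → f x >>= g)
    bind-bind f g t = Module.≈ᴹ-reflexive (Free Z) (extend-bind (Free Z) f g t)

    -- Independent sums commute. The scalar case rests on commutativity of the ring, through
    -- `extend-*`.
    bind-swap : (f : X → Y → Term Z) (t : Term X) (u : Term Y) →
                (t >>= λ x → u >>= f x) ≈ (u >>= λ y → t >>= λ x → f x y)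
    bind-swap f (gen x) u = ≈-refl
    bind-swap f 𝟘       u = ≈-sym (bind-0 u)
    bind-swap f (t ⊕ v) u = ≈-trans (⊕-cong (bind-swap f t u) (bind-swap f v u))
                                    (≈-sym (bind-+ _ _ u))
    bind-swap f (a ⊙ t) u = ≈-trans (⊙-cong (CommutativeRing.refl R) (bind-swap f t u))
                                    (≈-sym (extend-* (Free Z) a _ u))

  bind-gen : {X : Set x} (t : Term X) → (t >>= gen) ≈ t
  bind-gen (gen x) = ≈-refl
  bind-gen 𝟘       = ≈-refl
  bind-gen (t ⊕ u) = ⊕-cong (bind-gen t) (bind-gen u)
  bind-gen (a ⊙ t) = ⊙-cong (CommutativeRing.refl R) (bind-gen t)

  -- The tool that carries computations from formal sums into modules: a linear map known on
  -- generators, with values written as formal sums, is thereby known on every `extend P g t`.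
  extend-natural : {X : Set x} {Y : Set y} {P : Module R p ℓp} {Q : Module R q ℓq}
    (F : LinearMap P Q) {g : X → ∣ P ∣} {h : Y → ∣ Q ∣} {f : X → Term Y} →
    (∀ x → Module._≈ᴹ_ Q (F $ g x) (extend Q h (f x))) →
    ∀ t → Module._≈ᴹ_ Q (F $ extend P g t) (extend Q h (t >>= f))
  extend-natural {P = P} {Q = Q} F {g} {h} {f} e t = Q.≈ᴹ-trans (map-extend F g t)
    (Q.≈ᴹ-trans (extend-congʳ Q e t) (Q.≈ᴹ-reflexive (≡.sym (extend-bind Q f h t))))
    where module Q = Module Q

  free⊗free-unique : {X : Set x} {Y : Set y} {P : Module R p ℓp}
    (f g : LinearMap (Free X ⊗ᴹ Free Y) P) →
    (∀ x y → Module._≈ᴹ_ P (f $ (gen x ⊗ gen y)) (g $ (gen x ⊗ gen y))) → f ≋ g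
  free⊗free-unique {X = X} {Y} {P} f g f≈g = lift-unique f g λ (u , v) →
    lift-unique {P = P} (f ∘ₗ (flipₗ tensor $ v)) (g ∘ₗ (flipₗ tensor $ v)) (λ x →
      lift-unique {P = P} (f ∘ₗ (tensor $ gen x)) (g ∘ₗ (tensor $ gen x)) (f≈g x) v) u

  module ≈-Reasoning {x} {X : Set x} = SetoidReasoning (Module.≈ᴹ-setoid (Free X))

-- Vertex-decorated trees l ∨_ω r; `nothing` is the trivial tree, the unit 1.
data Node (Ω : Set w) : Set w where
  node : Maybe (Node Ω) → Ω → Maybe (Node Ω) → Node Ω

mutual
  size : {Ω : Set w} → Node Ω → ℕ
  size (node l ω r) = suc (size? l ℕ.+ size? r)

  size? : {Ω : Set w} → Maybe (Node Ω) → ℕ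
  size? nothing  = 0
  size? (just x) = size x

-- The dendriform algebra of decorated trees with a unit adjoined

module DecoratedTrees {c ℓ} (R : CommutativeRing c ℓ) (Ω : Set w) where

  open LinearAlgebra R
  open FreeMonad R

  N : Set w
  N = Node Ω

  open ≈-Reasoning

  mutual
    -- The optional argument sits where the unit acts trivially, x ≺ 1 = x and 1 ≻ x = x; the other
    -- argument is a proper tree.
    prec : N → Maybe N → Term N
    prec (node l ω r) y = node l ω <$> mul r y

    succ : Maybe N → N → Term N
    succ x (node l ω r) = (λ s → node s ω r) <$> mul x l

    mul : Maybe N → Maybe N → Term (Maybe N)
    mul nothing  y        = gen y
    mul (just x) nothing  = gen (just x)
    mul (just x) (just y) = (just <$> prec x (just y)) ⊕ (just <$> succ (just x) y)

  -- `just <$> mul⁺ x y` computes to `mul (just x) (just y)`, so sums over the latter can be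
  -- reindexed by `bind-bind` at `mul⁺ x y`.
  mul⁺ : N → N → Term N
  mul⁺ x y = prec x (just y) ⊕ succ (just x) y

  mul-identityʳ : ∀ x → mul x nothing ≡ gen x
  mul-identityʳ nothing  = refl
  mul-identityʳ (just x) = refl

  prec-identityʳ : ∀ x → prec x nothing ≡ gen x
  prec-identityʳ (node l ω r) = ≡.cong (node l ω <$>_) (mul-identityʳ r)

  mutual
    -- For three proper trees this is the sum of the three dendriform axioms below. The outer two
    -- strip a node and return to associativity at one of its subtrees, which is why all four are
    -- proved together.
    mul-assoc : ∀ x y z → (mul x y >>= λ s → mul s z) ≈ (mul y z >>= mul x)
    mul-assoc nothing  y        z        = ≈-sym (bind-gen (mul y z))
    mul-assoc (just x) nothing  z        = ≈-refl
    mul-assoc (just x) (just y) nothing  = begin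
      (mul (just x) (just y) >>= λ s → mul s nothing)
        ≈⟨ bind-congʳ (mul (just x) (just y)) (λ s → Module.≈ᴹ-reflexive (Free _) (mul-identityʳ s)) ⟩
      (mul (just x) (just y) >>= gen)
        ≈⟨ bind-gen _ ⟩
      mul (just x) (just y) ∎
    mul-assoc (just x) (just y) (just z) = begin
      (mul (just x) (just y) >>= λ s → mul s (just z))
        ≈⟨ bind-bind _ _ (mul⁺ x y) ⟩
      (mul⁺ x y >>= λ s → (just <$> prec s (just z)) ⊕ (just <$> succ (just s) z))
        ≈⟨ bind-+ _ _ (mul⁺ x y) ⟩
      (mul⁺ x y >>= λ s → just <$> prec s (just z))
        ⊕ (mul⁺ x y >>= λ s → just <$> succ (just s) z)
        ≈⟨ ⊕-cong (≈-sym (bind-bind _ _ (mul⁺ x y))) (≈-sym (bind-bind _ _ (mul⁺ x y))) ⟩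
      (just <$> (mul⁺ x y >>= λ s → prec s (just z)))
        ⊕ (just <$> (mul⁺ x y >>= λ s → succ (just s) z))
        ≈⟨ bind-congˡ _ (⊕-cong (⊕-cong (prec-assoc x (just y) (just z))
                                        (succ-prec-assoc (just x) y (just z)))
             (≈-trans (≈-sym (bind-bind _ _ (mul⁺ x y))) (succ-assoc (just x) (just y) z))) ⟩
      (just <$> ((mul (just y) (just z) >>= prec x ) ⊕ (prec y (just z) >>= succ (just x)) ⊕ (succ (just y) z >>= succ (just x))))
        ≈⟨ ⊕-assoc _ _ _ ⟩
      (just <$> (mul (just y) (just z) >>= prec x)) ⊕ (just <$> (mul⁺ y z >>= succ (just x)))
        ≈⟨ ⊕-cong (bind-congˡ _ (bind-bind _ _ (mul⁺ y z))) ≈-refl ⟩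
      (just <$> (mul⁺ y z >>= λ s → prec x (just s))) ⊕ (just <$> (mul⁺ y z >>= succ (just x)))
        ≈⟨ ⊕-cong (bind-bind _ _ (mul⁺ y z)) (bind-bind _ _ (mul⁺ y z)) ⟩
      (mul⁺ y z >>= λ s → just <$> prec x (just s)) ⊕ (mul⁺ y z >>= λ s → just <$> succ (just x) s)
        ≈⟨ bind-+ _ _ (mul⁺ y z) ⟨
      (mul⁺ y z >>= λ s → mul (just x) (just s))
        ≈⟨ bind-bind _ _ (mul⁺ y z) ⟨
      (mul (just y) (just z) >>= mul (just x)) ∎

    prec-assoc : ∀ x y z → (prec x y >>= λ s → prec s z) ≈ (mul y z >>= prec x)
    prec-assoc (node l ω r) y z = begin
      (prec (node l ω r) y >>= λ s → prec s z)                ≈⟨ bind-bind _ _ (mul r y) ⟩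
      (mul r y >>= λ s → node l ω <$> mul s z)                ≈⟨ bind-bind _ _ (mul r y) ⟨
      (node l ω <$> (mul r y >>= λ s → mul s z))              ≈⟨ bind-congˡ _ (mul-assoc r y z) ⟩
      (node l ω <$> (mul y z >>= mul r))                      ≈⟨ bind-bind _ _ (mul y z) ⟩
      (mul y z >>= prec (node l ω r))                         ∎

    -- `succ` changes only the left subtree and `prec` only the right one, so both sides are the
    -- same double sum in different orders.
    succ-prec-assoc : ∀ x y z → (succ x y >>= λ s → prec s z) ≈ (prec y z >>= succ x)
    succ-prec-assoc x (node l ω r) z = begin
      (succ x (node l ω r) >>= λ s → prec s z)                ≈⟨ bind-bind _ _ (mul x l) ⟩
      (mul x l >>= λ s → node s ω <$> mul r z)                ≈⟨ bind-swap _ (mul x l) (mul r z) ⟩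
      (mul r z >>= λ t → (λ s → node s ω t) <$> mul x l)      ≈⟨ bind-bind _ _ (mul r z) ⟨
      (prec (node l ω r) z >>= succ x)                        ∎

    succ-assoc : ∀ x y z → (mul x y >>= λ s → succ s z) ≈ (succ y z >>= succ x)
    succ-assoc x y (node l ω r) = begin
      (mul x y >>= λ s → succ s (node l ω r))                 ≈⟨ bind-bind _ _ (mul x y) ⟨
      ((λ s → node s ω r) <$> (mul x y >>= λ s → mul s l))    ≈⟨ bind-congˡ _ (mul-assoc x y l) ⟩
      ((λ s → node s ω r) <$> (mul y l >>= mul x))            ≈⟨ bind-bind _ _ (mul y l) ⟩
      (mul y l >>= λ s → (λ s → node s ω r) <$> mul x s)      ≈⟨ bind-bind _ _ (mul y l) ⟨
      (succ y (node l ω r) >>= succ x)                        ∎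

-- The extended coproduct and its multiplicativity

module Coproduct {c ℓ} (R : CommutativeRing c ℓ) (Ω : Set w) where

  open LinearAlgebra R
  open FreeMonad R
  open DecoratedTrees R Ω
  open ≈-Reasoning

  M : Set w
  M = Maybe N

  succ-identityˡ : ∀ y → succ nothing y ≡ gen y
  succ-identityˡ (node l ω r) = refl

  mul² : M × M → M × M → Term (M × M)
  mul² (a , b) (c , d) = mul a c >>= λ e → (e ,_) <$> mul b d

  -- The half-product acts on left factors while right factors are multiplied fully, as in the last
  -- summands of the compatibility formulas.
  prec² : N × M → M × M → Term (N × M)
  prec² (a , b) (c , d) = prec a c >>= λ e → (e ,_) <$> mul b d

  succ² : M × M → N × M → Term (N × M)
  succ² (a , b) (c , d) = succ a c >>= λ e → (e ,_) <$> mul b d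

  graft : Ω → M × M → M × M → Term (N × M)
  graft ω (a , b) (c , d) = (node a ω c ,_) <$> mul b d

  -- Δ⁺ x is the part of Δ̄ x whose left factor is not the unit.
  mutual
    Δ̄ : M → Term (M × M)
    Δ̄ nothing  = gen (nothing , nothing)
    Δ̄ (just x) = gen (nothing , just x) ⊕ (map₁ just <$> Δ⁺ x)

    Δ⁺ : N → Term (N × M)
    Δ⁺ (node l ω r) = Δ̄ l >>= λ p → Δ̄ r >>= graft ω p

  -- On left factors both sides multiply into the right subtree, by definition of `prec`; on right
  -- factors the claim is associativity of `mul`. `graft-succ²` is the mirror image.
  graft-prec² : ∀ ω p q s → (mul² q s >>= graft ω p) ≈ (graft ω p q >>= λ t → prec² t s)
  graft-prec² ω (a , b) (c , d) (e , f) = begin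
    (mul² (c , d) (e , f) >>= graft ω (a , b))
      ≈⟨ bind-bind _ _ (mul c e) ⟩
    (mul c e >>= λ u → (u ,_) <$> mul d f >>= graft ω (a , b))
      ≈⟨ bind-congʳ (mul c e) (λ u → bind-bind _ _ (mul d f)) ⟩
    (mul c e >>= λ u → mul d f >>= λ v → (node a ω u ,_) <$> mul b v)
      ≈⟨ bind-congʳ (mul c e) (λ u → bind-bind _ _ (mul d f)) ⟨
    (mul c e >>= λ u → (node a ω u ,_) <$> (mul d f >>= mul b))
      ≈⟨ bind-congʳ (mul c e) (λ u → bind-congˡ _ (mul-assoc b d f)) ⟨
    (mul c e >>= λ u → (node a ω u ,_) <$> (mul b d >>= λ t → mul t f))
      ≈⟨ bind-congʳ (mul c e) (λ u → bind-bind _ _ (mul b d)) ⟩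
    (mul c e >>= λ u → mul b d >>= λ t → (node a ω u ,_) <$> mul t f)
      ≈⟨ bind-swap _ (mul c e) (mul b d) ⟩
    (mul b d >>= λ t → mul c e >>= λ u → (node a ω u ,_) <$> mul t f)
      ≈⟨ bind-congʳ (mul b d) (λ t → bind-bind _ _ (mul c e)) ⟨
    (mul b d >>= λ t → prec² (node a ω c , t) (e , f))
      ≈⟨ bind-bind _ _ (mul b d) ⟨
    (graft ω (a , b) (c , d) >>= λ t → prec² t (e , f)) ∎

  graft-succ² : ∀ ω p q s → (mul² s p >>= λ u → graft ω u q) ≈ (graft ω p q >>= succ² s)
  graft-succ² ω (a , b) (c , d) (e , f) = begin
    (mul² (e , f) (a , b) >>= λ u → graft ω u (c , d))
      ≈⟨ bind-bind _ _ (mul e a) ⟩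
    (mul e a >>= λ u → (u ,_) <$> mul f b >>= λ u → graft ω u (c , d))
      ≈⟨ bind-congʳ (mul e a) (λ u → bind-bind _ _ (mul f b)) ⟩
    (mul e a >>= λ u → mul f b >>= λ v → (node u ω c ,_) <$> mul v d)
      ≈⟨ bind-congʳ (mul e a) (λ u → bind-bind _ _ (mul f b)) ⟨
    (mul e a >>= λ u → (node u ω c ,_) <$> (mul f b >>= λ v → mul v d))
      ≈⟨ bind-congʳ (mul e a) (λ u → bind-congˡ _ (mul-assoc f b d)) ⟩
    (mul e a >>= λ u → (node u ω c ,_) <$> (mul b d >>= mul f))
      ≈⟨ bind-congʳ (mul e a) (λ u → bind-bind _ _ (mul b d)) ⟩
    (mul e a >>= λ u → mul b d >>= λ t → (node u ω c ,_) <$> mul f t)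
      ≈⟨ bind-swap _ (mul e a) (mul b d) ⟩
    (mul b d >>= λ t → mul e a >>= λ u → (node u ω c ,_) <$> mul f t)
      ≈⟨ bind-congʳ (mul b d) (λ t → bind-bind _ _ (mul e a)) ⟨
    (mul b d >>= λ t → succ² (e , f) (node a ω c , t))
      ≈⟨ bind-bind _ _ (mul b d) ⟨
    (graft ω (a , b) (c , d) >>= succ² (e , f)) ∎

  -- This and the next two lemmas sort products by which left factors are the unit: 1 · c is read as
  -- 1 ≻ c and a · 1 as a ≺ 1, so every product with a proper left factor belongs to `prec²` or
  -- `succ²`.
  mul²-unitˡ : ∀ b q → mul² (nothing , b) (map₁ just q) ≈ (map₁ just <$> succ² (nothing , b) q)
  mul²-unitˡ b (c , d) = begin
    ((just c ,_) <$> mul b d)                                       ≈⟨ bind-bind _ _ (mul b d) ⟨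
    (map₁ just <$> (gen c >>= λ e → (e ,_) <$> mul b d))            ≡⟨ ≡.cong (λ t → map₁ just <$> (t >>= λ e → (e ,_) <$> mul b d)) (succ-identityˡ c) ⟨
    (map₁ just <$> succ² (nothing , b) (c , d))                     ∎

  mul²-unitʳ : ∀ p d → mul² (map₁ just p) (nothing , d) ≈ (map₁ just <$> prec² p (nothing , d))
  mul²-unitʳ (a , b) d = begin
    ((just a ,_) <$> mul b d)                                       ≈⟨ bind-bind _ _ (mul b d) ⟨
    (map₁ just <$> (gen a >>= λ e → (e ,_) <$> mul b d))            ≡⟨ ≡.cong (λ t → map₁ just <$> (t >>= λ e → (e ,_) <$> mul b d)) (prec-identityʳ a) ⟨
    (map₁ just <$> prec² (a , b) (nothing , d))                     ∎

  mul²-split : ∀ p q → mul² (map₁ just p) (map₁ just q) ≈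
                 (map₁ just <$> prec² p (map₁ just q)) ⊕ (map₁ just <$> succ² (map₁ just p) q)
  mul²-split (a , b) (c , d) = ⊕-cong (go (prec a (just c))) (go (succ (just a) c))
    where
    go : ∀ t → (just <$> t >>= λ e → (e ,_) <$> mul b d) ≈
               (map₁ just <$> (t >>= λ e → (e ,_) <$> mul b d))
    go t = begin
      (just <$> t >>= λ e → (e ,_) <$> mul b d)               ≈⟨ bind-bind _ _ t ⟩
      (t >>= λ e → (just e ,_) <$> mul b d)                   ≈⟨ bind-congʳ t (λ e → bind-bind _ _ (mul b d)) ⟨
      (t >>= λ e → map₁ just <$> ((e ,_) <$> mul b d))        ≈⟨ bind-bind _ _ t ⟨
      (map₁ just <$> (t >>= λ e → (e ,_) <$> mul b d))        ∎

  mutual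
    -- For proper trees, 1 ⊗ (x · y) matches the product of 1 ⊗ x and 1 ⊗ y, and the remaining terms
    -- are the sum of `Δ⁺-prec` and `Δ⁺-succ`. These in turn need multiplicativity only for a
    -- subtree of the node.
    Δ̄-mul : ∀ x y → (mul x y >>= Δ̄) ≈ (Δ̄ x >>= λ p → Δ̄ y >>= mul² p)
    Δ̄-mul nothing y = begin
      Δ̄ y                            ≈⟨ bind-gen _ ⟨
      (Δ̄ y >>= gen)                  ∎
    Δ̄-mul (just x) nothing = begin
      Δ̄ (just x)                     ≈⟨ bind-gen _ ⟨
      (Δ̄ (just x) >>= gen)           ≈⟨ bind-congʳ (Δ̄ (just x)) (λ (a , b) → go a b) ⟨
      (Δ̄ (just x) >>= λ p → mul² p (nothing , nothing)) ∎
      where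
      go : ∀ a b → mul² (a , b) (nothing , nothing) ≈ gen (a , b)
      go a b rewrite mul-identityʳ a | mul-identityʳ b = ≈-refl
    Δ̄-mul (just x) (just y) = begin
      (mul (just x) (just y) >>= Δ̄)
        ≈⟨ bind-bind _ _ (mul⁺ x y) ⟩
      (mul⁺ x y >>= λ s → gen (nothing , just s) ⊕ (map₁ just <$> Δ⁺ s))
        ≈⟨ bind-+ _ _ (mul⁺ x y) ⟩
      (mul⁺ x y >>= λ s → gen (nothing , just s)) ⊕ (mul⁺ x y >>= λ s → map₁ just <$> Δ⁺ s)
        ≈⟨ ⊕-cong (≈-sym (bind-bind _ _ (mul⁺ x y))) (≈-sym (bind-bind _ _ (mul⁺ x y))) ⟩
      mul² (nothing , just x) (nothing , just y) ⊕ (map₁ just <$> (mul⁺ x y >>= Δ⁺))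
        ≈⟨ ⊕-cong ≈-refl (bind-congˡ _ (⊕-cong (Δ⁺-prec x (just y)) (Δ⁺-succ (just x) y))) ⟩
      mul² (nothing , just x) (nothing , just y) ⊕
        ((map₁ just <$> (Δ⁺ x >>= λ p → Δ̄ (just y) >>= prec² p)) ⊕
         (map₁ just <$> ((Δ⁺ y >>= succ² (nothing , just x)) ⊕
                         (map₁ just <$> Δ⁺ x >>= λ p → Δ⁺ y >>= succ² p))))
        -- The `succ²` terms whose first argument has left factor 1 move forward: on the other side
        -- they come from the summand 1 ⊗ x of Δ̄ x.
        ≈⟨ ⊕-cong ≈-refl (≈-trans (≈-sym (⊕-assoc _ _ _)) (⊕-cong (⊕-comm _ _) ≈-refl)) ⟩
      mul² (nothing , just x) (nothing , just y) ⊕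
        ((map₁ just <$> (Δ⁺ y >>= succ² (nothing , just x))) ⊕
         (map₁ just <$> (Δ⁺ x >>= λ p → Δ̄ (just y) >>= prec² p)) ⊕
         (map₁ just <$> (map₁ just <$> Δ⁺ x >>= λ p → Δ⁺ y >>= succ² p)))
        ≈⟨ ⊕-cong ≈-refl (⊕-assoc _ _ _) ⟩
      mul² (nothing , just x) (nothing , just y) ⊕
        ((map₁ just <$> (Δ⁺ y >>= succ² (nothing , just x))) ⊕
         ((map₁ just <$> (Δ⁺ x >>= λ p → Δ̄ (just y) >>= prec² p)) ⊕
          (map₁ just <$> (map₁ just <$> Δ⁺ x >>= λ p → Δ⁺ y >>= succ² p))))
        ≈⟨ ⊕-assoc _ _ _ ⟨
      mul² (nothing , just x) (nothing , just y) ⊕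
        (map₁ just <$> (Δ⁺ y >>= succ² (nothing , just x))) ⊕
        ((map₁ just <$> (Δ⁺ x >>= λ p → Δ̄ (just y) >>= prec² p)) ⊕
         (map₁ just <$> (map₁ just <$> Δ⁺ x >>= λ p → Δ⁺ y >>= succ² p)))
        ≈⟨ ⊕-cong (⊕-cong ≈-refl unit-left) both ⟨
      (Δ̄ (just x) >>= λ p → Δ̄ (just y) >>= mul² p) ∎
      where
      unit-left : (map₁ just <$> Δ⁺ y >>= mul² (nothing , just x)) ≈
                  (map₁ just <$> (Δ⁺ y >>= succ² (nothing , just x)))
      unit-left = begin
        (map₁ just <$> Δ⁺ y >>= mul² (nothing , just x))
          ≈⟨ bind-bind _ _ (Δ⁺ y) ⟩
        (Δ⁺ y >>= λ q → mul² (nothing , just x) (map₁ just q))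
          ≈⟨ bind-congʳ (Δ⁺ y) (mul²-unitˡ (just x)) ⟩
        (Δ⁺ y >>= λ q → map₁ just <$> succ² (nothing , just x) q)
          ≈⟨ bind-bind _ _ (Δ⁺ y) ⟨
        (map₁ just <$> (Δ⁺ y >>= succ² (nothing , just x))) ∎

      each : ∀ p → (Δ̄ (just y) >>= mul² (map₁ just p)) ≈
               (map₁ just <$> (Δ̄ (just y) >>= prec² p)) ⊕
               (map₁ just <$> (Δ⁺ y >>= succ² (map₁ just p)))
      each p = begin
        mul² (map₁ just p) (nothing , just y) ⊕ (map₁ just <$> Δ⁺ y >>= mul² (map₁ just p))
          ≈⟨ ⊕-cong (mul²-unitʳ p (just y)) (bind-bind _ _ (Δ⁺ y)) ⟩
        (map₁ just <$> prec² p (nothing , just y)) ⊕ (Δ⁺ y >>= λ q → mul² (map₁ just p) (map₁ just q))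
          ≈⟨ ⊕-cong ≈-refl (≈-trans (bind-congʳ (Δ⁺ y) (mul²-split p)) (bind-+ _ _ (Δ⁺ y))) ⟩
        (map₁ just <$> prec² p (nothing , just y)) ⊕
          ((Δ⁺ y >>= λ q → map₁ just <$> prec² p (map₁ just q)) ⊕
           (Δ⁺ y >>= λ q → map₁ just <$> succ² (map₁ just p) q))
          ≈⟨ ⊕-assoc _ _ _ ⟨
        (map₁ just <$> prec² p (nothing , just y)) ⊕
          (Δ⁺ y >>= λ q → map₁ just <$> prec² p (map₁ just q)) ⊕
          (Δ⁺ y >>= λ q → map₁ just <$> succ² (map₁ just p) q)
          ≈⟨ ⊕-cong (⊕-cong ≈-refl
               (≈-trans (bind-congˡ _ (bind-bind _ _ (Δ⁺ y))) (bind-bind _ _ (Δ⁺ y))))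
               (bind-bind _ _ (Δ⁺ y)) ⟨
        (map₁ just <$> (Δ̄ (just y) >>= prec² p)) ⊕
          (map₁ just <$> (Δ⁺ y >>= succ² (map₁ just p))) ∎

      both : (map₁ just <$> Δ⁺ x >>= λ p → Δ̄ (just y) >>= mul² p) ≈
             (map₁ just <$> (Δ⁺ x >>= λ p → Δ̄ (just y) >>= prec² p)) ⊕
             (map₁ just <$> (map₁ just <$> Δ⁺ x >>= λ p → Δ⁺ y >>= succ² p))
      both = begin
        (map₁ just <$> Δ⁺ x >>= λ p → Δ̄ (just y) >>= mul² p)
          ≈⟨ bind-bind _ _ (Δ⁺ x) ⟩
        (Δ⁺ x >>= λ p → Δ̄ (just y) >>= mul² (map₁ just p))
          ≈⟨ bind-congʳ (Δ⁺ x) each ⟩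
        (Δ⁺ x >>= λ p → (map₁ just <$> (Δ̄ (just y) >>= prec² p)) ⊕
                        (map₁ just <$> (Δ⁺ y >>= succ² (map₁ just p))))
          ≈⟨ bind-+ _ _ (Δ⁺ x) ⟩
        (Δ⁺ x >>= λ p → map₁ just <$> (Δ̄ (just y) >>= prec² p)) ⊕
          (Δ⁺ x >>= λ p → map₁ just <$> (Δ⁺ y >>= succ² (map₁ just p)))
          ≈⟨ ⊕-cong (bind-bind _ _ (Δ⁺ x))
               (≈-trans (bind-congˡ _ (bind-bind _ _ (Δ⁺ x))) (bind-bind _ _ (Δ⁺ x))) ⟨
        (map₁ just <$> (Δ⁺ x >>= λ p → Δ̄ (just y) >>= prec² p)) ⊕
          (map₁ just <$> (map₁ just <$> Δ⁺ x >>= λ p → Δ⁺ y >>= succ² p)) ∎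

    Δ⁺-prec : ∀ x y → (prec x y >>= Δ⁺) ≈ (Δ⁺ x >>= λ p → Δ̄ y >>= prec² p)
    Δ⁺-prec (node l ω r) y = begin
      (prec (node l ω r) y >>= Δ⁺)
        ≈⟨ bind-bind _ _ (mul r y) ⟩
      (mul r y >>= λ s → Δ̄ l >>= λ p → Δ̄ s >>= graft ω p)
        ≈⟨ bind-swap _ (mul r y) (Δ̄ l) ⟩
      (Δ̄ l >>= λ p → mul r y >>= λ s → Δ̄ s >>= graft ω p)
        ≈⟨ bind-congʳ (Δ̄ l) (λ p → bind-bind _ _ (mul r y)) ⟨
      (Δ̄ l >>= λ p → mul r y >>= Δ̄ >>= graft ω p)
        ≈⟨ bind-congʳ (Δ̄ l) (λ p → bind-congˡ _ (Δ̄-mul r y)) ⟩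
      (Δ̄ l >>= λ p → (Δ̄ r >>= λ q → Δ̄ y >>= mul² q) >>= graft ω p)
        ≈⟨ bind-congʳ (Δ̄ l) (λ p → bind-bind _ _ (Δ̄ r)) ⟩
      (Δ̄ l >>= λ p → Δ̄ r >>= λ q → Δ̄ y >>= mul² q >>= graft ω p)
        ≈⟨ bind-congʳ (Δ̄ l) (λ p → bind-congʳ (Δ̄ r) (λ q →
             ≈-trans (bind-bind _ _ (Δ̄ y)) (bind-congʳ (Δ̄ y) (graft-prec² ω p q)))) ⟩
      (Δ̄ l >>= λ p → Δ̄ r >>= λ q → Δ̄ y >>= λ s → graft ω p q >>= λ t → prec² t s)
        ≈⟨ bind-congʳ (Δ̄ l) (λ p → bind-congʳ (Δ̄ r) (λ q → bind-swap _ (Δ̄ y) (graft ω p q))) ⟩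
      (Δ̄ l >>= λ p → Δ̄ r >>= λ q → graft ω p q >>= λ t → Δ̄ y >>= prec² t)
        ≈⟨ bind-congʳ (Δ̄ l) (λ p → bind-bind _ _ (Δ̄ r)) ⟨
      (Δ̄ l >>= λ p → Δ̄ r >>= graft ω p >>= λ t → Δ̄ y >>= prec² t)
        ≈⟨ bind-bind _ _ (Δ̄ l) ⟨
      (Δ⁺ (node l ω r) >>= λ t → Δ̄ y >>= prec² t) ∎

    Δ⁺-succ : ∀ x y → (succ x y >>= Δ⁺) ≈ (Δ̄ x >>= λ p → Δ⁺ y >>= succ² p)
    Δ⁺-succ x (node l ω r) = begin
      (succ x (node l ω r) >>= Δ⁺)
        ≈⟨ bind-bind _ _ (mul x l) ⟩
      (mul x l >>= λ s → Δ̄ s >>= λ p → Δ̄ r >>= graft ω p)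
        ≈⟨ bind-bind _ _ (mul x l) ⟨
      (mul x l >>= Δ̄ >>= λ p → Δ̄ r >>= graft ω p)
        ≈⟨ bind-congˡ _ (Δ̄-mul x l) ⟩
      ((Δ̄ x >>= λ s → Δ̄ l >>= mul² s) >>= λ p → Δ̄ r >>= graft ω p)
        ≈⟨ bind-bind _ _ (Δ̄ x) ⟩
      (Δ̄ x >>= λ s → Δ̄ l >>= mul² s >>= λ p → Δ̄ r >>= graft ω p)
        ≈⟨ bind-congʳ (Δ̄ x) (λ s → bind-bind _ _ (Δ̄ l)) ⟩
      (Δ̄ x >>= λ s → Δ̄ l >>= λ p → mul² s p >>= λ u → Δ̄ r >>= graft ω u)
        ≈⟨ bind-congʳ (Δ̄ x) (λ s → bind-congʳ (Δ̄ l) (λ p → bind-swap _ (mul² s p) (Δ̄ r))) ⟩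
      (Δ̄ x >>= λ s → Δ̄ l >>= λ p → Δ̄ r >>= λ q → mul² s p >>= λ u → graft ω u q)
        ≈⟨ bind-congʳ (Δ̄ x) (λ s → bind-congʳ (Δ̄ l) (λ p →
             bind-congʳ (Δ̄ r) (λ q → graft-succ² ω p q s))) ⟩
      (Δ̄ x >>= λ s → Δ̄ l >>= λ p → Δ̄ r >>= λ q → graft ω p q >>= succ² s)
        ≈⟨ bind-congʳ (Δ̄ x) (λ s → bind-congʳ (Δ̄ l) (λ p → bind-bind _ _ (Δ̄ r))) ⟨
      (Δ̄ x >>= λ s → Δ̄ l >>= λ p → Δ̄ r >>= graft ω p >>= succ² s)
        ≈⟨ bind-congʳ (Δ̄ x) (λ s → bind-bind _ _ (Δ̄ l)) ⟨
      (Δ̄ x >>= λ s → Δ⁺ (node l ω r) >>= succ² s) ∎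

-- Coassociativity, counit and the reduced coproduct

module Reduced {c ℓ} (R : CommutativeRing c ℓ) (Ω : Set w) where

  open LinearAlgebra R
  open FreeMonad R
  open DecoratedTrees R Ω
  open Coproduct R Ω
  open ≈-Reasoning

  comultˡ comultʳ : M × M → Term (M × M × M)
  comultˡ (a , b) = (λ (a₁ , a₂) → a₁ , a₂ , b) <$> Δ̄ a
  comultʳ (a , b) = (a ,_) <$> Δ̄ b

  -- Iterated coproducts restricted to terms with a proper first factor, the part of Δ̄ that is
  -- defined by recursion at a node.
  comultˡ⁺ comultʳ⁺ : N × M → Term (N × M × M)
  comultˡ⁺ (a , b) = (λ (a₁ , a₂) → a₁ , a₂ , b) <$> Δ⁺ a
  comultʳ⁺ (a , b) = (a ,_) <$> Δ̄ b

  -- Both iterated coproducts of a node turn out to be this graft of the iterated coproducts of its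
  -- subtrees, which reduces coassociativity to the subtrees.
  graft³ : Ω → M × M × M → M × M × M → Term (N × M × M)
  graft³ ω (a , b , c) (d , e , f) = mul b e >>= λ s → (λ t → node a ω d , s , t) <$> mul c f

  graft-comultˡ : ∀ ω p q → (graft ω p q >>= comultˡ⁺) ≈
                            (comultˡ p >>= λ P → comultˡ q >>= graft³ ω P)
  graft-comultˡ ω (a , b) (c , d) = begin
    (graft ω (a , b) (c , d) >>= comultˡ⁺)
      ≈⟨ bind-bind _ _ (mul b d) ⟩
    (mul b d >>= λ t → (λ (x₁ , x₂) → x₁ , x₂ , t) <$> Δ⁺ (node a ω c))
      ≈⟨ bind-congʳ (mul b d) (λ t → ≈-trans (bind-bind _ _ (Δ̄ a))
           (bind-congʳ (Δ̄ a) λ (a₁ , a₂) → ≈-trans (bind-bind _ _ (Δ̄ c))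
           (bind-congʳ (Δ̄ c) λ (c₁ , c₂) → bind-bind _ _ (mul a₂ c₂)))) ⟩
    (mul b d >>= λ t → Δ̄ a >>= λ (a₁ , a₂) → Δ̄ c >>= λ (c₁ , c₂) →
       (λ s → node a₁ ω c₁ , s , t) <$> mul a₂ c₂)
      ≈⟨ bind-swap _ (mul b d) (Δ̄ a) ⟩
    (Δ̄ a >>= λ (a₁ , a₂) → mul b d >>= λ t → Δ̄ c >>= λ (c₁ , c₂) →
       (λ s → node a₁ ω c₁ , s , t) <$> mul a₂ c₂)
      ≈⟨ bind-congʳ (Δ̄ a) (λ (a₁ , a₂) → ≈-trans (bind-swap _ (mul b d) (Δ̄ c))
           (bind-congʳ (Δ̄ c) λ (c₁ , c₂) → bind-swap _ (mul b d) (mul a₂ c₂))) ⟩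
    (Δ̄ a >>= λ (a₁ , a₂) → Δ̄ c >>= λ (c₁ , c₂) → graft³ ω (a₁ , a₂ , b) (c₁ , c₂ , d))
      ≈⟨ bind-congʳ (Δ̄ a) (λ (a₁ , a₂) → bind-bind _ _ (Δ̄ c)) ⟨
    (Δ̄ a >>= λ (a₁ , a₂) → comultˡ (c , d) >>= graft³ ω (a₁ , a₂ , b))
      ≈⟨ bind-bind _ _ (Δ̄ a) ⟨
    (comultˡ (a , b) >>= λ P → comultˡ (c , d) >>= graft³ ω P) ∎

  -- Multiplicativity enters coassociativity here: the right factor of a graft is a product b · d,
  -- whose coproduct has to be split. In `graft-comultˡ` it is the node that is split, so the
  -- recursion for `Δ⁺` suffices.
  graft-comultʳ : ∀ ω p q → (graft ω p q >>= comultʳ⁺) ≈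
                            (comultʳ p >>= λ P → comultʳ q >>= graft³ ω P)
  graft-comultʳ ω (a , b) (c , d) = begin
    (graft ω (a , b) (c , d) >>= comultʳ⁺)
      ≈⟨ bind-bind _ _ (mul b d) ⟩
    (mul b d >>= λ t → (node a ω c ,_) <$> Δ̄ t)
      ≈⟨ bind-bind _ _ (mul b d) ⟨
    ((node a ω c ,_) <$> (mul b d >>= Δ̄))
      ≈⟨ bind-congˡ _ (Δ̄-mul b d) ⟩
    ((node a ω c ,_) <$> (Δ̄ b >>= λ p → Δ̄ d >>= mul² p))
      ≈⟨ ≈-trans (bind-bind _ _ (Δ̄ b)) (bind-congʳ (Δ̄ b) λ (b₁ , b₂) →
         ≈-trans (bind-bind _ _ (Δ̄ d)) (bind-congʳ (Δ̄ d) λ (d₁ , d₂) →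
         ≈-trans (bind-bind _ _ (mul b₁ d₁)) (bind-congʳ (mul b₁ d₁) λ s →
           bind-bind _ _ (mul b₂ d₂)))) ⟩
    (Δ̄ b >>= λ (b₁ , b₂) → Δ̄ d >>= λ (d₁ , d₂) → graft³ ω (a , b₁ , b₂) (c , d₁ , d₂))
      ≈⟨ bind-congʳ (Δ̄ b) (λ (b₁ , b₂) → bind-bind _ _ (Δ̄ d)) ⟨
    (Δ̄ b >>= λ (b₁ , b₂) → comultʳ (c , d) >>= graft³ ω (a , b₁ , b₂))
      ≈⟨ bind-bind _ _ (Δ̄ b) ⟨
    (comultʳ (a , b) >>= λ P → comultʳ (c , d) >>= graft³ ω P) ∎

  -- Abstract in `f` and `g` because the left and right iterations differ only in their graft lemma.
  node-comult : (f : M × M → Term (M × M × M)) (g : N × M → Term (N × M × M)) →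
    (∀ ω p q → (graft ω p q >>= g) ≈ (f p >>= λ P → f q >>= graft³ ω P)) →
    ∀ l ω r → (Δ⁺ (node l ω r) >>= g) ≈
              ((Δ̄ l >>= f) >>= λ P → (Δ̄ r >>= f) >>= graft³ ω P)
  node-comult f g graft-fg l ω r = begin
    (Δ⁺ (node l ω r) >>= g)
      ≈⟨ bind-bind _ _ (Δ̄ l) ⟩
    (Δ̄ l >>= λ p → Δ̄ r >>= graft ω p >>= g)
      ≈⟨ bind-congʳ (Δ̄ l) (λ p → ≈-trans (bind-bind _ _ (Δ̄ r))
           (bind-congʳ (Δ̄ r) (graft-fg ω p))) ⟩
    (Δ̄ l >>= λ p → Δ̄ r >>= λ q → f p >>= λ P → f q >>= graft³ ω P)
      ≈⟨ bind-congʳ (Δ̄ l) (λ p → bind-swap _ (Δ̄ r) (f p)) ⟩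
    (Δ̄ l >>= λ p → f p >>= λ P → Δ̄ r >>= λ q → f q >>= graft³ ω P)
      ≈⟨ bind-congʳ (Δ̄ l) (λ p → bind-congʳ (f p) (λ P → bind-bind _ _ (Δ̄ r))) ⟨
    (Δ̄ l >>= λ p → f p >>= λ P → (Δ̄ r >>= f) >>= graft³ ω P)
      ≈⟨ bind-bind _ _ (Δ̄ l) ⟨
    ((Δ̄ l >>= f) >>= λ P → (Δ̄ r >>= f) >>= graft³ ω P) ∎

  mutual
    -- For a proper x both sides consist of 1 ⊗ 1 ⊗ x, of 1 ⊗ `Δ⁺ x`, and of terms with a proper
    -- first factor; only the last group needs `Δ⁺-coassoc`.
    Δ̄-coassoc : ∀ x → (Δ̄ x >>= comultˡ) ≈ (Δ̄ x >>= comultʳ)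
    Δ̄-coassoc nothing  = ≈-refl
    Δ̄-coassoc (just x) = begin
      gen (nothing , nothing , just x) ⊕ (map₁ just <$> Δ⁺ x >>= comultˡ)
        ≈⟨ ⊕-cong ≈-refl (begin
             (map₁ just <$> Δ⁺ x >>= comultˡ)
               ≈⟨ bind-bind _ _ (Δ⁺ x) ⟩
             (Δ⁺ x >>= λ (a , b) → comultˡ (just a , b))
               ≈⟨ bind-congʳ (Δ⁺ x) (λ (a , b) → ⊕-cong ≈-refl (bind-bind _ _ (Δ⁺ a))) ⟩
             (Δ⁺ x >>= λ (a , b) → gen (nothing , just a , b) ⊕ ((λ (a₁ , a₂) → just a₁ , a₂ , b) <$> Δ⁺ a))
               ≈⟨ bind-+ _ _ (Δ⁺ x) ⟩
             ((λ (a , b) → nothing , just a , b) <$> Δ⁺ x) ⊕ (Δ⁺ x >>= λ (a , b) → (λ (a₁ , a₂) → just a₁ , a₂ , b) <$> Δ⁺ a)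
               ≈⟨ ⊕-cong ≈-refl (bind-congʳ (Δ⁺ x) λ (a , b) → bind-bind _ _ (Δ⁺ a)) ⟨
             ((λ (a , b) → nothing , just a , b) <$> Δ⁺ x) ⊕ (Δ⁺ x >>= λ p → map₁ just <$> comultˡ⁺ p)
               ≈⟨ ⊕-cong ≈-refl (bind-bind _ _ (Δ⁺ x)) ⟨
             ((λ (a , b) → nothing , just a , b) <$> Δ⁺ x) ⊕ (map₁ just <$> (Δ⁺ x >>= comultˡ⁺))
               ≈⟨ ⊕-cong ≈-refl (bind-congˡ _ (Δ⁺-coassoc x)) ⟩
             ((λ (a , b) → nothing , just a , b) <$> Δ⁺ x) ⊕ (map₁ just <$> (Δ⁺ x >>= comultʳ⁺))
               ≈⟨ ⊕-cong ≈-refl (≈-trans (bind-bind _ _ (Δ⁺ x))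
                    (bind-congʳ (Δ⁺ x) λ (a , b) → bind-bind _ _ (Δ̄ b))) ⟩
             ((λ (a , b) → nothing , just a , b) <$> Δ⁺ x) ⊕ (Δ⁺ x >>= λ p → comultʳ (map₁ just p)) ∎) ⟩
      gen (nothing , nothing , just x) ⊕
        (((λ (a , b) → nothing , just a , b) <$> Δ⁺ x) ⊕ (Δ⁺ x >>= λ p → comultʳ (map₁ just p)))
        ≈⟨ ⊕-assoc _ _ _ ⟨
      gen (nothing , nothing , just x) ⊕
        ((λ (a , b) → nothing , just a , b) <$> Δ⁺ x) ⊕ (Δ⁺ x >>= λ p → comultʳ (map₁ just p))
        ≈⟨ ⊕-cong (⊕-cong ≈-refl (bind-bind _ _ (Δ⁺ x))) (bind-bind _ _ (Δ⁺ x)) ⟨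
      (Δ̄ (just x) >>= comultʳ) ∎

    Δ⁺-coassoc : ∀ x → (Δ⁺ x >>= comultˡ⁺) ≈ (Δ⁺ x >>= comultʳ⁺)
    Δ⁺-coassoc (node l ω r) = begin
      (Δ⁺ (node l ω r) >>= comultˡ⁺)
        ≈⟨ node-comult comultˡ comultˡ⁺ graft-comultˡ l ω r ⟩
      ((Δ̄ l >>= comultˡ) >>= λ P → (Δ̄ r >>= comultˡ) >>= graft³ ω P)
        ≈⟨ bind-cong (Δ̄-coassoc l) (λ P → bind-congˡ _ (Δ̄-coassoc r)) ⟩
      ((Δ̄ l >>= comultʳ) >>= λ P → (Δ̄ r >>= comultʳ) >>= graft³ ω P)
        ≈⟨ node-comult comultʳ comultʳ⁺ graft-comultʳ l ω r ⟨
      (Δ⁺ (node l ω r) >>= comultʳ⁺) ∎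

  -- This is id ⊗ ε with ε the coefficient of the unit. It isolates the terms with right factor 1.
  counit : M × M → Term M
  counit (a , nothing) = gen a
  counit (a , just _)  = 𝟘

  counit⁺ : N × M → Term N
  counit⁺ (a , nothing) = gen a
  counit⁺ (a , just _)  = 𝟘

  -- A product of two proper trees has no unit term, so b · d contributes to ε only if b and d are
  -- both the unit.
  graft-counit : ∀ ω p q → (graft ω p q >>= counit⁺) ≈
                           (counit p >>= λ a → node a ω <$> counit q)
  graft-counit ω (a , nothing) (c , nothing) = ≈-refl
  graft-counit ω (a , nothing) (c , just d)  = ≈-refl
  graft-counit ω (a , just b)  (c , nothing) = ≈-refl
  graft-counit ω (a , just b)  (c , just d)  = begin
    ((node a ω c ,_) <$> mul (just b) (just d) >>= counit⁺)  ≈⟨ bind-bind _ _ (mul (just b) (just d)) ⟩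
    (mul (just b) (just d) >>= λ t → counit⁺ (node a ω c , t)) ≈⟨ bind-bind _ _ (mul⁺ b d) ⟩
    (mul⁺ b d >>= λ _ → 𝟘)                                   ≈⟨ bind-0 (mul⁺ b d) ⟩
    𝟘                                                        ∎

  mutual
    Δ̄-counit : ∀ x → (Δ̄ x >>= counit) ≈ gen x
    Δ̄-counit nothing  = ≈-refl
    Δ̄-counit (just x) = begin
      𝟘 ⊕ (map₁ just <$> Δ⁺ x >>= counit)      ≈⟨ ⊕-identity _ ⟩
      (map₁ just <$> Δ⁺ x >>= counit)          ≈⟨ bind-bind _ _ (Δ⁺ x) ⟩
      (Δ⁺ x >>= λ p → counit (map₁ just p))    ≈⟨ bind-congʳ (Δ⁺ x) (λ (a , b) → go a b) ⟨
      (Δ⁺ x >>= λ p → just <$> counit⁺ p)      ≈⟨ bind-bind _ _ (Δ⁺ x) ⟨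
      (just <$> (Δ⁺ x >>= counit⁺))            ≈⟨ bind-congˡ _ (Δ⁺-counit x) ⟩
      gen (just x)                             ∎
      where
      go : ∀ a b → (just <$> counit⁺ (a , b)) ≈ counit (just a , b)
      go a nothing  = ≈-refl
      go a (just b) = ≈-refl

    Δ⁺-counit : ∀ x → (Δ⁺ x >>= counit⁺) ≈ gen x
    Δ⁺-counit (node l ω r) = begin
      (Δ⁺ (node l ω r) >>= counit⁺)
        ≈⟨ bind-bind _ _ (Δ̄ l) ⟩
      (Δ̄ l >>= λ p → Δ̄ r >>= graft ω p >>= counit⁺)
        ≈⟨ bind-congʳ (Δ̄ l) (λ p → ≈-trans (bind-bind _ _ (Δ̄ r))
             (bind-congʳ (Δ̄ r) (graft-counit ω p))) ⟩
      (Δ̄ l >>= λ p → Δ̄ r >>= λ q → counit p >>= λ a → node a ω <$> counit q)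
        ≈⟨ bind-congʳ (Δ̄ l) (λ p → bind-swap _ (Δ̄ r) (counit p)) ⟩
      (Δ̄ l >>= λ p → counit p >>= λ a → Δ̄ r >>= λ q → node a ω <$> counit q)
        ≈⟨ bind-congʳ (Δ̄ l) (λ p → bind-congʳ (counit p) (λ a →
             ≈-trans (≈-sym (bind-bind _ _ (Δ̄ r))) (bind-congˡ _ (Δ̄-counit r)))) ⟩
      (Δ̄ l >>= λ p → (λ a → node a ω r) <$> counit p)
        ≈⟨ bind-bind _ _ (Δ̄ l) ⟨
      ((λ a → node a ω r) <$> (Δ̄ l >>= counit))
        ≈⟨ bind-congˡ _ (Δ̄-counit l) ⟩
      gen (node l ω r) ∎

  reduce : N × M → Term (N × N)
  reduce (a , nothing) = 𝟘
  reduce (a , just b)  = gen (a , b)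

  -- The coproduct Δ in terms of decorated trees: `Δ⁺` has already left out 1 ⊗ x, and `reduce`
  -- removes x ⊗ 1.
  δ : N → Term (N × N)
  δ x = Δ⁺ x >>= reduce

  -- Each term is the sum of its counit part and its reduced part, exactly one of them nonzero by
  -- form; `Δ⁺-counit` evaluates the total of the first parts.
  Δ⁺-split : ∀ x → Δ⁺ x ≈ gen (x , nothing) ⊕ (map₂ just <$> δ x)
  Δ⁺-split x = begin
    Δ⁺ x
      ≈⟨ bind-gen (Δ⁺ x) ⟨
    (Δ⁺ x >>= gen)
      ≈⟨ bind-congʳ (Δ⁺ x) (λ (a , b) → go a b) ⟩
    (Δ⁺ x >>= λ p → ((_, nothing) <$> counit⁺ p) ⊕ (map₂ just <$> reduce p))
      ≈⟨ bind-+ _ _ (Δ⁺ x) ⟩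
    (Δ⁺ x >>= λ p → (_, nothing) <$> counit⁺ p) ⊕ (Δ⁺ x >>= λ p → map₂ just <$> reduce p)
      ≈⟨ ⊕-cong (≈-sym (bind-bind _ _ (Δ⁺ x))) (≈-sym (bind-bind _ _ (Δ⁺ x))) ⟩
    ((_, nothing) <$> (Δ⁺ x >>= counit⁺)) ⊕ (map₂ just <$> δ x)
      ≈⟨ ⊕-cong (bind-congˡ _ (Δ⁺-counit x)) ≈-refl ⟩
    gen (x , nothing) ⊕ (map₂ just <$> δ x) ∎
    where
    go : ∀ a b → gen (a , b) ≈ ((_, nothing) <$> counit⁺ (a , b)) ⊕ (map₂ just <$> reduce (a , b))
    go a nothing  = ≈-sym (≈-trans (⊕-comm _ _) (⊕-identity _))
    go a (just b) = ≈-sym (⊕-identity _)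

  reduce³ : N × M × M → Term (N × N × N)
  reduce³ (a , just b , just c) = gen (a , b , c)
  reduce³ _                     = 𝟘

  reduce³-nothing : ∀ a b → reduce³ (a , b , nothing) ≡ 𝟘
  reduce³-nothing a nothing  = refl
  reduce³-nothing a (just b) = refl

  -- The projection of `Δ⁺-coassoc` to terms with three proper factors: applying `reduce` after each
  -- coproduct discards the same terms as applying `reduce³` once at the end.
  δ-coassoc : ∀ x → (δ x >>= λ (a , b) → (λ (a₁ , a₂) → a₁ , a₂ , b) <$> δ a) ≈
                    (δ x >>= λ (a , b) → (a ,_) <$> δ b)
  δ-coassoc x = begin
    (δ x >>= λ (a , b) → (λ (a₁ , a₂) → a₁ , a₂ , b) <$> δ a)
      ≈⟨ bind-bind _ _ (Δ⁺ x) ⟩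
    (Δ⁺ x >>= λ p → reduce p >>= λ (a , b) → (λ (a₁ , a₂) → a₁ , a₂ , b) <$> δ a)
      ≈⟨ bind-congʳ (Δ⁺ x) (λ (a , b) → left a b) ⟩
    (Δ⁺ x >>= λ p → comultˡ⁺ p >>= reduce³)
      ≈⟨ bind-bind _ _ (Δ⁺ x) ⟨
    (Δ⁺ x >>= comultˡ⁺ >>= reduce³)
      ≈⟨ bind-congˡ _ (Δ⁺-coassoc x) ⟩
    (Δ⁺ x >>= comultʳ⁺ >>= reduce³)
      ≈⟨ bind-bind _ _ (Δ⁺ x) ⟩
    (Δ⁺ x >>= λ p → comultʳ⁺ p >>= reduce³)
      ≈⟨ bind-congʳ (Δ⁺ x) (λ (a , b) → right a b) ⟩
    (Δ⁺ x >>= λ p → reduce p >>= λ (a , b) → (a ,_) <$> δ b)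
      ≈⟨ bind-bind _ _ (Δ⁺ x) ⟨
    (δ x >>= λ (a , b) → (a ,_) <$> δ b) ∎
    where
    left : ∀ a b → (reduce (a , b) >>= λ (a , b) → (λ (a₁ , a₂) → a₁ , a₂ , b) <$> δ a) ≈
                   (comultˡ⁺ (a , b) >>= reduce³)
    left a nothing = begin
      𝟘                                                    ≈⟨ bind-0 (Δ⁺ a) ⟨
      (Δ⁺ a >>= λ _ → 𝟘)                                   ≈⟨ bind-congʳ (Δ⁺ a) (λ (a₁ , a₂) → Module.≈ᴹ-reflexive (Free _) (reduce³-nothing a₁ a₂)) ⟨
      (Δ⁺ a >>= λ (a₁ , a₂) → reduce³ (a₁ , a₂ , nothing)) ≈⟨ bind-bind _ _ (Δ⁺ a) ⟨
      (comultˡ⁺ (a , nothing) >>= reduce³)                 ∎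
    left a (just b) = begin
      ((λ (a₁ , a₂) → a₁ , a₂ , b) <$> δ a)                         ≈⟨ bind-bind _ _ (Δ⁺ a) ⟩
      (Δ⁺ a >>= λ p → (λ (a₁ , a₂) → a₁ , a₂ , b) <$> reduce p)     ≈⟨ bind-congʳ (Δ⁺ a) (λ (a₁ , a₂) → go a₁ a₂) ⟩
      (Δ⁺ a >>= λ (a₁ , a₂) → reduce³ (a₁ , a₂ , just b))           ≈⟨ bind-bind _ _ (Δ⁺ a) ⟨
      (comultˡ⁺ (a , just b) >>= reduce³)                           ∎
      where
      go : ∀ a₁ a₂ → ((λ (a₁ , a₂) → a₁ , a₂ , b) <$> reduce (a₁ , a₂)) ≈ reduce³ (a₁ , a₂ , just b)
      go a₁ nothing  = ≈-refl
      go a₁ (just _) = ≈-refl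

    right : ∀ a b → (comultʳ⁺ (a , b) >>= reduce³) ≈ (reduce (a , b) >>= λ (a , b) → (a ,_) <$> δ b)
    right a nothing  = ≈-refl
    right a (just b) = begin
      𝟘 ⊕ ((a ,_) <$> (map₁ just <$> Δ⁺ b) >>= reduce³)  ≈⟨ ⊕-identity _ ⟩
      ((a ,_) <$> (map₁ just <$> Δ⁺ b) >>= reduce³)      ≈⟨ bind-bind _ _ (map₁ just <$> Δ⁺ b) ⟩
      (map₁ just <$> Δ⁺ b >>= λ p → reduce³ (a , p))     ≈⟨ bind-bind _ _ (Δ⁺ b) ⟩
      (Δ⁺ b >>= λ p → reduce³ (a , map₁ just p))         ≈⟨ bind-congʳ (Δ⁺ b) (λ (b₁ , b₂) → go b₁ b₂) ⟩
      (Δ⁺ b >>= λ p → (a ,_) <$> reduce p)               ≈⟨ bind-bind _ _ (Δ⁺ b) ⟨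
      ((a ,_) <$> δ b)                                   ∎
      where
      go : ∀ b₁ b₂ → reduce³ (a , just b₁ , b₂) ≈ ((a ,_) <$> reduce (b₁ , b₂))
      go b₁ nothing  = ≈-refl
      go b₁ (just _) = ≈-refl

  private
    -- The left side has the order in which `δ-prec` meets the summands, the right side that of the
    -- compatibility formula. The `𝟘` is what `reduce` leaves of (x ≺ y) ⊗ 1; `rearrange` serves
    -- `δ-succ` likewise.
    shuffle : ∀ {X : Set x} {t₁ t₂ t₃ t₄ t₅ : Term X} →
              (t₁ ⊕ (𝟘 ⊕ t₄)) ⊕ (t₃ ⊕ (t₂ ⊕ t₅)) ≈ t₁ ⊕ t₂ ⊕ t₃ ⊕ t₄ ⊕ t₅
    shuffle {t₁ = t₁} {t₂} {t₃} {t₄} {t₅} = begin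
      (t₁ ⊕ (𝟘 ⊕ t₄)) ⊕ (t₃ ⊕ (t₂ ⊕ t₅))  ≈⟨ ⊕-cong (⊕-cong ≈-refl (⊕-identity t₄)) (≈-sym (⊕-assoc _ _ _)) ⟩
      (t₁ ⊕ t₄) ⊕ (t₃ ⊕ t₂ ⊕ t₅)          ≈⟨ ⊕-assoc _ _ _ ⟨
      (t₁ ⊕ t₄) ⊕ (t₃ ⊕ t₂) ⊕ t₅          ≈⟨ ⊕-cong (begin
        (t₁ ⊕ t₄) ⊕ (t₃ ⊕ t₂)               ≈⟨ ⊕-cong ≈-refl (⊕-comm t₃ t₂) ⟩
        (t₁ ⊕ t₄) ⊕ (t₂ ⊕ t₃)               ≈⟨ ⊕-assoc _ _ _ ⟩
        t₁ ⊕ (t₄ ⊕ (t₂ ⊕ t₃))               ≈⟨ ⊕-cong ≈-refl (⊕-comm _ _) ⟩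
        t₁ ⊕ (t₂ ⊕ t₃ ⊕ t₄)                 ≈⟨ ⊕-assoc _ _ _ ⟨
        t₁ ⊕ (t₂ ⊕ t₃) ⊕ t₄                 ≈⟨ ⊕-cong (⊕-assoc _ _ _) ≈-refl ⟨
        t₁ ⊕ t₂ ⊕ t₃ ⊕ t₄                   ∎) ≈-refl ⟩
      t₁ ⊕ t₂ ⊕ t₃ ⊕ t₄ ⊕ t₅              ∎

    rearrange : ∀ {X : Set x} {t₁ t₂ t₃ t₄ t₅ : Term X} →
                (t₁ ⊕ t₃) ⊕ ((𝟘 ⊕ t₄) ⊕ (t₂ ⊕ t₅)) ≈ t₁ ⊕ t₂ ⊕ t₃ ⊕ t₄ ⊕ t₅
    rearrange {t₁ = t₁} {t₂} {t₃} {t₄} {t₅} = begin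
      (t₁ ⊕ t₃) ⊕ ((𝟘 ⊕ t₄) ⊕ (t₂ ⊕ t₅))  ≈⟨ ⊕-cong ≈-refl (⊕-cong (⊕-identity t₄) ≈-refl) ⟩
      (t₁ ⊕ t₃) ⊕ (t₄ ⊕ (t₂ ⊕ t₅))        ≈⟨ ⊕-cong ≈-refl (⊕-assoc _ _ _) ⟨
      (t₁ ⊕ t₃) ⊕ (t₄ ⊕ t₂ ⊕ t₅)          ≈⟨ ⊕-assoc _ _ _ ⟨
      (t₁ ⊕ t₃) ⊕ (t₄ ⊕ t₂) ⊕ t₅          ≈⟨ ⊕-cong (begin
        (t₁ ⊕ t₃) ⊕ (t₄ ⊕ t₂)               ≈⟨ ⊕-cong ≈-refl (⊕-comm t₄ t₂) ⟩
        (t₁ ⊕ t₃) ⊕ (t₂ ⊕ t₄)               ≈⟨ ⊕-assoc _ _ _ ⟨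
        t₁ ⊕ t₃ ⊕ t₂ ⊕ t₄                   ≈⟨ ⊕-cong (⊕-assoc _ _ _) ≈-refl ⟩
        t₁ ⊕ (t₃ ⊕ t₂) ⊕ t₄                 ≈⟨ ⊕-cong (⊕-cong ≈-refl (⊕-comm _ _)) ≈-refl ⟩
        t₁ ⊕ (t₂ ⊕ t₃) ⊕ t₄                 ≈⟨ ⊕-cong (⊕-assoc _ _ _) ≈-refl ⟨
        t₁ ⊕ t₂ ⊕ t₃ ⊕ t₄                   ∎) ≈-refl ⟩
      t₁ ⊕ t₂ ⊕ t₃ ⊕ t₄ ⊕ t₅              ∎

  Δ̄-expand : ∀ {X : Set x} y (W : M × M → Term X) → (Δ̄ (just y) >>= W) ≈
    W (nothing , just y) ⊕ (W (just y , nothing) ⊕ (δ y >>= λ (c , d) → W (just c , just d)))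
  Δ̄-expand y W = ⊕-cong ≈-refl (begin
    (map₁ just <$> Δ⁺ y >>= W)
      ≈⟨ bind-bind _ _ (Δ⁺ y) ⟩
    (Δ⁺ y >>= λ p → W (map₁ just p))
      ≈⟨ bind-congˡ _ (Δ⁺-split y) ⟩
    W (just y , nothing) ⊕ (map₂ just <$> δ y >>= λ p → W (map₁ just p))
      ≈⟨ ⊕-cong ≈-refl (bind-bind _ _ (δ y)) ⟩
    W (just y , nothing) ⊕ (δ y >>= λ (c , d) → W (just c , just d)) ∎)

  Δ⁺-expand : ∀ {X : Set x} y (W : N × M → Term X) → (Δ⁺ y >>= W) ≈
    W (y , nothing) ⊕ (δ y >>= λ (c , d) → W (c , just d))
  Δ⁺-expand y W = begin
    (Δ⁺ y >>= W)
      ≈⟨ bind-congˡ _ (Δ⁺-split y) ⟩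
    W (y , nothing) ⊕ (map₂ just <$> δ y >>= W)
      ≈⟨ ⊕-cong ≈-refl (bind-bind _ _ (δ y)) ⟩
    W (y , nothing) ⊕ (δ y >>= λ (c , d) → W (c , just d)) ∎

  reduce-mul⁺ : ∀ (t : Term N) b d →
    (t >>= (λ e → (e ,_) <$> mul (just b) (just d)) >>= reduce) ≈
    (t >>= λ e → (e ,_) <$> mul⁺ b d)
  reduce-mul⁺ t b d = ≈-trans (bind-bind _ _ t) (bind-congʳ t λ e →
    ≈-trans (bind-bind _ _ (mul (just b) (just d))) (bind-bind _ _ (mul⁺ b d)))

  -- Expanding Δ⁺ x into two parts and Δ̄ y into three gives six products. One of them is (x ≺ y) ⊗
  -- 1, which `reduce` kills, and the other five are the summands stated.
  δ-prec : ∀ x y → (prec x (just y) >>= δ) ≈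
      gen (x , y)
    ⊕ (δ x >>= λ (a , b) → (_, b) <$> prec a (just y))
    ⊕ (δ x >>= λ (a , b) → (a ,_) <$> mul⁺ b y)
    ⊕ (δ y >>= λ (c , d) → (_, d) <$> prec x (just c))
    ⊕ (δ x >>= λ (a , b) → δ y >>= λ (c , d) → prec a (just c) >>= λ e → (e ,_) <$> mul⁺ b d)
  δ-prec x y = begin
    (prec x (just y) >>= δ)
      ≈⟨ bind-bind _ _ (prec x (just y)) ⟨
    (prec x (just y) >>= Δ⁺ >>= reduce)
      ≈⟨ bind-congˡ _ (Δ⁺-prec x (just y)) ⟩
    (Δ⁺ x >>= (λ p → Δ̄ (just y) >>= prec² p) >>= reduce)
      ≈⟨ ≈-trans (bind-bind _ _ (Δ⁺ x)) (bind-congʳ (Δ⁺ x) λ p →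
         ≈-trans (bind-bind _ _ (Δ̄ (just y))) (Δ̄-expand y (W p))) ⟩
    (Δ⁺ x >>= V)
      ≈⟨ Δ⁺-expand x V ⟩
    V (x , nothing) ⊕ (δ x >>= λ (a , b) → V (a , just b))
      ≈⟨ ⊕-cong
           (⊕-cong (Module.≈ᴹ-reflexive (Free _) (≡.cong (λ t → t >>= (λ e → gen (e , just y)) >>= reduce) (prec-identityʳ x)))
             (⊕-cong (≈-trans (bind-bind _ _ (prec x (just y))) (bind-0 (prec x (just y))))
                     (bind-congʳ (δ y) λ (c , d) → bind-bind _ _ (prec x (just c)))))
           (bind-congʳ (δ x) λ (a , b) →
             ⊕-cong (≈-trans (Module.≈ᴹ-reflexive (Free _) (≡.cong (λ t → t >>= (λ e → (e ,_) <$> mul (just b) (just y)) >>= reduce) (prec-identityʳ a)))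
                       (reduce-mul⁺ (gen a) b y))
             (⊕-cong (bind-bind _ _ (prec a (just y)))
                     (bind-congʳ (δ y) λ (c , d) → reduce-mul⁺ (prec a (just c)) b d))) ⟩
    _ ⊕ (δ x >>= λ (a , b) → ((a ,_) <$> mul⁺ b y) ⊕ (((_, b) <$> prec a (just y)) ⊕
      (δ y >>= λ (c , d) → prec a (just c) >>= λ e → (e ,_) <$> mul⁺ b d)))
      ≈⟨ ⊕-cong ≈-refl (≈-trans (bind-+ _ _ (δ x)) (⊕-cong ≈-refl (bind-+ _ _ (δ x)))) ⟩
    _ ≈⟨ shuffle ⟩
    _ ∎
    where
    W : N × M → M × M → Term (N × N)
    W p q = prec² p q >>= reduce
    V : N × M → Term (N × N)
    V p = W p (nothing , just y) ⊕ (W p (just y , nothing) ⊕ (δ y >>= λ (c , d) → W p (just c , just d)))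

  δ-succ : ∀ x y → (succ (just x) y >>= δ) ≈
      gen (y , x)
    ⊕ (δ x >>= λ (a , b) → (_, b) <$> succ (just a) y)
    ⊕ (δ y >>= λ (c , d) → (c ,_) <$> mul⁺ x d)
    ⊕ (δ y >>= λ (c , d) → (_, d) <$> succ (just x) c)
    ⊕ (δ x >>= λ (a , b) → δ y >>= λ (c , d) → succ (just a) c >>= λ e → (e ,_) <$> mul⁺ b d)
  δ-succ x y = begin
    (succ (just x) y >>= δ)
      ≈⟨ bind-bind _ _ (succ (just x) y) ⟨
    (succ (just x) y >>= Δ⁺ >>= reduce)
      ≈⟨ bind-congˡ _ (Δ⁺-succ (just x) y) ⟩
    (Δ̄ (just x) >>= (λ p → Δ⁺ y >>= succ² p) >>= reduce)
      ≈⟨ ≈-trans (bind-bind _ _ (Δ̄ (just x))) (bind-congʳ (Δ̄ (just x)) λ p →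
         ≈-trans (bind-bind _ _ (Δ⁺ y)) (Δ⁺-expand y (W p))) ⟩
    (Δ̄ (just x) >>= V)
      ≈⟨ Δ̄-expand x V ⟩
    V (nothing , just x) ⊕ (V (just x , nothing) ⊕ (δ x >>= λ (a , b) → V (just a , just b)))
      ≈⟨ ⊕-cong
           (⊕-cong (Module.≈ᴹ-reflexive (Free _) (≡.cong (λ t → t >>= (λ e → gen (e , just x)) >>= reduce) (succ-identityˡ y)))
             (bind-congʳ (δ y) λ (c , d) →
               ≈-trans (Module.≈ᴹ-reflexive (Free _) (≡.cong (λ t → t >>= (λ e → (e ,_) <$> mul (just x) (just d)) >>= reduce) (succ-identityˡ c)))
                       (reduce-mul⁺ (gen c) x d)))
           (⊕-cong
             (⊕-cong (≈-trans (bind-bind _ _ (succ (just x) y)) (bind-0 (succ (just x) y)))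
                     (bind-congʳ (δ y) λ (c , d) → bind-bind _ _ (succ (just x) c)))
             (≈-trans (bind-congʳ (δ x) λ (a , b) →
               ⊕-cong (bind-bind _ _ (succ (just a) y))
                      (bind-congʳ (δ y) λ (c , d) → reduce-mul⁺ (succ (just a) c) b d))
             (bind-+ _ _ (δ x)))) ⟩
    _ ≈⟨ rearrange ⟩
    _ ∎
    where
    W : M × M → N × M → Term (N × N)
    W p q = succ² p q >>= reduce
    V : M × M → Term (N × N)
    V p = W p (y , nothing) ⊕ (δ y >>= λ (c , d) → W p (c , just d))

-- The bijection between decorated trees and typed trees with a root type

module Encoding (Ω : EDS w) where

  open EDS Ω

  Root : Set w
  Root = Carrier × Tree⁺ Carrier

  -- Computes x ≻ (ω ⊗ Y). Its right branch is trivial, so only the root type and the left branch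
  -- are kept; `joinʳ` then multiplies by ≺ y.
  joinˡ : Maybe Root → Carrier → Carrier × Branch Carrier
  joinˡ nothing        ω = ω , ∅
  joinˡ (just (α , S)) ω = α ⟶ ω , (α ▹ ω) ↘ S

  joinʳ : Carrier × Branch Carrier → Maybe Root → Root
  joinʳ (ε , l) nothing        = ε , l ⋁ ∅
  joinʳ (ε , l) (just (α , T)) = ε ⟵ α , l ⋁ (ε ◃ α) ↘ T

  mutual
    encode : Node Carrier → Root
    encode (node l ω r) = joinʳ (joinˡ (encode? l) ω) (encode? r)

    encode? : Maybe (Node Carrier) → Maybe Root
    encode? nothing  = nothing
    encode? (just x) = just (encode x)

  vertices-encode : ∀ n → vertices (proj₂ (encode n)) ≡ size n
  vertices-encode (node nothing  ω nothing)  = refl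
  vertices-encode (node nothing  ω (just r)) = ≡.cong suc (vertices-encode r)
  vertices-encode (node (just l) ω nothing)  = ≡.cong (λ k → suc (k ℕ.+ 0)) (vertices-encode l)
  vertices-encode (node (just l) ω (just r)) =
    ≡.cong₂ (λ i j → suc (i ℕ.+ j)) (vertices-encode l) (vertices-encode r)

  module _ (nondegenerate : Nondegenerate Ω) where

    open Nondegenerate nondegenerate

    private
      invˡ invʳ : Carrier × Carrier → Carrier × Carrier
      invˡ p = proj₁ (proj₂ left-bijective p)
      invʳ p = proj₁ (proj₂ right-bijective p)

      invˡ-right : ∀ p → (proj₁ (invˡ p) ⟵ proj₂ (invˡ p) , proj₁ (invˡ p) ◃ proj₂ (invˡ p)) ≡ p
      invˡ-right p = proj₂ (proj₂ left-bijective p) refl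

      invʳ-right : ∀ p → (proj₁ (invʳ p) ⟶ proj₂ (invʳ p) , proj₁ (invʳ p) ▹ proj₂ (invʳ p)) ≡ p
      invʳ-right p = proj₂ (proj₂ right-bijective p) refl

      invˡ-left : ∀ α β → invˡ (α ⟵ β , α ◃ β) ≡ (α , β)
      invˡ-left α β = proj₁ left-bijective (invˡ-right _)

      invʳ-left : ∀ α β → invʳ (α ⟶ β , α ▹ β) ≡ (α , β)
      invʳ-left α β = proj₁ right-bijective (invʳ-right _)

    mutual
      -- The right branch is undone first: the root type and the right edge type together determine
      -- the type ε of x ≻ (ω ⊗ Y), and only with ε does the left edge type reveal ω.
      decode : Carrier → Tree⁺ Carrier → Node Carrier
      decode α (l ⋁ r) = node (proj₁ (splitˡ (proj₁ (splitʳ α r)) l))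
                              (proj₂ (splitˡ (proj₁ (splitʳ α r)) l))
                              (proj₂ (splitʳ α r))

      splitˡ : Carrier → Branch Carrier → Maybe (Node Carrier) × Carrier
      splitˡ ε ∅       = nothing , ε
      splitˡ ε (β ↘ S) = just (decode (proj₁ (invʳ (ε , β))) S) , proj₂ (invʳ (ε , β))

      splitʳ : Carrier → Branch Carrier → Carrier × Maybe (Node Carrier)
      splitʳ α ∅       = α , nothing
      splitʳ α (β ↘ T) = proj₁ (invˡ (α , β)) , just (decode (proj₂ (invˡ (α , β))) T)

    mutual
      encode-decode : ∀ α T → encode (decode α T) ≡ (α , T)
      encode-decode α (l ⋁ r) = ≡.trans
        (≡.cong (λ p → joinʳ p (encode? (proj₂ (splitʳ α r)))) (join-splitˡ (proj₁ (splitʳ α r)) l))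
        (join-splitʳ α l r)

      join-splitˡ : ∀ ε l → joinˡ (encode? (proj₁ (splitˡ ε l))) (proj₂ (splitˡ ε l)) ≡ (ε , l)
      join-splitˡ ε ∅       = refl
      join-splitˡ ε (β ↘ S) = ≡.trans
        (≡.cong (λ p → joinˡ (just p) (proj₂ (invʳ (ε , β)))) (encode-decode _ S))
        (≡.cong (λ (ε′ , β′) → ε′ , β′ ↘ S) (invʳ-right (ε , β)))

      join-splitʳ : ∀ α l r → joinʳ (proj₁ (splitʳ α r) , l) (encode? (proj₂ (splitʳ α r))) ≡ (α , l ⋁ r)
      join-splitʳ α l ∅       = refl
      join-splitʳ α l (β ↘ T) = ≡.trans
        (≡.cong (λ p → joinʳ (proj₁ (invˡ (α , β)) , l) (just p)) (encode-decode _ T))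
        (≡.cong (λ (α′ , β′) → α′ , l ⋁ β′ ↘ T) (invˡ-right (α , β)))

    decode′ : Root → Node Carrier
    decode′ (α , T) = decode α T

    mutual
      decode-encode : ∀ n → decode′ (encode n) ≡ n
      decode-encode (node l ω r) = ≡.trans (decode-joinʳ (joinˡ (encode? l) ω) r)
        (≡.cong (λ (l , ω) → node l ω r) (split-joinˡ l ω))

      decode-joinʳ : ∀ p r → decode′ (joinʳ p (encode? r)) ≡
                     node (proj₁ (splitˡ (proj₁ p) (proj₂ p))) (proj₂ (splitˡ (proj₁ p) (proj₂ p))) r
      decode-joinʳ (ε , l) nothing  = refl
      decode-joinʳ (ε , l) (just r) = ≡.trans
        (≡.cong (λ (ε , α) → node (proj₁ (splitˡ ε l)) (proj₂ (splitˡ ε l))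
                               (just (decode α (proj₂ (encode r)))))
          (invˡ-left ε (proj₁ (encode r))))
        (≡.cong (λ r → node (proj₁ (splitˡ ε l)) (proj₂ (splitˡ ε l)) (just r)) (decode-encode r))

      split-joinˡ : ∀ l ω → splitˡ (proj₁ (joinˡ (encode? l) ω)) (proj₂ (joinˡ (encode? l) ω)) ≡ (l , ω)
      split-joinˡ nothing  ω = refl
      split-joinˡ (just l) ω = ≡.trans
        (≡.cong (λ (α , ω) → just (decode α (proj₂ (encode l))) , ω) (invʳ-left (proj₁ (encode l)) ω))
        (≡.cong (λ l → just l , ω) (decode-encode l))

-- The encoding respects the two products

module Homomorphism {c ℓ₁ ℓ₂} (K : HeytingField c ℓ₁ ℓ₂) (Ω : EDS w) where

  open TypedTrees K Ω hiding (_≺_; _≻_)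
  open EDS Ω
  open IsEDS isEDS
  open IsDiassociativeSemigroup isDiassociativeSemigroup
  open FreeMonad 𝕂
  open DecoratedTrees 𝕂 Carrier
  open Encoding Ω

  private
    module B = Module B

  basis : Root → ∣ B ∣
  basis (α , T) = gen α ⊗ gen T

  basisᴺ : N → ∣ B ∣
  basisᴺ n = basis (encode n)

  Ψ : LinearMap (Free N) B
  Ψ = freeLift {P = B} basisᴺ

  -- The map u ↦ (ε ⊗ (l ⋁ ∅)) ≺ u.
  joinʳ-linear : Carrier → Branch Carrier → LinearMap B B
  joinʳ-linear ε l = uncurryₗ {M = 𝕂Ω} {N = 𝕂𝒯⁺} {P = B} (freeLift {P = 𝕂𝒯⁺ ⊸ B} λ α →
    (tensor {M = 𝕂Ω} {N = 𝕂𝒯⁺} $ gen (ε ⟵ α)) ∘ₗ graftʳ l (ε ◃ α))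

  -- With `o α = α ⟶ ω` and trivial `r` this is u ↦ u ≻ (ω ⊗ Y); the general form allows for a
  -- further right factor.
  joinˡ-linear : (Carrier → Carrier) → Carrier → (Carrier → Branch Carrier) → LinearMap B B
  joinˡ-linear o ω r = uncurryₗ {M = 𝕂Ω} {N = 𝕂𝒯⁺} {P = B} (freeLift {P = 𝕂𝒯⁺ ⊸ B} λ α →
    (tensor {M = 𝕂Ω} {N = 𝕂𝒯⁺} $ gen (o α)) ∘ₗ graftˡ (α ▹ ω) (r α))

  infixl 7 _≺_ _≻_
  _≺_ _≻_ : ∣ B ∣ → ∣ B ∣ → ∣ B ∣
  u ≺ v = ≺ᴮ $ u $ v
  u ≻ v = ≻ᴮ $ u $ v

  -- The axiom (e ≺ p) ≺ q = e ≺ (p · q) for e = ε ⊗ (l ⋁ ∅). The four axioms with two outer `◃`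
  -- match the edge types and the inner products; `⟵-assoc` and `⟵-absorbs` give both summands one
  -- root type, so that they merge into a single tensor.
  joinʳ-linear-≺ : ∀ ε l p q →
    joinʳ-linear ε l $ (basis p ≺ basis q ⊕ basis p ≻ basis q) B.≈ᴹ
    basis (joinʳ (ε , l) (just p)) ≺ basis q
  joinʳ-linear-≺ ε l (α , S) (γ , T)
    rewrite ⟵-assoc ε α γ | ◃-⟵-◃ ε α γ | ◃-◃-◃ ε α γ | ◃-⟶-◃ ε α γ | ◃-▹-◃ ε α γ
          | ≡.sym (⟵-absorbs ε α γ) = ≈-sym (relation (+ʳ _ _ _))

  -- o and r give the root type and the right branch in terms of the type α of the
  -- factor on the left of ω; the two choices used are those for a trivial and for a
  -- nontrivial right subtree.
  joinˡ-linear-≻ : ∀ o ω (r : Carrier → Branch Carrier) →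
    (∀ γ α → γ ⟶ o α ≡ o (γ ⟶ α)) → (∀ γ α → γ ⟶ o α ≡ o (γ ⟵ α)) →
    (∀ γ α → γ ▹ o α ≡ γ ▹ (α ⟶ ω)) →
    (∀ γ α → r (γ ⟶ α) ≡ r α) → (∀ γ α → r (γ ⟵ α) ≡ r α) →
    ∀ p q →
    joinˡ-linear o ω r $ (basis p ≻ basis q ⊕ basis p ≺ basis q) B.≈ᴹ
    basis p ≻ basis (o (proj₁ q) , (proj₁ q ▹ ω) ↘ proj₂ q ⋁ r (proj₁ q))
  joinˡ-linear-≻ o ω r o-⟶ o-⟵ ▹-o r-⟶ r-⟵ (γ , T) (α , S)
    rewrite ▹-o γ α | ▹-⟶-▹ γ α ω | ▹-▹-▹ γ α ω | ▹-⟵-▹ γ α ω | ▹-◃-▹ γ α ω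
          | r-⟶ γ α | r-⟵ γ α | ≡.sym (o-⟵ γ α) | ≡.sym (o-⟶ γ α) = ≈-sym (relation (+ʳ _ _ _))

  open SetoidReasoning B.≈ᴹ-setoid

  mutual
    -- A half-product of a node grafts a full product of one subtree, so the induction passes
    -- through `Ψ-mul⁺` and needs both half-products at once.
    Ψ-prec : ∀ x y → Ψ $ prec x (just y) B.≈ᴹ basisᴺ x ≺ basisᴺ y
    Ψ-prec (node l ω nothing)  y = B.≈ᴹ-refl
    Ψ-prec (node l ω (just r)) y = begin
      Ψ $ prec (node l ω (just r)) (just y)
        ≡⟨ extend-bind B _ basisᴺ (mul (just r) (just y)) ⟩
      extend B (λ s → basisᴺ (node l ω s)) (just <$> mul⁺ r y)
        ≡⟨ extend-bind B _ _ (mul⁺ r y) ⟩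
      extend B (λ s → basisᴺ (node l ω (just s))) (mul⁺ r y)
        ≈⟨ map-extend J basisᴺ (mul⁺ r y) ⟨
      J $ (Ψ $ mul⁺ r y)
        ≈⟨ LinearMap.⟦⟧-cong J (Ψ-mul⁺ r y) ⟩
      J $ (basisᴺ r ≺ basisᴺ y ⊕ basisᴺ r ≻ basisᴺ y)
        ≈⟨ joinʳ-linear-≺ _ _ (encode r) (encode y) ⟩
      basisᴺ (node l ω (just r)) ≺ basisᴺ y ∎
      where
      J : LinearMap B B
      J = joinʳ-linear (proj₁ (joinˡ (encode? l) ω)) (proj₂ (joinˡ (encode? l) ω))

    Ψ-succ : ∀ x y → Ψ $ succ (just x) y B.≈ᴹ basisᴺ x ≻ basisᴺ y
    Ψ-succ x (node nothing ω nothing) = B.≈ᴹ-refl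
    Ψ-succ x (node nothing ω (just r))
      -- The axiom (x ≻ y) ≺ z = x ≻ (y ≺ z) at the level of types, with y = ω ⊗ Y and z the right
      -- subtree.
      rewrite ≡.sym (inner-assoc (proj₁ (encode x)) ω (proj₁ (encode r)))
            | ▹-⟵ (proj₁ (encode x)) ω (proj₁ (encode r))
            | ⟶-◃ (proj₁ (encode x)) ω (proj₁ (encode r)) = B.≈ᴹ-refl
    Ψ-succ x (node (just l) ω r) = begin
      Ψ $ succ (just x) (node (just l) ω r)
        ≡⟨ extend-bind B _ basisᴺ (mul (just x) (just l)) ⟩
      extend B (λ s → basisᴺ (node s ω r)) (just <$> mul⁺ x l)
        ≡⟨ extend-bind B _ _ (mul⁺ x l) ⟩
      extend B (λ s → basisᴺ (node (just s) ω r)) (mul⁺ x l)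
        ≈⟨ go r ⟩
      basisᴺ x ≻ basisᴺ (node (just l) ω r) ∎
      where
      step : ∀ r (o : Carrier → Carrier) (br : Carrier → Branch Carrier) →
        (∀ α S → joinʳ (joinˡ (just (α , S)) ω) (encode? r) ≡ (o α , (α ▹ ω) ↘ S ⋁ br α)) →
        (∀ γ α → γ ⟶ o α ≡ o (γ ⟶ α)) → (∀ γ α → γ ⟶ o α ≡ o (γ ⟵ α)) →
        (∀ γ α → γ ▹ o α ≡ γ ▹ (α ⟶ ω)) →
        (∀ γ α → br (γ ⟶ α) ≡ br α) → (∀ γ α → br (γ ⟵ α) ≡ br α) →
        extend B (λ s → basisᴺ (node (just s) ω r)) (mul⁺ x l) B.≈ᴹ
        basisᴺ x ≻ basisᴺ (node (just l) ω r)
      step r o br join-eq e₁ e₂ e₃ e₄ e₅ = begin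
        extend B (λ s → basisᴺ (node (just s) ω r)) (mul⁺ x l)
          ≈⟨ extend-congʳ B (λ s → B.≈ᴹ-reflexive (≡.cong basis (join-eq _ _))) (mul⁺ x l) ⟩
        extend B (λ s → J $ basisᴺ s) (mul⁺ x l)
          ≈⟨ map-extend J basisᴺ (mul⁺ x l) ⟨
        J $ (Ψ $ mul⁺ x l)
          -- The summands are exchanged because `≻ᵗ` is defined with its `≻` summand first.
          ≈⟨ LinearMap.⟦⟧-cong J (B.≈ᴹ-trans (Ψ-mul⁺ x l) (⊕-comm _ _)) ⟩
        J $ (basisᴺ x ≻ basisᴺ l ⊕ basisᴺ x ≺ basisᴺ l)
          ≈⟨ joinˡ-linear-≻ o ω br e₁ e₂ e₃ e₄ e₅ (encode x) (encode l) ⟩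
        basisᴺ x ≻ basis _
          ≡⟨ ≡.cong (λ p → basisᴺ x ≻ basis p) (join-eq _ _) ⟨
        basisᴺ x ≻ basisᴺ (node (just l) ω r) ∎
        where
        J : LinearMap B B
        J = joinˡ-linear o ω br

      ⟶-⟶ : ∀ γ α → γ ⟶ (α ⟶ ω) ≡ (γ ⟶ α) ⟶ ω
      ⟶-⟶ γ α = ≡.sym (≡.trans (⟶-absorbs γ α ω) (⟶-assoc γ α ω))

      go : ∀ r → extend B (λ s → basisᴺ (node (just s) ω r)) (mul⁺ x l) B.≈ᴹ
                 basisᴺ x ≻ basisᴺ (node (just l) ω r)
      go nothing = step nothing (_⟶ ω) (λ _ → ∅) (λ _ _ → refl)
        ⟶-⟶ (λ γ α → ≡.sym (⟶-assoc γ α ω)) (λ _ _ → refl) (λ _ _ → refl) (λ _ _ → refl)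
      -- Here the right edge has type (α ⟶ ω) ◃ β, which equals ω ◃ β by `⟶-◃` and hence does not
      -- change when α is multiplied from the left.
      go (just r) = step (just r) (λ α → (α ⟶ ω) ⟵ β) (λ α → ((α ⟶ ω) ◃ β) ↘ T) (λ _ _ → refl)
        (λ γ α → ≡.trans (≡.sym (inner-assoc γ (α ⟶ ω) β)) (≡.cong (_⟵ β) (⟶-⟶ γ α)))
        (λ γ α → ≡.trans (≡.sym (inner-assoc γ (α ⟶ ω) β)) (≡.cong (_⟵ β) (≡.sym (⟶-assoc γ α ω))))
        (λ γ α → ▹-⟵ γ (α ⟶ ω) β)
        (λ γ α → ≡.cong (_↘ T) (≡.trans (⟶-◃ (γ ⟶ α) ω β) (≡.sym (⟶-◃ α ω β))))
        (λ γ α → ≡.cong (_↘ T) (≡.trans (⟶-◃ (γ ⟵ α) ω β) (≡.sym (⟶-◃ α ω β))))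
        where
        β = proj₁ (encode r)
        T = proj₂ (encode r)

    Ψ-mul⁺ : ∀ x y → Ψ $ mul⁺ x y B.≈ᴹ basisᴺ x ≺ basisᴺ y ⊕ basisᴺ x ≻ basisᴺ y
    Ψ-mul⁺ x y = B.+ᴹ-cong (Ψ-prec x y) (Ψ-succ x y)

-- Transport of multilinear identities to a spanned module

module Spanned {c ℓ} (R : CommutativeRing c ℓ) (Ω : Set w) (A : Module R a ℓa)
  (b : Node Ω → Module.Carrierᴹ A)
  (spanned : ∀ u → ∃ λ t → Module._≈ᴹ_ A u (LinearAlgebra.extend R A b t)) where

  open LinearAlgebra R
  open Dendriform R hiding (_≺_; _≻_)
  open FreeMonad R
  open DecoratedTrees R Ω
  open Reduced R Ω

  private
    module A = Module A
    module A₂ = Module (A ⊗ᴹ A)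

  Ψ : Term N → ∣ A ∣
  Ψ = extend A b

  Ψ₂ : Term (N × N) → ∣ A ⊗ᴹ A ∣
  Ψ₂ = extend (A ⊗ᴹ A) λ (m , n) → b m ⊗ b n

  Ψ₃ : Term (N × N × N) → ∣ A ⊗ᴹ A ⊗ᴹ A ∣
  Ψ₃ = extend (A ⊗ᴹ A ⊗ᴹ A) λ (l , m , n) → b l ⊗ b m ⊗ b n

  module _ {P : Module R p ℓp} where

    private
      module P = Module P

    unique : (f g : LinearMap A P) → (∀ n → f $ b n P.≈ᴹ g $ b n) → f ≋ g
    unique f g f≈g u = P.≈ᴹ-trans (f.⟦⟧-cong u≈Ψt) (P.≈ᴹ-trans (map-extend f b t)
      (P.≈ᴹ-trans (extend-congʳ P f≈g t) (P.≈ᴹ-sym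
      (P.≈ᴹ-trans (g.⟦⟧-cong u≈Ψt) (map-extend g b t)))))
      where
      module f = LinearMap f
      module g = LinearMap g
      t = proj₁ (spanned u)
      u≈Ψt = proj₂ (spanned u)

  -- A record instead of a bare function type, so that `β` and `f` can be read off from the type of
  -- the evidence.
  record Represents (β : LinearMap A (A ⊸ A)) (f : N → N → Term N) : Set (w ⊔ ℓa) where
    constructor represents
    field on-basis : ∀ m n → β $ b m $ b n A.≈ᴹ Ψ (f m n)

  open Represents

  module _ {β₁ β₂ β₃ β₄ : LinearMap A (A ⊸ A)} {f₁ f₂ f₃ f₄ : N → N → Term N}
    (h₁ : Represents β₁ f₁) (h₂ : Represents β₂ f₂)
    (h₃ : Represents β₃ f₃) (h₄ : Represents β₄ f₄)
    (assoc : ∀ l m n → (f₁ l m >>= λ s → f₂ s n) ≈ (f₃ m n >>= f₄ l)) where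

    open SetoidReasoning A.≈ᴹ-setoid

    -- Four operations are allowed to differ because the dendriform axioms mix `≺`, `≻` and their
    -- sum; each axiom is one instance. Both sides are linear in each of the three variables.
    transport-assoc : ∀ u v t → β₂ $ (β₁ $ u $ v) $ t A.≈ᴹ β₄ $ u $ (β₃ $ v $ t)
    transport-assoc u v t =
      unique ((flipₗ β₂ $ t) ∘ₗ (flipₗ β₁ $ v)) (flipₗ β₄ $ (β₃ $ v $ t)) (λ l →
        unique ((flipₗ β₂ $ t) ∘ₗ (β₁ $ b l)) ((β₄ $ b l) ∘ₗ (flipₗ β₃ $ t)) (λ m →
          unique (β₂ $ (β₁ $ b l $ b m)) ((β₄ $ b l) ∘ₗ (β₃ $ b m)) (agree l m) t) v) u
      where
      agree : ∀ l m n → β₂ $ (β₁ $ b l $ b m) $ b n A.≈ᴹ β₄ $ b l $ (β₃ $ b m $ b n)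
      agree l m n = begin
        β₂ $ (β₁ $ b l $ b m) $ b n
          ≈⟨ LinearMap.⟦⟧-cong β₂ (on-basis h₁ l m) (b n) ⟩
        β₂ $ Ψ (f₁ l m) $ b n
          ≈⟨ extend-natural (flipₗ β₂ $ b n) (λ s → on-basis h₂ s n) (f₁ l m) ⟩
        Ψ (f₁ l m >>= λ s → f₂ s n)
          ≈⟨ extend-congˡ A b (assoc l m n) ⟩
        Ψ (f₃ m n >>= f₄ l)
          ≈⟨ extend-natural (β₄ $ b l) (on-basis h₄ l) (f₃ m n) ⟨
        β₄ $ b l $ Ψ (f₃ m n)
          ≈⟨ LinearMap.⟦⟧-cong (β₄ $ b l) (on-basis h₃ m n) ⟨
        β₄ $ b l $ (β₃ $ b m $ b n) ∎

  Ψ⊗b : ∀ t n → Ψ t ⊗ b n A₂.≈ᴹ Ψ₂ ((_, n) <$> t)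
  Ψ⊗b t n = extend-natural (flipₗ tensor $ b n) (λ _ → A₂.≈ᴹ-refl) t

  b⊗Ψ : ∀ n t → b n ⊗ Ψ t A₂.≈ᴹ Ψ₂ ((n ,_) <$> t)
  b⊗Ψ n t = extend-natural (tensor $ b n) (λ _ → A₂.≈ᴹ-refl) t

  Ψ⊗Ψ : ∀ s t → Ψ s ⊗ Ψ t A₂.≈ᴹ Ψ₂ (s >>= λ m → (m ,_) <$> t)
  Ψ⊗Ψ s t = extend-natural (flipₗ tensor $ Ψ t) (λ m → b⊗Ψ m t) s

  Ψ₂-map₁ : (F : LinearMap A A) {f : N → Term N} → (∀ n → F $ b n A.≈ᴹ Ψ (f n)) →
    ∀ t → (F ⊗₁ idₗ A) $ Ψ₂ t A₂.≈ᴹ Ψ₂ (t >>= λ (m , n) → (_, n) <$> f m)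
  Ψ₂-map₁ F {f} h = extend-natural (F ⊗₁ idₗ A) λ (m , n) →
    A₂.≈ᴹ-trans (relation (cong (h m) A.≈ᴹ-refl)) (Ψ⊗b (f m) n)

  Ψ₂-map₂ : (F : LinearMap A A) {f : N → Term N} → (∀ n → F $ b n A.≈ᴹ Ψ (f n)) →
    ∀ t → (idₗ A ⊗₁ F) $ Ψ₂ t A₂.≈ᴹ Ψ₂ (t >>= λ (m , n) → (m ,_) <$> f n)
  Ψ₂-map₂ F {f} h = extend-natural (idₗ A ⊗₁ F) λ (m , n) →
    A₂.≈ᴹ-trans (relation (cong A.≈ᴹ-refl (h n))) (b⊗Ψ m (f n))

  Ψ₂-⊗₂ : {β γ : LinearMap A (A ⊸ A)} {f g : N → N → Term N} →
    Represents β f → Represents γ g → ∀ s t → (β ⊗₂ γ) $ Ψ₂ s $ Ψ₂ t A₂.≈ᴹ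
    Ψ₂ (s >>= λ (k , l) → t >>= λ (m , n) → f k m >>= λ e → (e ,_) <$> g l n)
  Ψ₂-⊗₂ {β} {γ} {f} {g} hβ hγ s t =
    extend-natural (flipₗ (β ⊗₂ γ) $ Ψ₂ t) (λ (k , l) →
      extend-natural ((β ⊗₂ γ) $ (b k ⊗ b l)) (λ (m , n) →
        A₂.≈ᴹ-trans (relation (cong (on-basis hβ k m) (on-basis hγ l n))) (Ψ⊗Ψ (f k m) (g l n))) t) s

  -- Some summands of the compatibility formulas contain a variable in the operator and not under Δ;
  -- here such a summand is made a linear map of that variable.
  actˡ actʳ : LinearMap A (A ⊸ A) → ∣ A ⊗ᴹ A ∣ → LinearMap A (A ⊗ᴹ A)
  actˡ β z = linearMap (λ u → (β $ u ⊗₁ idₗ A) $ z)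
    (λ u≈v → extend-congʳ (A ⊗ᴹ A) (λ (p , q) → relation (cong (β.⟦⟧-cong u≈v p) A.≈ᴹ-refl)) z)
    (λ u v → A₂.≈ᴹ-trans (extend-congʳ (A ⊗ᴹ A) (λ (p , q) →
      A₂.≈ᴹ-trans (relation (cong (β.+ᴹ-homo u v p) A.≈ᴹ-refl)) (relation (+ˡ _ _ q))) z)
      (extend-+ (A ⊗ᴹ A) _ _ z))
    (λ k u → A₂.≈ᴹ-trans (extend-congʳ (A ⊗ᴹ A) (λ (p , q) →
      A₂.≈ᴹ-trans (relation (cong (β.*ₗ-homo k u p) A.≈ᴹ-refl)) (relation (*ˡ k _ q))) z)
      (extend-* (A ⊗ᴹ A) k _ z))
    where module β = LinearMap β
  actʳ β z = linearMap (λ u → (idₗ A ⊗₁ β $ u) $ z)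
    (λ u≈v → extend-congʳ (A ⊗ᴹ A) (λ (p , q) → relation (cong A.≈ᴹ-refl (β.⟦⟧-cong u≈v q))) z)
    (λ u v → A₂.≈ᴹ-trans (extend-congʳ (A ⊗ᴹ A) (λ (p , q) →
      A₂.≈ᴹ-trans (relation (cong A.≈ᴹ-refl (β.+ᴹ-homo u v q))) (relation (+ʳ p _ _))) z)
      (extend-+ (A ⊗ᴹ A) _ _ z))
    (λ k u → A₂.≈ᴹ-trans (extend-congʳ (A ⊗ᴹ A) (λ (p , q) →
      A₂.≈ᴹ-trans (relation (cong A.≈ᴹ-refl (β.*ₗ-homo k u q))) (relation (*ʳ k p _))) z)
      (extend-* (A ⊗ᴹ A) k _ z))
    where module β = LinearMap β

  prec⁺ succ⁺ : N → N → Term N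
  prec⁺ x y = prec x (just y)
  succ⁺ x y = succ (just x) y

  module _ {≺ₗ ≻ₗ γ : LinearMap A (A ⊸ A)} (≺-prec : Represents ≺ₗ prec⁺)
    (≻-succ : Represents ≻ₗ succ⁺) (·-mul⁺ : Represents γ mul⁺)
    {Δ : LinearMap A (A ⊗ᴹ A)} (Δ-δ : ∀ n → Δ $ b n A₂.≈ᴹ Ψ₂ (δ n)) where

    private
      module Δ = LinearMap Δ

    private
      module D = Module (A ⊸ A ⊗ᴹ A)
      infixl 6 _+_
      _+_ = A₂._+ᴹ_

    on-Δ : (F : LinearMap (A ⊗ᴹ A) (A ⊗ᴹ A)) → ∀ n {z} → F $ Ψ₂ (δ n) A₂.≈ᴹ z →
           z A₂.≈ᴹ F $ (Δ $ b n)
    on-Δ F n e = A₂.≈ᴹ-sym (A₂.≈ᴹ-trans (LinearMap.⟦⟧-cong F (Δ-δ n)) e)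

    Δ-⊗₂-Δ : {β γ : LinearMap A (A ⊸ A)} {f g : N → N → Term N} →
      Represents β f → Represents γ g → ∀ m n →
      Ψ₂ (δ m >>= λ (k , l) → δ n >>= λ (m , n) → f k m >>= λ e → (e ,_) <$> g l n) A₂.≈ᴹ
      (β ⊗₂ γ) $ (Δ $ b m) $ (Δ $ b n)
    Δ-⊗₂-Δ {β} {γ} hβ hγ m n = A₂.≈ᴹ-sym (A₂.≈ᴹ-trans
      (LinearMap.⟦⟧-cong (flipₗ (β ⊗₂ γ) $ (Δ $ b n)) (Δ-δ m))
      (A₂.≈ᴹ-trans (LinearMap.⟦⟧-cong ((β ⊗₂ γ) $ Ψ₂ (δ m)) (Δ-δ n)) (Ψ₂-⊗₂ hβ hγ (δ m) (δ n))))

    open SetoidReasoning A₂.≈ᴹ-setoid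

    Δ-≺-basis : ∀ m n → Δ $ (≺ₗ $ b m $ b n) A₂.≈ᴹ
        b m ⊗ b n
        + (flipₗ ≺ₗ $ b n ⊗₁ idₗ A) $ (Δ $ b m)
        + (idₗ A ⊗₁ flipₗ γ $ b n) $ (Δ $ b m)
        + (≺ₗ $ b m ⊗₁ idₗ A) $ (Δ $ b n)
        + (≺ₗ ⊗₂ γ) $ (Δ $ b m) $ (Δ $ b n)
    Δ-≺-basis m n = begin
      Δ $ (≺ₗ $ b m $ b n)   ≈⟨ Δ.⟦⟧-cong (on-basis ≺-prec m n) ⟩
      Δ $ Ψ (prec⁺ m n)      ≈⟨ extend-natural Δ Δ-δ (prec⁺ m n) ⟩
      Ψ₂ (prec⁺ m n >>= δ)   ≈⟨ extend-congˡ (A ⊗ᴹ A) _ (δ-prec m n) ⟩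
      _                      ≈⟨ A₂.+ᴹ-cong (A₂.+ᴹ-cong (A₂.+ᴹ-cong (A₂.+ᴹ-congˡ
        (on-Δ (flipₗ ≺ₗ $ b n ⊗₁ idₗ A) m (Ψ₂-map₁ (flipₗ ≺ₗ $ b n) {λ k → prec⁺ k n} (λ k → on-basis ≺-prec k n) (δ m))))
        (on-Δ (idₗ A ⊗₁ flipₗ γ $ b n) m (Ψ₂-map₂ (flipₗ γ $ b n) {λ k → mul⁺ k n} (λ k → on-basis ·-mul⁺ k n) (δ m))))
        (on-Δ (≺ₗ $ b m ⊗₁ idₗ A) n (Ψ₂-map₁ (≺ₗ $ b m) {prec⁺ m} (on-basis ≺-prec m) (δ n))))
        (Δ-⊗₂-Δ {≺ₗ} {γ} {prec⁺} {mul⁺} ≺-prec ·-mul⁺ m n) ⟩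
      _ ∎

    Δ-≻-basis : ∀ m n → Δ $ (≻ₗ $ b m $ b n) A₂.≈ᴹ
        b n ⊗ b m
        + (flipₗ ≻ₗ $ b n ⊗₁ idₗ A) $ (Δ $ b m)
        + (idₗ A ⊗₁ γ $ b m) $ (Δ $ b n)
        + (≻ₗ $ b m ⊗₁ idₗ A) $ (Δ $ b n)
        + (≻ₗ ⊗₂ γ) $ (Δ $ b m) $ (Δ $ b n)
    Δ-≻-basis m n = begin
      Δ $ (≻ₗ $ b m $ b n)   ≈⟨ Δ.⟦⟧-cong (on-basis ≻-succ m n) ⟩
      Δ $ Ψ (succ⁺ m n)      ≈⟨ extend-natural Δ Δ-δ (succ⁺ m n) ⟩
      Ψ₂ (succ⁺ m n >>= δ)   ≈⟨ extend-congˡ (A ⊗ᴹ A) _ (δ-succ m n) ⟩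
      _                      ≈⟨ A₂.+ᴹ-cong (A₂.+ᴹ-cong (A₂.+ᴹ-cong (A₂.+ᴹ-congˡ
        (on-Δ (flipₗ ≻ₗ $ b n ⊗₁ idₗ A) m (Ψ₂-map₁ (flipₗ ≻ₗ $ b n) {λ k → succ⁺ k n} (λ k → on-basis ≻-succ k n) (δ m))))
        (on-Δ (idₗ A ⊗₁ γ $ b m) n (Ψ₂-map₂ (γ $ b m) {mul⁺ m} (on-basis ·-mul⁺ m) (δ n))))
        (on-Δ (≻ₗ $ b m ⊗₁ idₗ A) n (Ψ₂-map₁ (≻ₗ $ b m) {succ⁺ m} (on-basis ≻-succ m) (δ n))))
        (Δ-⊗₂-Δ {≻ₗ} {γ} {succ⁺} {mul⁺} ≻-succ ·-mul⁺ m n) ⟩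
      _ ∎

    -- Both sides are presented as linear maps of u; once u is a basis element, they are presented
    -- anew as linear maps of v, which leaves `Δ-≺-basis`.
    Δ-≺-expansion : ∀ u v → Δ $ (≺ₗ $ u $ v) A₂.≈ᴹ
        u ⊗ v
        + (flipₗ ≺ₗ $ v ⊗₁ idₗ A) $ (Δ $ u)
        + (idₗ A ⊗₁ flipₗ γ $ v) $ (Δ $ u)
        + (≺ₗ $ u ⊗₁ idₗ A) $ (Δ $ v)
        + (≺ₗ ⊗₂ γ) $ (Δ $ u) $ (Δ $ v)
    Δ-≺-expansion u v =
      unique (Δ ∘ₗ (flipₗ ≺ₗ $ v)) (flipₗ tensor $ v
        D.+ᴹ (flipₗ ≺ₗ $ v ⊗₁ idₗ A) ∘ₗ Δ
        D.+ᴹ (idₗ A ⊗₁ flipₗ γ $ v) ∘ₗ Δ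
        D.+ᴹ actˡ ≺ₗ (Δ $ v)
        D.+ᴹ (flipₗ (≺ₗ ⊗₂ γ) $ (Δ $ v)) ∘ₗ Δ) (λ m →
      unique (Δ ∘ₗ (≺ₗ $ b m)) (tensor $ b m
        D.+ᴹ actˡ (flipₗ ≺ₗ) (Δ $ b m)
        D.+ᴹ actʳ (flipₗ γ) (Δ $ b m)
        D.+ᴹ (≺ₗ $ b m ⊗₁ idₗ A) ∘ₗ Δ
        D.+ᴹ ((≺ₗ ⊗₂ γ) $ (Δ $ b m)) ∘ₗ Δ) (Δ-≺-basis m) v) u

    Δ-≻-expansion : ∀ u v → Δ $ (≻ₗ $ u $ v) A₂.≈ᴹ
        v ⊗ u
        + (flipₗ ≻ₗ $ v ⊗₁ idₗ A) $ (Δ $ u)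
        + (idₗ A ⊗₁ γ $ u) $ (Δ $ v)
        + (≻ₗ $ u ⊗₁ idₗ A) $ (Δ $ v)
        + (≻ₗ ⊗₂ γ) $ (Δ $ u) $ (Δ $ v)
    Δ-≻-expansion u v =
      unique (Δ ∘ₗ (flipₗ ≻ₗ $ v)) (tensor $ v
        D.+ᴹ (flipₗ ≻ₗ $ v ⊗₁ idₗ A) ∘ₗ Δ
        D.+ᴹ actʳ γ (Δ $ v)
        D.+ᴹ actˡ ≻ₗ (Δ $ v)
        D.+ᴹ (flipₗ (≻ₗ ⊗₂ γ) $ (Δ $ v)) ∘ₗ Δ) (λ m →
      unique (Δ ∘ₗ (≻ₗ $ b m)) (flipₗ tensor $ b m
        D.+ᴹ actˡ (flipₗ ≻ₗ) (Δ $ b m)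
        D.+ᴹ (idₗ A ⊗₁ γ $ b m) ∘ₗ Δ
        D.+ᴹ (≻ₗ $ b m ⊗₁ idₗ A) ∘ₗ Δ
        D.+ᴹ ((≻ₗ ⊗₂ γ) $ (Δ $ b m)) ∘ₗ Δ) (Δ-≻-basis m) v) u

  module _ {≺ₗ ≻ₗ : LinearMap A (A ⊸ A)}
    (≺-prec : Represents ≺ₗ prec⁺) (≻-succ : Represents ≻ₗ succ⁺) where

    ·-mul : Represents (·ₗ A ≺ₗ ≻ₗ) mul⁺
    ·-mul = represents λ m n → A.+ᴹ-cong (on-basis ≺-prec m n) (on-basis ≻-succ m n)

    isDendriformAlgebra : IsDendriformAlgebra A ≺ₗ ≻ₗ
    isDendriformAlgebra = record
      { ≺-≺ = transport-assoc ≺-prec ≺-prec ·-mul ≺-prec λ l m n →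
          ≈-trans (prec-assoc l (just m) (just n)) (bind-bind _ _ (mul⁺ m n))
      ; ≻-≺ = transport-assoc ≻-succ ≺-prec ≺-prec ≻-succ λ l m n →
          succ-prec-assoc (just l) m (just n)
      ; ≻-≻ = transport-assoc ·-mul ≻-succ ≻-succ ≻-succ λ l m n →
          ≈-trans (≈-sym (bind-bind _ _ (mul⁺ l m))) (succ-assoc (just l) (just m) n)
      }

    module _ {Δ : LinearMap A (A ⊗ᴹ A)} (Δ-δ : ∀ n → Δ $ b n A₂.≈ᴹ Ψ₂ (δ n)) where

      private
        module A₃ = Module (A ⊗ᴹ A ⊗ᴹ A)
        module Δ = LinearMap Δ

      Δ-coassociative : Coassociative A ≺ₗ ≻ₗ Δ
      Δ-coassociative = unique (assoc ∘ₗ (Δ ⊗₁ idₗ A) ∘ₗ Δ) ((idₗ A ⊗₁ Δ) ∘ₗ Δ) λ n → begin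
        assoc $ ((Δ ⊗₁ idₗ A) $ (Δ $ b n))
          ≈⟨ LinearMap.⟦⟧-cong (assoc ∘ₗ (Δ ⊗₁ idₗ A)) (Δ-δ n) ⟩
        assoc $ ((Δ ⊗₁ idₗ A) $ Ψ₂ (δ n))
          ≈⟨ extend-natural (assoc ∘ₗ (Δ ⊗₁ idₗ A)) left (δ n) ⟩
        Ψ₃ (δ n >>= λ (m , n) → (λ (m₁ , m₂) → m₁ , m₂ , n) <$> δ m)
          ≈⟨ extend-congˡ (A ⊗ᴹ A ⊗ᴹ A) _ (δ-coassoc n) ⟩
        Ψ₃ (δ n >>= λ (m , n) → (m ,_) <$> δ n)
          ≈⟨ extend-natural (idₗ A ⊗₁ Δ) right (δ n) ⟨
        (idₗ A ⊗₁ Δ) $ Ψ₂ (δ n)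
          ≈⟨ LinearMap.⟦⟧-cong (idₗ A ⊗₁ Δ) (Δ-δ n) ⟨
        (idₗ A ⊗₁ Δ) $ (Δ $ b n) ∎
        where
        assoc = associator {M = A} {N = A} {P = A}
        open SetoidReasoning A₃.≈ᴹ-setoid
        left : ∀ ((m , n) : N × N) → assoc $ ((Δ $ b m) ⊗ b n) A₃.≈ᴹ
               Ψ₃ ((λ (m₁ , m₂) → m₁ , m₂ , n) <$> δ m)
        left (m , n) = A₃.≈ᴹ-trans
          (LinearMap.⟦⟧-cong assoc (relation (cong (Δ-δ m) A.≈ᴹ-refl)))
          (extend-natural (assoc ∘ₗ (flipₗ tensor $ b n)) (λ _ → A₃.≈ᴹ-refl) (δ m))
        right : ∀ ((m , n) : N × N) → b m ⊗ (Δ $ b n) A₃.≈ᴹ Ψ₃ ((m ,_) <$> δ n)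
        right (m , n) = A₃.≈ᴹ-trans (relation (cong A.≈ᴹ-refl (Δ-δ n)))
          (extend-natural (tensor $ b m) (λ _ → A₃.≈ᴹ-refl) (δ n))

      isDendriformBialgebra : IsDendriformBialgebra A ≺ₗ ≻ₗ Δ
      isDendriformBialgebra = record
        { isDendriformAlgebra = isDendriformAlgebra
        ; coassociative       = Δ-coassociative
        ; Δ-≺ = Δ-≺-expansion {≺ₗ} {≻ₗ} {·ₗ A ≺ₗ ≻ₗ} ≺-prec ≻-succ ·-mul {Δ} Δ-δ
        ; Δ-≻ = Δ-≻-expansion {≺ₗ} {≻ₗ} {·ₗ A ≺ₗ ≻ₗ} ≺-prec ≻-succ ·-mul {Δ} Δ-δ
        }

-- Homogeneity of products and coproduct on decorated trees

module Sizes {c ℓ} (R : CommutativeRing c ℓ) (Ω : Set w) where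

  open LinearAlgebra R
  open FreeMonad R
  open DecoratedTrees R Ω
  open Coproduct R Ω
  open Reduced R Ω
  open CommutativeSemigroupProperties +-commutativeSemigroup using (interchange)

  -- A condition on the written term, not on its class: `𝟘` always satisfies it, a zero multiple of
  -- `gen y` only if `Q y` holds. The recursively defined terms satisfy it as they stand.
  Supported : {X : Set x} → (X → Set p) → Term X → Set p
  Supported Q (gen y) = Q y
  Supported Q 𝟘       = ⊤
  Supported Q (t ⊕ u) = Supported Q t × Supported Q u
  Supported Q (k ⊙ t) = Supported Q t

  Supported-bind : {X : Set x} {Y : Set y} {Q : X → Set p} {Q′ : Y → Set q} (t : Term X)
    {f : X → Term Y} → Supported Q t → (∀ {x} → Q x → Supported Q′ (f x)) →
    Supported Q′ (t >>= f)
  Supported-bind (gen x) st         sf = sf st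
  Supported-bind 𝟘       st         sf = tt
  Supported-bind (t ⊕ u) (st , su)  sf = Supported-bind t st sf , Supported-bind u su sf
  Supported-bind (k ⊙ t) st         sf = Supported-bind t st sf

  size²? : M × M → ℕ
  size²? (a , b) = size? a ℕ.+ size? b

  size²⁺ : N × M → ℕ
  size²⁺ (a , b) = size a ℕ.+ size? b

  size² : N × N → ℕ
  size² (a , b) = size a ℕ.+ size b

  mutual
    prec-size : ∀ x y → Supported (λ n → size n ≡ size x ℕ.+ size? y) (prec x y)
    prec-size (node l ω r) y = Supported-bind (mul r y) (mul-size r y) λ e →
      ≡.cong suc (≡.trans (≡.cong (size? l ℕ.+_) e) (≡.sym (+-assoc (size? l) (size? r) (size? y))))

    succ-size : ∀ x y → Supported (λ n → size n ≡ size? x ℕ.+ size y) (succ x y)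
    succ-size x (node l ω r) = Supported-bind (mul x l) (mul-size x l) λ e →
      ≡.trans (≡.cong suc (≡.trans (≡.cong (ℕ._+ size? r) e) (+-assoc (size? x) (size? l) (size? r))))
              (≡.sym (+-suc (size? x) (size? l ℕ.+ size? r)))

    mul-size : ∀ x y → Supported (λ n → size? n ≡ size? x ℕ.+ size? y) (mul x y)
    mul-size nothing  y        = refl
    mul-size (just x) nothing  = ≡.sym (ℕ.+-identityʳ (size x))
    mul-size (just x) (just y) =
      Supported-bind (prec x (just y)) (prec-size x (just y)) (λ e → e) ,
      Supported-bind (succ (just x) y) (succ-size (just x) y) (λ e → e)

  mutual
    Δ̄-size : ∀ x → Supported (λ p → size²? p ≡ size? x) (Δ̄ x)
    Δ̄-size nothing  = refl
    Δ̄-size (just x) = refl , Supported-bind (Δ⁺ x) (Δ⁺-size x) (λ e → e)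

    Δ⁺-size : ∀ x → Supported (λ p → size²⁺ p ≡ size x) (Δ⁺ x)
    Δ⁺-size (node l ω r) =
      Supported-bind (Δ̄ l) (Δ̄-size l) λ {(l₁ , l₂)} eˡ →
      Supported-bind (Δ̄ r) (Δ̄-size r) λ {(r₁ , r₂)} eʳ →
      Supported-bind (mul l₂ r₂) (mul-size l₂ r₂) λ {t} e →
        ≡.cong suc (≡.trans (≡.cong (size? l₁ ℕ.+ size? r₁ ℕ.+_) e)
          (≡.trans (interchange (size? l₁) (size? r₁) (size? l₂) (size? r₂)) (≡.cong₂ ℕ._+_ eˡ eʳ)))

  δ-size : ∀ x → Supported (λ p → size² p ≡ size x) (δ x)
  δ-size x = Supported-bind (Δ⁺ x) (Δ⁺-size x) λ {(a , b)} → go a b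
    where
    go : ∀ a b → size²⁺ (a , b) ≡ size x → Supported (λ p → size² p ≡ size x) (reduce (a , b))
    go a nothing  e = tt
    go a (just b) e = e

-- Uniqueness of the coproduct

module Uniqueness {c ℓ} (R : CommutativeRing c ℓ) (Ω : Set w) (A : Module R a ℓa)
  (b : Node Ω → Module.Carrierᴹ A)
  (spanned : ∀ u → ∃ λ t → Module._≈ᴹ_ A u (LinearAlgebra.extend R A b t)) where

  open LinearAlgebra R
  open Dendriform R hiding (_≺_; _≻_)
  open Spanned R Ω A b spanned
  open Represents

  private
    module A = Module A
    module A₂ = Module (A ⊗ᴹ A)

  module _ {≺ₗ ≻ₗ : LinearMap A (A ⊸ A)}
    (≺-prec : Represents ≺ₗ prec⁺) (≻-succ : Represents ≻ₗ succ⁺)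
    {Δ Δ′ : LinearMap A (A ⊗ᴹ A)}
    (bialgebra  : IsDendriformBialgebra A ≺ₗ ≻ₗ Δ)
    (bialgebra′ : IsDendriformBialgebra A ≺ₗ ≻ₗ Δ′)
    (on-generators : ∀ ω → Δ $ b (node nothing ω nothing) A₂.≈ᴹ Δ′ $ b (node nothing ω nothing)) where

    private
      module Δ = LinearMap Δ
      module Δ′ = LinearMap Δ′

      agree-≺ : ∀ u v → Δ $ u A₂.≈ᴹ Δ′ $ u → Δ $ v A₂.≈ᴹ Δ′ $ v →
                Δ $ (≺ₗ $ u $ v) A₂.≈ᴹ Δ′ $ (≺ₗ $ u $ v)
      agree-≺ u v eu ev = A₂.≈ᴹ-trans (IsDendriformBialgebra.Δ-≺ bialgebra u v) (A₂.≈ᴹ-trans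
        (A₂.+ᴹ-cong (A₂.+ᴹ-cong (A₂.+ᴹ-cong (A₂.+ᴹ-congˡ
          (LinearMap.⟦⟧-cong (flipₗ ≺ₗ $ v ⊗₁ idₗ A) eu))
          (LinearMap.⟦⟧-cong (idₗ A ⊗₁ flipₗ (·ₗ A ≺ₗ ≻ₗ) $ v) eu))
          (LinearMap.⟦⟧-cong (≺ₗ $ u ⊗₁ idₗ A) ev))
          (A₂.≈ᴹ-trans (LinearMap.⟦⟧-cong (≺ₗ ⊗₂ ·ₗ A ≺ₗ ≻ₗ) eu (Δ $ v))
            (LinearMap.⟦⟧-cong ((≺ₗ ⊗₂ ·ₗ A ≺ₗ ≻ₗ) $ (Δ′ $ u)) ev)))
        (A₂.≈ᴹ-sym (IsDendriformBialgebra.Δ-≺ bialgebra′ u v)))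

      agree-≻ : ∀ u v → Δ $ u A₂.≈ᴹ Δ′ $ u → Δ $ v A₂.≈ᴹ Δ′ $ v →
                Δ $ (≻ₗ $ u $ v) A₂.≈ᴹ Δ′ $ (≻ₗ $ u $ v)
      agree-≻ u v eu ev = A₂.≈ᴹ-trans (IsDendriformBialgebra.Δ-≻ bialgebra u v) (A₂.≈ᴹ-trans
        (A₂.+ᴹ-cong (A₂.+ᴹ-cong (A₂.+ᴹ-cong (A₂.+ᴹ-congˡ
          (LinearMap.⟦⟧-cong (flipₗ ≻ₗ $ v ⊗₁ idₗ A) eu))
          (LinearMap.⟦⟧-cong (idₗ A ⊗₁ (·ₗ A ≺ₗ ≻ₗ) $ u) ev))
          (LinearMap.⟦⟧-cong (≻ₗ $ u ⊗₁ idₗ A) ev))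
          (A₂.≈ᴹ-trans (LinearMap.⟦⟧-cong (≻ₗ ⊗₂ ·ₗ A ≺ₗ ≻ₗ) eu (Δ $ v))
            (LinearMap.⟦⟧-cong ((≻ₗ ⊗₂ ·ₗ A ≺ₗ ≻ₗ) $ (Δ′ $ u)) ev)))
        (A₂.≈ᴹ-sym (IsDendriformBialgebra.Δ-≻ bialgebra′ u v)))

      resp : ∀ {u v} → u A.≈ᴹ v → Δ $ u A₂.≈ᴹ Δ′ $ u → Δ $ v A₂.≈ᴹ Δ′ $ v
      resp u≈v e = A₂.≈ᴹ-trans (Δ.⟦⟧-cong (A.≈ᴹ-sym u≈v)) (A₂.≈ᴹ-trans e (Δ′.⟦⟧-cong u≈v))

      mutual
        -- Every tree is l ≻ (ω ≺ r), with ω standing for its single-node tree. Such products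
        -- compute to one tree, and the compatibility formulas determine Δ on them from its values
        -- on the factors.
        agree : ∀ n → Δ $ b n A₂.≈ᴹ Δ′ $ b n
        agree (node nothing  ω r) = agreeʳ ω r
        agree (node (just l) ω r) = resp (on-basis ≻-succ l (node nothing ω r))
          (agree-≻ (b l) (b (node nothing ω r)) (agree l) (agreeʳ ω r))

        agreeʳ : ∀ ω r → Δ $ b (node nothing ω r) A₂.≈ᴹ Δ′ $ b (node nothing ω r)
        agreeʳ ω nothing  = on-generators ω
        agreeʳ ω (just r) = resp (on-basis ≺-prec (node nothing ω nothing) r)
          (agree-≺ (b (node nothing ω nothing)) (b r) (on-generators ω) (agree r))

    coproduct-unique : Δ ≋ Δ′
    coproduct-unique = unique Δ Δ′ agree

-- The grading by size

module Grading {c ℓ} (R : CommutativeRing c ℓ) (Ω : Set w) (A : Module R a ℓa)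
  (b : Node Ω → Module.Carrierᴹ A)
  (spanned : ∀ u → ∃ λ t → Module._≈ᴹ_ A u (LinearAlgebra.extend R A b t))
  (coordinates : LinearAlgebra.LinearMap R A (LinearAlgebra.Free R (Node Ω)))
  (coordinates-b : ∀ n → FreeMonad._≈_ R (LinearAlgebra.LinearMap._$_ coordinates (b n))
                                          (LinearAlgebra.gen n))
  {s′} (S : ℕ → Pred (Module.Carrierᴹ A) s′) (S-b : ∀ n → S (size n) (b n))
  (S-elim : ∀ {d u} → S d u → ∃ λ n → size n ≡ d × u ≡ b n) where

  open LinearAlgebra R
  open Dendriform R hiding (_≺_; _≻_)
  open FreeMonad R
  open DecoratedTrees R Ω
  open Reduced R Ω
  open Sizes R Ω
  open Spanned R Ω A b spanned
  open Represents

  private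
    module A = Module A
    module A₂ = Module (A ⊗ᴹ A)

  open RawMonoidSum A.+ᴹ-rawMonoid using (sum)

  -- By `S-b` and `S-elim` the generators of degree d are the `b n` with `size n ≡ d`. Keeping `S`
  -- abstract lets `G` coincide literally with a grading described by typed trees.
  G : ℕ → Pred ∣ A ∣ _
  G d = Span A (S d)

  span-map : {P : Module R p ℓp} {S : Pred ∣ A ∣ q} {T : Pred ∣ P ∣ s} (F : LinearMap A P) →
             (∀ {u} → S u → Span P T (F $ u)) → ∀ {u} → Span A S u → Span P T (F $ u)
  span-map {P = P} F F-S = go
    where
    module P = Module P
    module F = LinearMap F
    go : ∀ {u} → Span A _ u → Span P _ (F $ u)
    go (incl Su)        = F-S Su
    go (span≈ u≈v Su)   = span≈ (F.⟦⟧-cong u≈v) (go Su)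
    go span0            = span≈ (P.≈ᴹ-sym F.0ᴹ-homo) span0
    go (span+ Su Sv)    = span≈ (P.≈ᴹ-sym (F.+ᴹ-homo _ _)) (span+ (go Su) (go Sv))
    go (span* k Su)     = span≈ (P.≈ᴹ-sym (F.*ₗ-homo _ _)) (span* k (go Su))

  span-unique : {P : Module R p ℓp} {S : Pred ∣ A ∣ q} (F H : LinearMap A P) →
    (∀ {u} → S u → Module._≈ᴹ_ P (F $ u) (H $ u)) →
    ∀ {u} → Span A S u → Module._≈ᴹ_ P (F $ u) (H $ u)
  span-unique {P = P} F H F≈H = go
    where
    module P = Module P
    module F = LinearMap F
    module H = LinearMap H
    go : ∀ {u} → Span A _ u → F $ u P.≈ᴹ H $ u
    go (incl Su)      = F≈H Su
    go (span≈ u≈v Su) = P.≈ᴹ-trans (F.⟦⟧-cong (A.≈ᴹ-sym u≈v)) (P.≈ᴹ-trans (go Su) (H.⟦⟧-cong u≈v))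
    go span0          = P.≈ᴹ-trans F.0ᴹ-homo (P.≈ᴹ-sym H.0ᴹ-homo)
    go (span+ Su Sv)  = P.≈ᴹ-trans (F.+ᴹ-homo _ _)
      (P.≈ᴹ-trans (P.+ᴹ-cong (go Su) (go Sv)) (P.≈ᴹ-sym (H.+ᴹ-homo _ _)))
    go (span* k Su)   = P.≈ᴹ-trans (F.*ₗ-homo _ _)
      (P.≈ᴹ-trans (P.*ₗ-congˡ (go Su)) (P.≈ᴹ-sym (H.*ₗ-homo _ _)))

  b-homogeneous : ∀ {d n} → size n ≡ d → G d (b n)
  b-homogeneous {n = n} refl = incl (S-b n)

  extend-span : {X : Set x} {Q : X → Set y} {P : Module R p ℓp} {T : Pred ∣ P ∣ q} {f : X → ∣ P ∣} →
    (∀ {x} → Q x → Span P T (f x)) → ∀ t → Supported Q t → Span P T (extend P f t)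
  extend-span h (gen x) st        = h st
  extend-span h 𝟘       st        = span0
  extend-span h (t ⊕ u) (st , su) = span+ (extend-span h t st) (extend-span h u su)
  extend-span h (k ⊙ t) st        = span* k (extend-span h t st)

  product-graded : {β : LinearMap A (A ⊸ A)} {f : N → N → Term N} → Represents β f →
    (∀ m n → Supported (λ k → size k ≡ size m ℕ.+ size n) (f m n)) →
    ∀ {i j u v} → G i u → G j v → G (i ℕ.+ j) (β $ u $ v)
  product-graded {β} {f} hβ f-size {i} {j} {v = v} Gu Gv =
    span-map (flipₗ β $ v) (λ Su → on-generator (S-elim Su)) Gu
    where
    on-generator : ∀ {u} → ∃ (λ m → size m ≡ i × u ≡ b m) → G (i ℕ.+ j) (β $ u $ v)
    on-generator (m , refl , refl) = span-map (β $ b m) (λ Sv → on-generators (S-elim Sv)) Gv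
      where
      on-generators : ∀ {v} → ∃ (λ n → size n ≡ j × v ≡ b n) → G (size m ℕ.+ j) (β $ b m $ v)
      on-generators (n , refl , refl) = span≈ (A.≈ᴹ-sym (on-basis hβ m n))
        (extend-span b-homogeneous (f m n) (f-size m n))

  coproduct-graded : (Δ : LinearMap A (A ⊗ᴹ A)) → (∀ n → Δ $ b n A₂.≈ᴹ Ψ₂ (δ n)) →
    ∀ {d u} → G d u → tensorGrade A A G G d (Δ $ u)
  coproduct-graded Δ Δ-δ {d} = span-map Δ (λ Su → on-generator (S-elim Su))
    where
    on-generator : ∀ {u} → ∃ (λ n → size n ≡ d × u ≡ b n) → tensorGrade A A G G d (Δ $ u)
    on-generator (n , refl , refl) = span≈ (A₂.≈ᴹ-sym (Δ-δ n)) (extend-span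
      (λ {(k , l)} e → incl (size k , size l , b k , b l , e , b-homogeneous refl , b-homogeneous refl , refl))
      (δ n) (δ-size n))

  -- The projection onto degree d sends b n to pick d (size n) (b n).
  pick : ℕ → ℕ → ∣ A ∣ → ∣ A ∣
  pick zero    zero    u = u
  pick zero    (suc _) u = A.0ᴹ
  pick (suc _) zero    u = A.0ᴹ
  pick (suc d) (suc e) u = pick d e u

  pick-≡ : ∀ d u → pick d d u ≡ u
  pick-≡ zero    u = refl
  pick-≡ (suc d) u = pick-≡ d u

  pick-≢ : ∀ {d e} u → d ≢ e → pick d e u ≡ A.0ᴹ
  pick-≢ {zero}  {zero}  u d≢e = contradiction refl d≢e
  pick-≢ {zero}  {suc e} u d≢e = refl
  pick-≢ {suc d} {zero}  u d≢e = refl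
  pick-≢ {suc d} {suc e} u d≢e = pick-≢ u (λ d≡e → d≢e (≡.cong suc d≡e))

  pick-homogeneous : ∀ d n → G d (pick d (size n) (b n))
  pick-homogeneous d n with d ℕ.≟ size n
  ... | yes refl = ≡.subst (G d) (≡.sym (pick-≡ d (b n))) (incl (S-b n))
  ... | no  d≢   = ≡.subst (G d) (≡.sym (pick-≢ (b n) d≢)) span0

  -- Read off from a representing term, for the decomposition into degrees; `projection` is the
  -- linear map on the module itself, for independence.
  component : ℕ → Term N → ∣ A ∣
  component d = extend A λ n → pick d (size n) (b n)

  projection : ℕ → LinearMap A A
  projection d = freeLift {P = A} (λ n → pick d (size n) (b n)) ∘ₗ coordinates

  projection-b : ∀ d n → projection d $ b n A.≈ᴹ pick d (size n) (b n)
  projection-b d n = extend-congˡ A _ (coordinates-b n)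

  projection-fixes : ∀ {d u} → G d u → projection d $ u A.≈ᴹ u
  projection-fixes {d} = span-unique (projection d) (idₗ A) λ Su → on-generator (S-elim Su)
    where
    on-generator : ∀ {u} → ∃ (λ n → size n ≡ d × u ≡ b n) → projection d $ u A.≈ᴹ u
    on-generator (n , refl , refl) =
      A.≈ᴹ-trans (projection-b d n) (A.≈ᴹ-reflexive (pick-≡ d (b n)))

  projection-kills : ∀ {d e u} → d ≢ e → G e u → projection d $ u A.≈ᴹ A.0ᴹ
  projection-kills {d} {e} d≢e = span-unique (projection d) (Module.0ᴹ (A ⊸ A)) λ Su →
    on-generator (S-elim Su)
    where
    on-generator : ∀ {u} → ∃ (λ n → size n ≡ e × u ≡ b n) → projection d $ u A.≈ᴹ A.0ᴹ
    on-generator (n , refl , refl) =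
      A.≈ᴹ-trans (projection-b d n) (A.≈ᴹ-reflexive (pick-≢ (b n) d≢e))

  projection-sum-kills : ∀ {k d} (g : Fin k → ℕ) (v : Vector ∣ A ∣ k) → (∀ i → G (g i) (v i)) →
                         (∀ i → d ≢ g i) → projection d $ sum v A.≈ᴹ A.0ᴹ
  projection-sum-kills {zero}  {d} g v Gv d≢ = LinearMap.0ᴹ-homo (projection d)
  projection-sum-kills {suc k} {d} g v Gv d≢ = A.≈ᴹ-trans (LinearMap.+ᴹ-homo (projection d) _ _)
    (A.≈ᴹ-trans (A.+ᴹ-cong (projection-kills (d≢ Fin.zero) (Gv Fin.zero))
      (projection-sum-kills (g ∘ Fin.suc) (v ∘ Fin.suc) (Gv ∘ Fin.suc) (d≢ ∘ Fin.suc)))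
    (A.+ᴹ-identityˡ _))

  -- An arbitrary injective `g` replaces `toℕ`, since dropping the first summand shifts the degrees
  -- of the others.
  projection-sum : ∀ {k} (g : Fin k → ℕ) → (∀ {i j} → g i ≡ g j → i ≡ j) →
                   (v : Vector ∣ A ∣ k) → (∀ i → G (g i) (v i)) →
                   ∀ i → projection (g i) $ sum v A.≈ᴹ v i
  projection-sum {suc k} g g-inj v Gv Fin.zero = A.≈ᴹ-trans (LinearMap.+ᴹ-homo (projection (g Fin.zero)) _ _)
    (A.≈ᴹ-trans (A.+ᴹ-cong (projection-fixes (Gv Fin.zero))
      (projection-sum-kills (g ∘ Fin.suc) (v ∘ Fin.suc) (Gv ∘ Fin.suc) λ i e → 0≢suc (g-inj e)))
    (A.+ᴹ-identityʳ _))
    where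
    0≢suc : ∀ {i : Fin k} → Fin.zero ≢ Fin.suc i
    0≢suc ()
  projection-sum {suc k} g g-inj v Gv (Fin.suc i) = A.≈ᴹ-trans (LinearMap.+ᴹ-homo (projection (g (Fin.suc i))) _ _)
    (A.≈ᴹ-trans (A.+ᴹ-cong (projection-kills (λ e → suc≢0 (g-inj e)) (Gv Fin.zero))
      (projection-sum (g ∘ Fin.suc) (λ e → suc-injective (g-inj e)) (v ∘ Fin.suc) (Gv ∘ Fin.suc) i))
    (A.+ᴹ-identityˡ _))
    where
    suc≢0 : ∀ {i : Fin k} → Fin.suc i ≢ Fin.zero
    suc≢0 ()

  sum-0 : ∀ k → sum {k} (λ _ → A.0ᴹ) A.≈ᴹ A.0ᴹ
  sum-0 zero    = A.≈ᴹ-refl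
  sum-0 (suc k) = A.≈ᴹ-trans (A.+ᴹ-identityˡ _) (sum-0 k)

  sum-+ : ∀ {k} (u v : Vector ∣ A ∣ k) → sum (λ i → u i A.+ᴹ v i) A.≈ᴹ sum u A.+ᴹ sum v
  sum-+ {zero}  u v = A.≈ᴹ-sym (A.+ᴹ-identityˡ _)
  sum-+ {suc k} u v = A.≈ᴹ-trans (A.+ᴹ-congˡ (sum-+ (u ∘ Fin.suc) (v ∘ Fin.suc)))
    (interchange _ _ _ _)
    where
    open CommutativeSemigroupProperties
      (CommutativeMonoid.commutativeSemigroup A.+ᴹ-commutativeMonoid) using (interchange)

  sum-* : ∀ {k} x (u : Vector ∣ A ∣ k) → sum (λ i → x A.*ₗ u i) A.≈ᴹ x A.*ₗ sum u
  sum-* {zero}  x u = A.≈ᴹ-sym (A.*ₗ-zeroʳ x)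
  sum-* {suc k} x u = A.≈ᴹ-trans (A.+ᴹ-congˡ (sum-* x (u ∘ Fin.suc))) (A.≈ᴹ-sym (A.*ₗ-distribˡ x _ _))

  -- A Kronecker delta: `pick` and `sum` recurse in step, lowering index and degree together, so the
  -- discarded summand is zero at each step.
  sum-pick : ∀ {k e} u → e < k → u A.≈ᴹ sum {k} (λ i → pick (toℕ i) e u)
  sum-pick {suc k} {zero}  u e<k       = A.≈ᴹ-sym (A.≈ᴹ-trans (A.+ᴹ-congˡ (sum-0 k)) (A.+ᴹ-identityʳ u))
  sum-pick {suc k} {suc e} u (s≤s e<k) = A.≈ᴹ-trans (sum-pick u e<k) (A.≈ᴹ-sym (A.+ᴹ-identityˡ _))

  -- A number of components that suffices for the term; `suc` because degrees start at 0.
  bound : Term N → ℕ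
  bound (gen n) = suc (size n)
  bound 𝟘       = 0
  bound (t ⊕ u) = bound t ℕ.⊔ bound u
  bound (x ⊙ t) = bound t

  -- Any sufficiently large `k` is allowed, so that both parts of `t ⊕ u` can be decomposed with the
  -- same number of components.
  sum-component : ∀ t {k} → bound t ≤ k → Ψ t A.≈ᴹ sum {k} (λ i → component (toℕ i) t)
  sum-component (gen n) t≤k = sum-pick (b n) t≤k
  sum-component 𝟘 {k}   t≤k = A.≈ᴹ-sym (sum-0 k)
  sum-component (t ⊕ u) {k} t≤k = A.≈ᴹ-trans
    (A.+ᴹ-cong (sum-component t (m⊔n≤o⇒m≤o (bound t) (bound u) t≤k))
               (sum-component u (m⊔n≤o⇒n≤o (bound t) (bound u) t≤k)))
    (A.≈ᴹ-sym (sum-+ {k} (λ i → component (toℕ i) t) (λ i → component (toℕ i) u)))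
  sum-component (x ⊙ t) {k} t≤k = A.≈ᴹ-trans (A.*ₗ-congˡ (sum-component t t≤k))
    (A.≈ᴹ-sym (sum-* {k} x (λ i → component (toℕ i) t)))

  component-homogeneous : ∀ d t → G d (component d t)
  component-homogeneous d (gen n) = pick-homogeneous d n
  component-homogeneous d 𝟘       = span0
  component-homogeneous d (t ⊕ u) = span+ (component-homogeneous d t) (component-homogeneous d u)
  component-homogeneous d (x ⊙ t) = span* x (component-homogeneous d t)

  isGrading : IsGrading A G
  isGrading = record
    { isSubmodule = λ d → record { resp = span≈ ; has0 = span0 ; has+ = span+ ; has* = λ a → span* a }
    ; spanning    = λ u → let (t , u≈Ψt) = spanned u in
        bound t , (λ i → component (toℕ i) t) , (λ i → component-homogeneous (toℕ i) t) ,
        A.≈ᴹ-trans u≈Ψt (sum-component t ℕ.≤-refl)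
    ; independent = λ k v Gv sum≈0 i → A.≈ᴹ-trans
        (A.≈ᴹ-sym (projection-sum toℕ toℕ-injective v Gv i))
        (A.≈ᴹ-trans (LinearMap.⟦⟧-cong (projection (toℕ i)) sum≈0)
                    (LinearMap.0ᴹ-homo (projection (toℕ i))))
    }

  isGradedBialgebra : {≺ₗ ≻ₗ : LinearMap A (A ⊸ A)} →
    Represents ≺ₗ prec⁺ → Represents ≻ₗ succ⁺ →
    {Δ : LinearMap A (A ⊗ᴹ A)} → (∀ n → Δ $ b n A₂.≈ᴹ Ψ₂ (δ n)) →
    IsGradedBialgebra A ≺ₗ ≻ₗ Δ G
  isGradedBialgebra ≺-prec ≻-succ {Δ} Δ-δ = record
    { isGrading = isGrading
    ; ≺-graded  = product-graded ≺-prec (λ m n → prec-size m (just n))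
    ; ≻-graded  = product-graded ≻-succ (λ m n → succ-size (just m) n)
    ; Δ-graded  = coproduct-graded Δ Δ-δ
    }

-- The coproduct on typed trees

module Instance {c ℓ₁ ℓ₂} (K : HeytingField c ℓ₁ ℓ₂) (Ω : EDS w)
                (nondegenerate : Nondegenerate Ω) where

  open TypedTrees K Ω hiding (_≺_; _≻_)
  open EDS Ω
  open FreeMonad 𝕂
  open DecoratedTrees 𝕂 Carrier
  open Reduced 𝕂 Carrier using (δ)
  open Encoding Ω
  open Homomorphism K Ω

  private
    module B = Module B
    module B₂ = Module (B ⊗ᴹ B)

  -- The inverse of `Ψ`, available because nondegeneracy makes `decode` inverse to `encode`.
  coordinates : LinearMap B (Free N)
  coordinates = uncurryₗ {M = 𝕂Ω} {N = 𝕂𝒯⁺} {P = Free N} (freeLift {P = 𝕂𝒯⁺ ⊸ Free N} λ α →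
    freeLift {P = Free N} λ T → gen (decode nondegenerate α T))

  coordinates-basis : ∀ n → coordinates $ basisᴺ n ≈ gen n
  coordinates-basis n = Module.≈ᴹ-reflexive (Free N) (≡.cong gen (decode-encode nondegenerate n))

  spanned : ∀ u → ∃ λ t → u B.≈ᴹ extend B basisᴺ t
  spanned u = (coordinates $ u) ,
    free⊗free-unique (idₗ B) (Ψ ∘ₗ coordinates) (λ α T →
      B.≈ᴹ-reflexive (≡.cong basis (≡.sym (encode-decode nondegenerate α T)))) u

  Generators : ℕ → Pred ∣ B ∣ _
  Generators d u = Σ[ α ∈ Carrier ] Σ[ T ∈ Tree⁺ Carrier ] vertices T ≡ d × u ≡ gen α ⊗ gen T

  generators-basis : ∀ n → Generators (size n) (basisᴺ n)
  generators-basis n = proj₁ (encode n) , proj₂ (encode n) , vertices-encode n , refl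

  generators-elim : ∀ {d u} → Generators d u → ∃ λ n → size n ≡ d × u ≡ basisᴺ n
  generators-elim (α , T , refl , refl) = decode nondegenerate α T ,
    ≡.trans (≡.sym (vertices-encode (decode nondegenerate α T)))
            (≡.cong (λ p → vertices (proj₂ p)) (encode-decode nondegenerate α T)) ,
    ≡.cong basis (≡.sym (encode-decode nondegenerate α T))

  open Spanned 𝕂 Carrier B basisᴺ spanned hiding (Ψ)
  open Uniqueness 𝕂 Carrier B basisᴺ spanned
  open Grading 𝕂 Carrier B basisᴺ spanned coordinates coordinates-basis
    Generators generators-basis generators-elim

  ≺-prec : Represents ≺ᴮ prec⁺
  ≺-prec = represents λ m n → B.≈ᴹ-sym (Ψ-prec m n)

  ≻-succ : Represents ≻ᴮ succ⁺
  ≻-succ = represents λ m n → B.≈ᴹ-sym (Ψ-succ m n)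

  Δ₀ : LinearMap B (B ⊗ᴹ B)
  Δ₀ = freeLift {P = B ⊗ᴹ B} (λ n → Ψ₂ (δ n)) ∘ₗ coordinates

  Δ₀-δ : ∀ n → Δ₀ $ basisᴺ n B₂.≈ᴹ Ψ₂ (δ n)
  Δ₀-δ n = extend-congˡ (B ⊗ᴹ B) (λ n → Ψ₂ (δ n)) (coordinates-basis n)

  Δ₀-isCoproduct : IsCoproduct Δ₀
  -- For a single node `Δ⁺` is the node tensor 1, so its `δ` computes to `𝟘`.
  Δ₀-isCoproduct = isDendriformBialgebra ≺-prec ≻-succ {Δ₀} Δ₀-δ , λ α → Δ₀-δ (node nothing α nothing)

  Δ₀-unique : ∀ Δ → IsCoproduct Δ → Δ₀ ≋ Δ
  Δ₀-unique Δ (bialgebra , vanishes) = coproduct-unique ≺-prec ≻-succ {Δ₀} {Δ}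
    (proj₁ Δ₀-isCoproduct) bialgebra λ α →
      B₂.≈ᴹ-trans (proj₂ Δ₀-isCoproduct α) (B₂.≈ᴹ-sym (vanishes α))

  -- By uniqueness any such Δ is given on the basis by `δ`, and homogeneity is read off there.
  graded : ∀ Δ → IsCoproduct Δ → IsGradedBialgebra B ≺ᴮ ≻ᴮ Δ Homogeneous
  graded Δ isCoproduct = isGradedBialgebra ≺-prec ≻-succ {Δ} λ n →
    B₂.≈ᴹ-trans (B₂.≈ᴹ-sym (Δ₀-unique Δ isCoproduct (basisᴺ n))) (Δ₀-δ n)

proposition39 : ∀ {c ℓ₁ ℓ₂ w} (K : HeytingField c ℓ₁ ℓ₂) (Ω : EDS w) → Nondegenerate Ω →
    let open TypedTrees K Ω in
    ∃! _≋_ IsCoproduct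
    × (∀ Δ → IsCoproduct Δ → IsGradedBialgebra B ≺ᴮ ≻ᴮ Δ Homogeneous)
proposition39 K Ω nondegenerate =
  (Δ₀ , Δ₀-isCoproduct , λ {Δ} → Δ₀-unique Δ) , graded
  where open Instance K Ω nondegenerate
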